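{- There is a constant $c$ and a choice of the parameter $G=\Theta(\log(1/\beta))$ such that for every $\beta\in(0,1)$, every $\varepsilon>0$, all positive integers $m\le n$ (with $G$ dividing $n$), every even $d$, and every attacker $M$: with probability at least $1-\beta$, \[ \mathrm{Manip}_{m,n}(\mathtt{RAPTOR}_{n,G,\varepsilon},\mathbf U,M)=\text{``Uniform''}, \] and for every distribution $\mathbf P$ on $[d]$ with $\|\mathbf P-\mathbf U\|_1\ge c\cdot\frac{e^\varepsilon+1}{e^\varepsilon-1}\left(\sqrt{\frac{dG}{n}\ln\frac G\beta}+\frac{mG\sqrt d}{n}\right)$, with probability at least $1-\beta$, \[ \mathrm{Manip}_{m,n}(\mathtt{RAPTOR}_{n,G,\varepsilon},\mathbf P,M)=\text{``Not uniform''}. \]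
   Context: $\mathbf U$ is the uniform distribution on $[d]$; $\|\mathbf P-\mathbf U\|_1=\sum_{j\in[d]}|\mathbf P(j)-\mathbf U(j)|$. Randomized response: for $b\in\{\pm1\}$, $R^{RR}_\varepsilon(b)$ outputs $b\cdot\frac{e^\varepsilon+1}{e^\varepsilon-1}$ with probability $\frac{e^\varepsilon}{e^\varepsilon+1}$ and $-b\cdot\frac{e^\varepsilon+1}{e^\varepsilon-1}$ otherwise. Protocol $\mathtt{RAPTOR}_{n,G,\varepsilon}$ (with parameters $m,\beta$ known to the aggregator): public randomness consists of independent uniformly random subsets $S_1,\dots,S_G\subset[d]$ of size $d/2$. Users are split into $G$ contiguous groups; group $g$ consists of users $i$ with $1+(g-1)n/G\le i\le gn/G$. A user $i$ in group $g$ with data $x_i\in[d]$ sets $x_i'=+1$ if $x_i\in S_g$ and $x_i'=-1$ otherwise, and sends $y_i\sim R^{RR}_\varepsilon(x_i')$. The aggregator sets $\alpha_G=\frac{e^\varepsilon+1}{e^\varepsilon-1}\left(\sqrt{\frac{6G}{n}\ln\frac{4G}{\beta}}+\frac{2mG}{n}\right)$, computes $\tilde p(S_g)=\frac Gn\sum_{i\text{ in group }g}y_i$ for each $g$, and outputs ``Not uniform'' if $|\tilde p(S_g)|>2\alpha_G$ for some $g$, and ``Uniform'' otherwise. Manipulation game $\mathrm{Manip}_{m,n}(\Pi,\mathbf P,M)$: the data $x_1,\dots,x_n$ are drawn i.i.d. from $\mathbf P$; the public randomness $S$ is sampled; the attacker $M$ chooses a set $C\subseteq[n]$ with $|C|=m$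 and messages $y_i\in\{\pm\frac{e^\varepsilon+1}{e^\varepsilon-1}\}$ for $i\in C$ (possibly depending on the data, $S$, and its own randomness); each $i\notin C$ independently sends its honest message; the output is the aggregator's output on $(y_1,\dots,y_n)$ and $S$. -}

module Defs where

open import Algebra.Bundles using (CommutativeRing)
open import Data.Bool.Base using (if_then_else_)
open import Data.Fin.Base using (Fin; combine; quotient)
open import Data.Fin.Properties using (any?)
open import Data.Fin.Subset using (Subset; inside; outside; _∈_; ∣_∣)
open import Data.Fin.Subset.Properties using (_∈?_)
open import Data.List.Base as List using (List; []; _∷_)
open import Data.Nat.Base as ℕ using (ℕ; zero; suc)
open import Data.Nat.Divisibility using (_∣_)
import Data.Nat.DivMod as ℕ
import Data.Nat.Properties as ℕ
open import Data.Product.Base using (∃; _×_; _,_; proj₁; proj₂)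
open import Data.Sign.Base as Sign using (Sign)
open import Data.Sum.Base using (_⊎_)
open import Data.Vec.Base as Vec using (Vec; []; _∷_; lookup)
open import Level using (0ℓ)
open import Relation.Binary.Core using (Rel)
open import Relation.Binary.Definitions using (DecidableEquality)
open import Relation.Binary.PropositionalEquality.Core using (_≡_; refl)
open import Relation.Binary.Structures using (IsStrictTotalOrder)
open import Relation.Nullary.Decidable.Core using (yes; no; does)
open import Relation.Nullary.Negation.Core using (¬_)
open import Relation.Unary using (Pred; Decidable)

-- The real numbers: a Dedekind-complete ordered field, together with the
-- exponential, logarithm and square root.  A complete ordered field is unique
-- up to isomorphism, and the laws below determine exp on the whole field, ln on
-- the positive elements and √ on the non-negative ones.  The functions _⁻¹, ln
-- and √ are total; nothing is assumed about their values elsewhere.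
-- These are the classical reals: completeness and trichotomy together entail
-- excluded middle for Set.
record RealNumbers : Set₁ where
  infix  4 _<_ _≤_
  infixl 7 _/_
  infix  8 _⁻¹

  field
    commutativeRing : CommutativeRing 0ℓ 0ℓ

  open CommutativeRing commutativeRing public renaming (Carrier to ℝ)

  field
    _<_                : Rel ℝ 0ℓ
    isStrictTotalOrder : IsStrictTotalOrder _≈_ _<_
    0<1                : 0# < 1#
    +-monoˡ-<          : ∀ {x y} z → x < y → x + z < y + z
    *-pos              : ∀ {x y} → 0# < x → 0# < y → 0# < x * y

    _⁻¹        : ℝ → ℝ
    *-inverseʳ : ∀ {x} → ¬ (x ≈ 0#) → x * x ⁻¹ ≈ 1#

  open IsStrictTotalOrder isStrictTotalOrder public
    using (compare; _<?_; <-resp-≈; <-respˡ-≈; <-respʳ-≈)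
    renaming (trans to <-trans; irrefl to <-irrefl; asym to <-asym; _≟_ to _≈?_)

  _≤_ : Rel ℝ 0ℓ
  x ≤ y = x < y ⊎ x ≈ y

  UpperBound : Pred ℝ 0ℓ → ℝ → Set
  UpperBound A u = ∀ {a} → A a → a ≤ u

  -- "Least" is expressed by approximation from below: no b < s bounds A.
  IsSupremum : Pred ℝ 0ℓ → ℝ → Set
  IsSupremum A s = UpperBound A s × (∀ {b} → b < s → ∃ λ a → A a × b < a)

  field
    complete : (A : Pred ℝ 0ℓ) → ∃ A → ∃ (UpperBound A) → ∃ (IsSupremum A)

    exp      : ℝ → ℝ
    exp-cong : ∀ {x y} → x ≈ y → exp x ≈ exp y
    exp-+    : ∀ x y → exp (x + y) ≈ exp x * exp y
    1+x≤exp  : ∀ x → 1# + x ≤ exp x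

    ln     : ℝ → ℝ
    exp-ln : ∀ {x} → 0# < x → exp (ln x) ≈ x

    √        : ℝ → ℝ
    √-nonNeg : ∀ {x} → 0# ≤ x → 0# ≤ √ x
    √-square : ∀ {x} → 0# ≤ x → √ x * √ x ≈ x

  _/_ : ℝ → ℝ → ℝ
  x / y = x * y ⁻¹

  abs : ℝ → ℝ
  abs x = if does (x <? 0#) then - x else x

  open import Algebra.Definitions.RawMonoid +-rawMonoid public
    using (sum) renaming (_×_ to _·_)

  fromℕ : ℕ → ℝ
  fromℕ n = n · 1#

data Verdict : Set where
  uniform notUniform : Verdict

infix 4 _≟ᵛ_

_≟ᵛ_ : DecidableEquality Verdict
uniform    ≟ᵛ uniform    = yes refl
uniform    ≟ᵛ notUniform = no λ ()
notUniform ≟ᵛ uniform    = no λ ()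
notUniform ≟ᵛ notUniform = yes refl

record Corruption (m n : ℕ) : Set where
  field
    C       : Subset n
    ∣C∣≡m   : ∣ C ∣ ≡ m
    message : ∀ i → i ∈ C → Sign

subsets : ∀ d → List (Subset d)
subsets zero    = [] ∷ []
subsets (suc d) = List.map (inside ∷_) (subsets d) List.++ List.map (outside ∷_) (subsets d)

halves : ∀ d → List (Subset d)
halves d = List.filter (λ S → ∣ S ∣ ℕ.≟ d ℕ./ 2) (subsets d)

module Game (ℛ : RealNumbers) where
  open RealNumbers ℛ

  -- Finitely supported weighted outcomes.  Repeated outcomes are allowed; the
  -- weight of an event is the sum over all entries lying in it.
  Weighted : Set → Set
  Weighted A = List (ℝ × A)

  total : List ℝ → ℝ
  total = List.foldr _+_ 0#

  IsProbability : ∀ {A} → Weighted A → Set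
  IsProbability D =
    (∀ i → 0# ≤ proj₁ (List.lookup D i)) × total (List.map proj₁ D) ≈ 1#

  ℙ : ∀ {A} → Weighted A → {E : Pred A 0ℓ} → Decidable E → ℝ
  ℙ D E? = total (List.map proj₁ (List.filter (λ (_ , a) → E? a) D))

  pure : ∀ {A} → A → Weighted A
  pure a = (1# , a) ∷ []

  infixl 1 _>>=_

  _>>=_ : ∀ {A B} → Weighted A → (A → Weighted B) → Weighted B
  D >>= f = List.concatMap (λ (p , a) → List.map (λ (q , b) → p * q , b) (f a)) D

  independent : ∀ {A n} → Vec (Weighted A) n → Weighted (Vec A n)
  independent []       = pure []
  independent (D ∷ Ds) = do
    a  ← D
    as ← independent Ds
    pure (a ∷ as)

  uniformOn : ∀ {A} → List A → Weighted A
  uniformOn as = List.map (λ a → 1# / fromℕ (List.length as) , a) as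

  IsDistribution : ∀ {d} → (Fin d → ℝ) → Set
  IsDistribution P = (∀ j → 0# ≤ P j) × sum P ≈ 1#

  sample : ∀ {d} → (Fin d → ℝ) → Weighted (Fin d)
  sample P = List.tabulate (λ j → P j , j)

  𝐔 : ∀ {d} → Fin d → ℝ
  𝐔 {d} _ = 1# / fromℕ d

  ‖_-_‖₁ : ∀ {d} → (Fin d → ℝ) → (Fin d → ℝ) → ℝ
  ‖ P - Q ‖₁ = sum (λ j → abs (P j - Q j))

  rrScale : ℝ → ℝ
  rrScale ε = (exp ε + 1#) / (exp ε - 1#)

  -- The two possible messages ± rrScale ε are represented by their signs.
  messageValue : ℝ → Sign → ℝ
  messageValue ε Sign.+ = rrScale ε
  messageValue ε Sign.- = - rrScale ε

  randomizedResponse : ℝ → Sign → Weighted Sign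
  randomizedResponse ε b = (p , b) ∷ (1# - p , Sign.opposite b) ∷ []
    where p = exp ε / (exp ε + 1#)

  -- RAPTOR for n = G * k users.  The j-th user of group g is user combine g j,
  -- that is g * k + j counting from 0, so the groups are the G contiguous
  -- blocks of k = n / G users.
  module RAPTOR (G k : ℕ) (ε : ℝ) (m : ℕ) (β : ℝ) {d : ℕ} where

    n : ℕ
    n = G ℕ.* k

    encode : Subset d → Fin d → Sign
    encode S x = if does (x ∈? S) then Sign.+ else Sign.-

    honest : Vec (Subset d) G → Fin n → Fin d → Weighted Sign
    honest S i x = randomizedResponse ε (encode (lookup S (quotient k i)) x)

    publicRandomness : Weighted (Vec (Subset d) G)
    publicRandomness = independent (Vec.replicate G (uniformOn (halves d)))

    α : ℝ
    α = rrScale ε *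
        ( √ ((fromℕ 6 * fromℕ G) / fromℕ n * ln ((fromℕ 4 * fromℕ G) / β))
        + (fromℕ 2 * fromℕ m * fromℕ G) / fromℕ n )

    p̃ : Vec Sign n → Fin G → ℝ
    p̃ y g = fromℕ G / fromℕ n *
            sum (λ (j : Fin k) → messageValue ε (lookup y (combine g j)))

    aggregate : Vec Sign n → Verdict
    aggregate y = if does (any? (λ g → fromℕ 2 * α <? abs (p̃ y g)))
                  then notUniform else uniform

    -- The attack set is finite, so a randomized attacker is a map from what it
    -- sees to distributions on attacks.
    record Attacker : Set where
      field
        strategy      : Vec (Fin d) n → Vec (Subset d) G → Weighted (Corruption m n)
        isProbability : ∀ x S → IsProbability (strategy x S)

    respond : Vec (Fin d) n → Vec (Subset d) G → Corruption m n → Fin n → Weighted Sign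
    respond x S a i with i ∈? Corruption.C a
    ... | yes i∈C = pure (Corruption.message a i i∈C)
    ... | no  _   = honest S i (lookup x i)

    Manip : (Fin d → ℝ) → Attacker → Weighted Verdict
    Manip P M = do
      x ← independent (Vec.replicate n (sample P))
      S ← publicRandomness
      a ← Attacker.strategy M x S
      y ← independent (Vec.tabulate (respond x S a))
      pure (aggregate y)

    distanceThreshold : ℝ → ℝ
    distanceThreshold c = c * rrScale ε *
      ( √ ((fromℕ d * fromℕ G) / fromℕ n * ln (fromℕ G / β))
      + (fromℕ m * fromℕ G * √ (fromℕ d)) / fromℕ n )

    AcceptsUniform : Attacker → Set
    AcceptsUniform M = 1# - β ≤ ℙ (Manip 𝐔 M) (_≟ᵛ uniform)

    RejectsFar : ℝ → Attacker → Set
    RejectsFar c M = ∀ P → IsDistribution P → distanceThreshold c ≤ ‖ P - 𝐔 ‖₁ →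
                     1# - β ≤ ℙ (Manip P M) (_≟ᵛ notUniform)

  -- G(β) = Θ(log(1/β)) as β → 0.  The bounds cannot be asked for on all of
  -- (0,1), since ln (1/β) → 0 as β → 1 while G(β) ≥ 1.
  IsΘ-log1/ : (ℝ → ℕ) → Set
  IsΘ-log1/ G =
    ∃ λ a → ∃ λ b → ∃ λ β₀ → 0# < a × 0# < b × 0# < β₀ ×
      (∀ β → 0# < β → β < β₀ →
        a * ln (1# / β) ≤ fromℕ (G β) × fromℕ (G β) ≤ b * ln (1# / β))

  -- The two guarantees for all parameters other than c and G; the users number
  -- n = G β * k, i.e. n ranges over the multiples of G β.
  Guarantees : ℝ → (ℝ → ℕ) → Set
  Guarantees c G =
    ∀ β → 0# < β → β < 1# →
    ∀ ε → 0# < ε →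
    ∀ k m → 1 ℕ.≤ m → m ℕ.≤ G β ℕ.* k →
    ∀ d → 1 ℕ.≤ d → 2 ∣ d →
    (M : RAPTOR.Attacker (G β) k ε m β {d}) →
      RAPTOR.AcceptsUniform (G β) k ε m β M × RAPTOR.RejectsFar (G β) k ε m β c M

  PositiveOn⟨0,1⟩ : (ℝ → ℕ) → Set
  PositiveOn⟨0,1⟩ G = ∀ β → 0# < β → β < 1# → 1 ℕ.≤ G β

{-# OPTIONS --safe #-}
-- Take G = 4 + ⌈12 ln (2/β)⌉ groups of κ = n / G users, and c = 48.
--
-- Concentration.  From 1 + x ≤ exp x alone one gets exp x ≤ x + exp (2 x²), so a
-- centred variable bounded by B satisfies E exp (θ X) ≤ exp (2 θ² B²).  Markov's
-- inequality for the exponential moments then bounds the probability that the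
-- honest messages of a group deviate from their mean, and m corruptions move a
-- group sum by at most 2 m (e^ε + 1) / (e^ε - 1), whatever the attacker sees.
-- Under the uniform distribution the mean of every group is 0.
--
-- Anticoncentration.  Let δ = P - U, V = Σ δ², and Z = Σ ± δ over a random half S,
-- which is the mean message of a group using S.  Exchanging the roles of i and j
-- preserves the law of S, and summing over all pairs (i, j) gives V ≤ E Z² and
-- E Z⁴ ≤ 6 V E Z².  By the Paley–Zygmund argument 4 Z² ≥ V has probability at
-- least 1/12, so with probability 1 - β/2 some group has a mean of size at least
-- √V / 2 ≥ ‖δ‖₁ / (2 √d), which exceeds what noise and corruption can hide.
module Submission where

open import Algebra.Solver.Ring.AlmostCommutativeRing using (fromCommutativeRing; _-Raw-AlmostCommutative⟶_; Induced-equivalence)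
import Algebra.Solver.Ring
open import Data.Bool.Base using (Bool; true; false; if_then_else_)
open import Data.Fin.Base as Fin using (Fin; zero; suc; combine; quotient)
import Data.Fin.Properties as Fin
open import Data.Fin.Properties using (any?)
open import Data.Fin.Subset using (Subset; inside; outside; ∣_∣; _∈_)
open import Data.Fin.Subset.Properties using (_∈?_)
open import Data.Integer.Base as ℤ using (ℤ; +_; -[1+_])
import Data.Integer.Properties as ℤ
open import Data.List.Base as List using (List; []; _∷_)
import Data.List.Membership.Propositional as ListMem
import Data.List.Membership.Propositional.Properties as ListMem
import Data.List.Properties as List
open import Data.List.Relation.Unary.All using (All; []; _∷_)
open import Data.List.Relation.Unary.All.Properties using (all-filter)
open import Data.List.Relation.Unary.Any using (here; there)
open import Data.Maybe.Base using (just; nothing)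
open import Data.Nat.Base as ℕ using (ℕ; zero; suc)
open import Data.Nat.Divisibility using (_∣_)
import Data.Nat.DivMod as ℕ
import Data.Nat.Properties as ℕ
open import Data.Product.Base using (∃; _×_; _,_; proj₁; proj₂)
open import Data.Sign.Base as Sign using (Sign)
open import Data.Sum.Base as Sum using (_⊎_; inj₁; inj₂)
open import Data.Unit.Base using (⊤; tt)
open import Data.Vec.Base as Vec using (Vec; []; _∷_; lookup; _[_]≔_)
open import Data.Vec.Properties using (lookup∘tabulate; lookup-replicate; lookup∘update; lookup∘update′; []=⇒lookup)
open import Defs
open import Function.Base using (_∘_)
open import Level using (0ℓ)
open import Relation.Binary.Bundles using (StrictPartialOrder)
open import Relation.Binary.Definitions using (WeaklyDecidable; tri<; tri≈; tri>)
open import Relation.Binary.PropositionalEquality.Core as ≡ using (_≡_)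
open import Relation.Binary.Structures using (IsStrictTotalOrder)
open import Relation.Nullary.Decidable using (¬?)
open import Relation.Nullary.Decidable.Core using (Dec; yes; no; does)
open import Relation.Nullary.Negation.Core using (¬_; contradiction)
open import Relation.Unary using (Pred; Decidable)

-- The attacker sees the data and the subsets, so the messages actually sent have no independence to
-- exploit. Bounds are therefore pointwise first: the verdict on the received `y` is compared with
-- an exponential functional of an honest transcript `z`, for all pairs agreeing off a set of size
-- `m`, and only then averaged. In the honest transcript data and response noise are averaged
-- together; for fixed subsets the messages of a group are i.i.d., and one tail bound covers
-- sampling error and noise.
--
-- The `4G` in the logarithm of `α` makes a two-sided tail, 2 exp (-ℓ), equal to β/(2G). Under the
-- uniform distribution this is summed over all groups. For a far distribution it is paid once, for
-- a group with large mean chosen from the subsets alone; the other β/2 is the chance that no such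
-- group exists, and 12 ln (2/β) ≤ G makes (11/12)^G that small.
--
-- A half of fixed size has dependent coordinates, so the moments of Z cannot be computed as for
-- independent signs. Exchanging pairs takes the place of independence, in the manner of Stein's
-- method of exchangeable pairs.

module Proof (ℛ : RealNumbers) where
  open RealNumbers ℛ hiding (zero)
  open Game ℛ
  open import Algebra.Properties.Ring ring using (-0#≈0#; -‿distribˡ-*; -‿distribʳ-*; -‿involutive; -‿+-comm)
  open import Algebra.Properties.Monoid.Mult +-monoid using (×-homo-+)
  open import Algebra.Properties.Semiring.Mult semiring using (×1-homo-*)

  -- Integer coefficients for the ring solver

  ⟦_⟧₀ : ℤ → ℝ
  ⟦ + n ⟧₀      = fromℕ n
  ⟦ -[1+ n ] ⟧₀ = - fromℕ (suc n)

  fromℕ-+ : ∀ m n → fromℕ (m ℕ.+ n) ≈ fromℕ m + fromℕ n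
  fromℕ-+ = ×-homo-+ 1#

  fromℕ-* : ∀ m n → fromℕ (m ℕ.* n) ≈ fromℕ m * fromℕ n
  fromℕ-* = ×1-homo-*

  module _ where
    open import Relation.Binary.Reasoning.Setoid setoid

    ⟦⊖⟧₀ : ∀ m n → ⟦ m ℤ.⊖ n ⟧₀ ≈ fromℕ m - fromℕ n
    ⟦⊖⟧₀ m zero = sym (trans (+-congˡ -0#≈0#) (+-identityʳ _))
    ⟦⊖⟧₀ zero (suc n) = sym (+-identityˡ _)
    ⟦⊖⟧₀ (suc m) (suc n) = begin
      ⟦ suc m ℤ.⊖ suc n ⟧₀                   ≡⟨ ≡.cong ⟦_⟧₀ (ℤ.[1+m]⊖[1+n]≡m⊖n m n) ⟩
      ⟦ m ℤ.⊖ n ⟧₀                           ≈⟨ ⟦⊖⟧₀ m n ⟩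
      fromℕ m - fromℕ n                     ≈⟨ +-congˡ (+-identityˡ _) ⟨
      fromℕ m + (0# - fromℕ n)              ≈⟨ +-congˡ (+-congʳ (-‿inverseʳ 1#)) ⟨
      fromℕ m + ((1# - 1#) - fromℕ n)       ≈⟨ +-congˡ (+-assoc _ _ _) ⟩
      fromℕ m + (1# + (- 1# - fromℕ n))     ≈⟨ +-assoc _ _ _ ⟨
      fromℕ m + 1# + (- 1# - fromℕ n)       ≈⟨ +-cong (+-comm _ _) (-‿+-comm _ _) ⟩
      fromℕ (suc m) - fromℕ (suc n)         ∎

    ⟦⟧₀-+ : ∀ i j → ⟦ i ℤ.+ j ⟧₀ ≈ ⟦ i ⟧₀ + ⟦ j ⟧₀
    ⟦⟧₀-+ (+ m) (+ n) = fromℕ-+ m n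
    ⟦⟧₀-+ (+ m) -[1+ n ] = ⟦⊖⟧₀ m (suc n)
    ⟦⟧₀-+ -[1+ m ] (+ n) = trans (⟦⊖⟧₀ n (suc m)) (+-comm _ _)
    ⟦⟧₀-+ -[1+ m ] -[1+ n ] = begin
      - fromℕ (suc (suc (m ℕ.+ n)))   ≡⟨ ≡.cong (λ k → - fromℕ (suc k)) (ℕ.+-suc m n) ⟨
      - fromℕ (suc m ℕ.+ suc n)       ≈⟨ -‿cong (fromℕ-+ (suc m) (suc n)) ⟩
      - (fromℕ (suc m) + fromℕ (suc n)) ≈⟨ -‿+-comm _ _ ⟨
      - fromℕ (suc m) - fromℕ (suc n) ∎

    ⟦⟧₀-neg : ∀ i → ⟦ ℤ.- i ⟧₀ ≈ - ⟦ i ⟧₀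
    ⟦⟧₀-neg (+ zero) = sym -0#≈0#
    ⟦⟧₀-neg (+ suc n) = refl
    ⟦⟧₀-neg -[1+ n ] = sym (-‿involutive _)

    ⟦-◃⟧₀ : ∀ n → ⟦ Sign.- ℤ.◃ n ⟧₀ ≈ - fromℕ n
    ⟦-◃⟧₀ zero = sym -0#≈0#
    ⟦-◃⟧₀ (suc n) = refl

    ⟦+◃⟧₀ : ∀ n → ⟦ Sign.+ ℤ.◃ n ⟧₀ ≈ fromℕ n
    ⟦+◃⟧₀ zero = refl
    ⟦+◃⟧₀ (suc n) = refl

    ⟦⟧₀-* : ∀ i j → ⟦ i ℤ.* j ⟧₀ ≈ ⟦ i ⟧₀ * ⟦ j ⟧₀
    ⟦⟧₀-* (+ m) (+ n) = trans (⟦+◃⟧₀ (m ℕ.* n)) (fromℕ-* m n)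
    ⟦⟧₀-* (+ m) -[1+ n ] = begin
      ⟦ Sign.- ℤ.◃ m ℕ.* suc n ⟧₀   ≈⟨ ⟦-◃⟧₀ (m ℕ.* suc n) ⟩
      - fromℕ (m ℕ.* suc n)        ≈⟨ -‿cong (fromℕ-* m (suc n)) ⟩
      - (fromℕ m * fromℕ (suc n))  ≈⟨ -‿distribʳ-* _ _ ⟩
      fromℕ m * - fromℕ (suc n)    ∎
    ⟦⟧₀-* -[1+ m ] (+ n) = begin
      ⟦ Sign.- ℤ.◃ suc m ℕ.* n ⟧₀   ≈⟨ ⟦-◃⟧₀ (suc m ℕ.* n) ⟩
      - fromℕ (suc m ℕ.* n)        ≈⟨ -‿cong (fromℕ-* (suc m) n) ⟩
      - (fromℕ (suc m) * fromℕ n)  ≈⟨ -‿distribˡ-* _ _ ⟩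
      - fromℕ (suc m) * fromℕ n    ∎
    ⟦⟧₀-* -[1+ m ] -[1+ n ] = begin
      fromℕ (suc m ℕ.* suc n)            ≈⟨ fromℕ-* (suc m) (suc n) ⟩
      fromℕ (suc m) * fromℕ (suc n)      ≈⟨ -‿involutive _ ⟨
      - - (fromℕ (suc m) * fromℕ (suc n)) ≈⟨ -‿cong (-‿distribʳ-* _ _) ⟩
      - (fromℕ (suc m) * - fromℕ (suc n)) ≈⟨ -‿distribˡ-* _ _ ⟩
      - fromℕ (suc m) * - fromℕ (suc n)  ∎

  -- Agrees with ⟦_⟧₀, but takes the numeral 1 to 1# rather than to 1# + 0#.
  ⟦_⟧ : ℤ → ℝ
  ⟦ + 1 ⟧ = 1#
  ⟦ i ⟧   = ⟦ i ⟧₀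

  ⟦⟧≈⟦⟧₀ : ∀ i → ⟦ i ⟧ ≈ ⟦ i ⟧₀
  ⟦⟧≈⟦⟧₀ (+ zero)        = refl
  ⟦⟧≈⟦⟧₀ (+ 1)           = sym (+-identityʳ 1#)
  ⟦⟧≈⟦⟧₀ (+ suc (suc n)) = refl
  ⟦⟧≈⟦⟧₀ -[1+ n ]        = refl

  ℤ-morphism : ℤ.+-*-rawRing -Raw-AlmostCommutative⟶ fromCommutativeRing commutativeRing
  ℤ-morphism = record
    { ⟦_⟧    = ⟦_⟧
    ; +-homo = λ i j → trans (⟦⟧≈⟦⟧₀ (i ℤ.+ j)) (trans (⟦⟧₀-+ i j) (+-cong (sym (⟦⟧≈⟦⟧₀ i)) (sym (⟦⟧≈⟦⟧₀ j))))
    ; *-homo = λ i j → trans (⟦⟧≈⟦⟧₀ (i ℤ.* j)) (trans (⟦⟧₀-* i j) (*-cong (sym (⟦⟧≈⟦⟧₀ i)) (sym (⟦⟧≈⟦⟧₀ j))))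
    ; -‿homo = λ i → trans (⟦⟧≈⟦⟧₀ (ℤ.- i)) (trans (⟦⟧₀-neg i) (-‿cong (sym (⟦⟧≈⟦⟧₀ i))))
    ; 0-homo = refl
    ; 1-homo = refl
    }

  ⟦⟧-≟ : WeaklyDecidable (Induced-equivalence ℤ-morphism)
  ⟦⟧-≟ i j with i ℤ.≟ j
  ... | yes i≡j = just (reflexive (≡.cong ⟦_⟧ i≡j))
  ... | no  _   = nothing

  open Algebra.Solver.Ring ℤ.+-*-rawRing (fromCommutativeRing commutativeRing) ℤ-morphism ⟦⟧-≟
    using (solve; _:=_; con; _:+_; _:*_; _:-_; :-_; Polynomial)

  num : ∀ {v} → ℕ → Polynomial v
  num n = con (+ n)

  -- Ordered-field arithmetic

  strictPartialOrder : StrictPartialOrder _ _ _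
  strictPartialOrder = record { isStrictPartialOrder = IsStrictTotalOrder.isStrictPartialOrder isStrictTotalOrder }

  import Relation.Binary.Construct.StrictToNonStrict _≈_ _<_ as NonStrict
  module Ineq where
    open import Relation.Binary.Reasoning.StrictPartialOrder strictPartialOrder public

  ≤-refl : ∀ {x} → x ≤ x
  ≤-refl = inj₂ refl

  ≤-reflexive : ∀ {x y} → x ≈ y → x ≤ y
  ≤-reflexive = inj₂

  <⇒≤ : ∀ {x y} → x < y → x ≤ y
  <⇒≤ = inj₁

  ≤-trans : ∀ {x y z} → x ≤ y → y ≤ z → x ≤ z
  ≤-trans = NonStrict.trans isEquivalence <-resp-≈ <-trans

  <-≤-trans : ∀ {x y z} → x < y → y ≤ z → x < z
  <-≤-trans = NonStrict.<-≤-trans <-trans <-respʳ-≈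

  ≤-<-trans : ∀ {x y z} → x ≤ y → y < z → x < z
  ≤-<-trans = NonStrict.≤-<-trans sym <-trans <-respˡ-≈

  ≮⇒≥ : ∀ {x y} → ¬ (x < y) → y ≤ x
  ≮⇒≥ {x} {y} x≮y with compare x y
  ... | tri< x<y _ _ = contradiction x<y x≮y
  ... | tri≈ _ x≈y _ = inj₂ (sym x≈y)
  ... | tri> _ _ y<x = inj₁ y<x

  <⇒≱ : ∀ {x y} → x < y → ¬ (y ≤ x)
  <⇒≱ x<y y≤x = <-irrefl refl (<-≤-trans x<y y≤x)

  ≤-antisym : ∀ {x y} → x ≤ y → y ≤ x → x ≈ y
  ≤-antisym (inj₂ x≈y) _ = x≈y
  ≤-antisym (inj₁ x<y) y≤x = contradiction y≤x (<⇒≱ x<y)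

  +-monoˡ-≤ : ∀ {x y} z → x ≤ y → x + z ≤ y + z
  +-monoˡ-≤ z (inj₁ x<y) = inj₁ (+-monoˡ-< z x<y)
  +-monoˡ-≤ z (inj₂ x≈y) = inj₂ (+-congʳ x≈y)

  +-monoʳ-≤ : ∀ {x y} z → x ≤ y → z + x ≤ z + y
  +-monoʳ-≤ {x} {y} z x≤y = begin
    z + x ≈⟨ +-comm z x ⟩
    x + z ≤⟨ +-monoˡ-≤ z x≤y ⟩
    y + z ≈⟨ +-comm y z ⟩
    z + y ∎
    where open Ineq

  +-mono-≤ : ∀ {x y u v} → x ≤ y → u ≤ v → x + u ≤ y + v
  +-mono-≤ x≤y u≤v = ≤-trans (+-monoˡ-≤ _ x≤y) (+-monoʳ-≤ _ u≤v)

  +-monoʳ-< : ∀ {x y} z → x < y → z + x < z + y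
  +-monoʳ-< z x<y = <-respˡ-≈ (+-comm _ z) (<-respʳ-≈ (+-comm _ z) (+-monoˡ-< z x<y))

  +-mono-<-≤ : ∀ {x y u v} → x < y → u ≤ v → x + u < y + v
  +-mono-<-≤ x<y u≤v = <-≤-trans (+-monoˡ-< _ x<y) (+-monoʳ-≤ _ u≤v)

  -- Polynomial inequalities are proved below by a certificate: a visibly non-negative `e` and a
  -- ring identity left to the solver.
  ≤-by : ∀ {x y e} → 0# ≤ e → y ≈ x + e → x ≤ y
  ≤-by {x} {y} {e} 0≤e y≈x+e = begin
    x      ≈⟨ +-identityʳ x ⟨
    x + 0# ≤⟨ +-monoʳ-≤ x 0≤e ⟩
    x + e  ≈⟨ y≈x+e ⟨
    y      ∎
    where open Ineq

  <-by : ∀ {x y e} → 0# < e → y ≈ x + e → x < y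
  <-by {x} 0<e y≈x+e =
    <-respˡ-≈ (+-identityʳ x) (<-respʳ-≈ (sym y≈x+e) (+-monoʳ-< x 0<e))

  ≤⇒0≤- : ∀ {x y} → x ≤ y → 0# ≤ y - x
  ≤⇒0≤- {x} {y} x≤y = begin
    0#    ≈⟨ -‿inverseʳ x ⟨
    x - x ≤⟨ +-monoˡ-≤ (- x) x≤y ⟩
    y - x ∎
    where open Ineq

  <⇒0<- : ∀ {x y} → x < y → 0# < y - x
  <⇒0<- {x} {y} x<y = <-respˡ-≈ (-‿inverseʳ x) (+-monoˡ-< (- x) x<y)

  0≤+ : ∀ {x y} → 0# ≤ x → 0# ≤ y → 0# ≤ x + y
  0≤+ 0≤x 0≤y = ≤-trans (≤-reflexive (sym (+-identityʳ 0#))) (+-mono-≤ 0≤x 0≤y)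

  0<+ : ∀ {x y} → 0# < x → 0# ≤ y → 0# < x + y
  0<+ 0<x 0≤y = ≤-<-trans (≤-reflexive (sym (+-identityʳ 0#))) (+-mono-<-≤ 0<x 0≤y)

  neg-mono-≤ : ∀ {x y} → x ≤ y → - y ≤ - x
  neg-mono-≤ {x} {y} x≤y = ≤-by (≤⇒0≤- x≤y) (solve 2 (λ x y → :- x := :- y :+ (y :- x)) refl x y)

  0≤* : ∀ {x y} → 0# ≤ x → 0# ≤ y → 0# ≤ x * y
  0≤* (inj₁ 0<x) (inj₁ 0<y) = inj₁ (*-pos 0<x 0<y)
  0≤* (inj₁ _) (inj₂ 0≈y) = inj₂ (sym (trans (*-congˡ (sym 0≈y)) (zeroʳ _)))
  0≤* (inj₂ 0≈x) _ = inj₂ (sym (trans (*-congʳ (sym 0≈x)) (zeroˡ _)))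

  0≤x² : ∀ x → 0# ≤ x * x
  0≤x² x with compare x 0#
  ... | tri> _ _ 0<x = inj₁ (*-pos 0<x 0<x)
  ... | tri≈ _ x≈0 _ = inj₂ (sym (trans (*-congʳ x≈0) (zeroˡ x)))
  ... | tri< x<0 _ _ = inj₁ (<-respʳ-≈ (solve 1 (λ x → (num 0 :- x) :* (num 0 :- x) := x :* x) refl x)
      (*-pos 0<-x 0<-x))
    where
    0<-x = <⇒0<- x<0

  *-monoˡ-≤ : ∀ {x y z} → 0# ≤ z → x ≤ y → z * x ≤ z * y
  *-monoˡ-≤ {x} {y} {z} 0≤z x≤y = ≤-by (0≤* 0≤z (≤⇒0≤- x≤y))
      (solve 3 (λ x y z → z :* y := z :* x :+ z :* (y :- x)) refl x y z)

  *-monoʳ-≤ : ∀ {x y z} → 0# ≤ z → x ≤ y → x * z ≤ y * z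
  *-monoʳ-≤ {x} {y} {z} 0≤z x≤y = ≤-by (0≤* 0≤z (≤⇒0≤- x≤y))
      (solve 3 (λ x y z → y :* z := x :* z :+ z :* (y :- x)) refl x y z)

  *-mono-≤ : ∀ {x y u v} → 0# ≤ x → 0# ≤ u → x ≤ y → u ≤ v → x * u ≤ y * v
  *-mono-≤ 0≤x 0≤u x≤y u≤v = ≤-trans (*-monoʳ-≤ 0≤u x≤y) (*-monoˡ-≤ (≤-trans 0≤x x≤y) u≤v)

  *-monoˡ-< : ∀ {x y z} → 0# < z → x < y → z * x < z * y
  *-monoˡ-< {x} {y} {z} 0<z x<y = <-by (*-pos 0<z (<⇒0<- x<y))
      (solve 3 (λ x y z → z :* y := z :* x :+ z :* (y :- x)) refl x y z)

  *-cancelˡ-≤ : ∀ {x y z} → 0# < z → z * x ≤ z * y → x ≤ y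
  *-cancelˡ-≤ 0<z zx≤zy = ≮⇒≥ λ y<x → <⇒≱ (*-monoˡ-< 0<z y<x) zx≤zy

  *-cancelˡ-< : ∀ {x y z} → 0# ≤ z → z * x < z * y → x < y
  *-cancelˡ-< {x} {y} 0≤z zx<zy with x <? y
  ... | yes x<y = x<y
  ... | no  x≮y = contradiction (*-monoˡ-≤ 0≤z (≮⇒≥ x≮y)) (<⇒≱ zx<zy)

  square-≤ : ∀ {x y} → 0# ≤ y → x * x ≤ y * y → x ≤ y
  square-≤ {x} {y} 0≤y x²≤y² = ≮⇒≥ λ y<x →
    <⇒≱ (<-by (*-pos (<⇒0<- y<x) (<-≤-trans (≤-<-trans 0≤y y<x) (≤-by 0≤y refl)))
          (solve 2 (λ x y → x :* x := y :* y :+ (x :- y) :* (x :+ y)) refl x y)) x²≤y²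

  pos⇒≉0 : ∀ {x} → 0# < x → ¬ (x ≈ 0#)
  pos⇒≉0 0<x x≈0 = <-irrefl (sym x≈0) 0<x

  x*x⁻¹≈1 : ∀ {x} → 0# < x → x * x ⁻¹ ≈ 1#
  x*x⁻¹≈1 0<x = *-inverseʳ (pos⇒≉0 0<x)

  ⁻¹-pos : ∀ {x} → 0# < x → 0# < x ⁻¹
  ⁻¹-pos {x} 0<x = *-cancelˡ-< (<⇒≤ 0<x) (<-respˡ-≈ (sym (zeroʳ x)) (<-respʳ-≈ (sym (x*x⁻¹≈1 0<x)) 0<1))

  x*[y/x]≈y : ∀ {x} y → 0# < x → x * (y / x) ≈ y
  x*[y/x]≈y {x} y 0<x = begin
    x * (y * x ⁻¹) ≈⟨ solve 3 (λ x y z → x :* (y :* z) := y :* (x :* z)) refl x y (x ⁻¹) ⟩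
    y * (x * x ⁻¹) ≈⟨ *-congˡ (x*x⁻¹≈1 0<x) ⟩
    y * 1#         ≈⟨ *-identityʳ y ⟩
    y              ∎
    where open import Relation.Binary.Reasoning.Setoid setoid

  *-cancelˡ-≈ : ∀ {x y z} → 0# < z → z * x ≈ z * y → x ≈ y
  *-cancelˡ-≈ 0<z zx≈zy = ≤-antisym (*-cancelˡ-≤ 0<z (≤-reflexive zx≈zy)) (*-cancelˡ-≤ 0<z (≤-reflexive (sym zx≈zy)))

  0≤1 : 0# ≤ 1#
  0≤1 = <⇒≤ 0<1

  0≤fromℕ : ∀ n → 0# ≤ fromℕ n
  0≤fromℕ zero = ≤-refl
  0≤fromℕ (suc n) = 0≤+ 0≤1 (0≤fromℕ n)

  -- The argument is the predecessor: `0<fromℕ 11` is the positivity of 12.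
  0<fromℕ : ∀ n → 0# < fromℕ (suc n)
  0<fromℕ n = 0<+ 0<1 (0≤fromℕ n)

  0<fromℕ′ : ∀ {n} → 1 ℕ.≤ n → 0# < fromℕ n
  0<fromℕ′ {suc n} _ = 0<fromℕ n

  fromℕ-mono : ∀ {m n} → m ℕ.≤ n → fromℕ m ≤ fromℕ n
  fromℕ-mono {n = n} ℕ.z≤n = 0≤fromℕ n
  fromℕ-mono (ℕ.s≤s m≤n) = +-monoʳ-≤ 1# (fromℕ-mono m≤n)

  fromℕ-1 : fromℕ 1 ≈ 1#
  fromℕ-1 = +-identityʳ 1#

  x≤∣x∣ : ∀ x → x ≤ abs x
  x≤∣x∣ x with x <? 0#
  ... | yes x<0 = ≤-trans (<⇒≤ x<0) (≤-trans (≤⇒0≤- (<⇒≤ x<0)) (≤-reflexive (+-identityˡ _)))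
  ... | no  _   = ≤-refl

  -x≤∣x∣ : ∀ x → - x ≤ abs x
  -x≤∣x∣ x with x <? 0#
  ... | yes _   = ≤-refl
  ... | no  x≮0 = ≤-by (0≤+ (≮⇒≥ x≮0) (≮⇒≥ x≮0)) (solve 1 (λ x → x := :- x :+ (x :+ x)) refl x)

  ∣x∣² : ∀ x → abs x * abs x ≈ x * x
  ∣x∣² x with x <? 0#
  ... | yes _ = solve 1 (λ x → (:- x) :* (:- x) := x :* x) refl x
  ... | no  _ = refl

  0≤∣x∣ : ∀ x → 0# ≤ abs x
  0≤∣x∣ x with x <? 0#
  ... | yes x<0 = ≤-trans (≤⇒0≤- (<⇒≤ x<0)) (≤-reflexive (+-identityˡ _))
  ... | no  x≮0 = ≮⇒≥ x≮0

  <∣x∣ : ∀ {x b} → b < abs x → b < x ⊎ b < - x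
  <∣x∣ {x} b<∣x∣ with x <? 0#
  ... | yes _ = inj₂ b<∣x∣
  ... | no  _ = inj₁ b<∣x∣

  ≤∣x∣ : ∀ {x b} → b ≤ abs x → b ≤ x ⊎ b ≤ - x
  ≤∣x∣ {x} b≤∣x∣ with x <? 0#
  ... | yes _ = inj₂ b≤∣x∣
  ... | no  _ = inj₁ b≤∣x∣

  -- The exponential function and the Archimedean property

  -- `exp 0#` is idempotent by `exp-+` and positive by `1+x≤exp`, so one factor cancels.
  exp-0 : exp 0# ≈ 1#
  exp-0 = *-cancelˡ-≈ (<-≤-trans 0<1 (≤-trans (≤-reflexive (sym (+-identityʳ 1#))) (1+x≤exp 0#)))
    (trans (sym (exp-+ 0# 0#)) (trans (exp-cong (+-identityʳ 0#)) (sym (*-identityʳ _))))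

  exp-inverse : ∀ x → exp x * exp (- x) ≈ 1#
  exp-inverse x = trans (sym (exp-+ x (- x))) (trans (exp-cong (-‿inverseʳ x)) exp-0)

  0<exp-nonNeg : ∀ {x} → 0# ≤ x → 0# < exp x
  0<exp-nonNeg 0≤x = <-≤-trans (0<+ 0<1 0≤x) (1+x≤exp _)

  0<exp : ∀ x → 0# < exp x
  0<exp x with x <? 0#
  ... | no  x≮0 = 0<exp-nonNeg (≮⇒≥ x≮0)
  ... | yes x<0 = *-cancelˡ-< (<⇒≤ 0<exp-x) (<-respˡ-≈ (sym (zeroʳ _))
      (<-respʳ-≈ (trans (sym (exp-inverse x)) (*-comm _ _)) 0<1))
    where
    0<exp-x : 0# < exp (- x)
    0<exp-x = 0<exp-nonNeg (≤-trans (≤⇒0≤- (<⇒≤ x<0)) (≤-reflexive (+-identityˡ _)))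

  0≤exp : ∀ x → 0# ≤ exp x
  0≤exp x = <⇒≤ (0<exp x)

  -- `exp y` is `exp x` times `exp (y - x)`, and the second factor is at least `1# + (y - x)`.
  exp-mono-< : ∀ {x y} → x < y → exp x < exp y
  exp-mono-< {x} {y} x<y = begin-strict
    exp x                    ≈⟨ *-identityʳ _ ⟨
    exp x * 1#               ≈⟨ *-congˡ (+-identityʳ 1#) ⟨
    exp x * (1# + 0#)        <⟨ *-monoˡ-< (0<exp x) (+-monoʳ-< 1# (<⇒0<- x<y)) ⟩
    exp x * (1# + (y - x))   ≤⟨ *-monoˡ-≤ (0≤exp x) (1+x≤exp (y - x)) ⟩
    exp x * exp (y - x)      ≈⟨ exp-+ x (y - x) ⟨
    exp (x + (y - x))        ≈⟨ exp-cong (solve 2 (λ x y → x :+ (y :- x) := y) refl x y) ⟩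
    exp y                    ∎
    where open Ineq

  exp-mono-≤ : ∀ {x y} → x ≤ y → exp x ≤ exp y
  exp-mono-≤ (inj₁ x<y) = inj₁ (exp-mono-< x<y)
  exp-mono-≤ (inj₂ x≈y) = inj₂ (exp-cong x≈y)

  exp-cancel-≤ : ∀ {x y} → exp x ≤ exp y → x ≤ y
  exp-cancel-≤ ex≤ey = ≮⇒≥ λ y<x → <⇒≱ (exp-mono-< y<x) ex≤ey

  1≤exp : ∀ {x} → 0# ≤ x → 1# ≤ exp x
  1≤exp 0≤x = ≤-trans (≤-reflexive (sym exp-0)) (exp-mono-≤ 0≤x)

  1<exp : ∀ {x} → 0# < x → 1# < exp x
  1<exp 0<x = <-respˡ-≈ exp-0 (exp-mono-< 0<x)

  0≤ln : ∀ {x} → 1# ≤ x → 0# ≤ ln x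
  0≤ln {x} 1≤x = exp-cancel-≤ (begin
    exp 0#     ≈⟨ exp-0 ⟩
    1#         ≤⟨ 1≤x ⟩
    x          ≈⟨ exp-ln (<-≤-trans 0<1 1≤x) ⟨
    exp (ln x) ∎)
    where open Ineq

  -- Since 1 - x ≤ exp (- x), it suffices that 1 ≤ (1 - x) (1 + x + 2 x²) = 1 + x² (1 - 2 x).
  exp≤quadratic : ∀ {x} → fromℕ 2 * x ≤ 1# → exp x ≤ 1# + x + fromℕ 2 * (x * x)
  exp≤quadratic {x} 2x≤1 = *-cancelˡ-≤ (0<exp (- x)) (begin
    exp (- x) * exp x                         ≈⟨ trans (*-comm _ _) (exp-inverse x) ⟩
    1#                                        ≤⟨ ≤-by (0≤* (0≤x² x) (≤⇒0≤- 2x≤1)) (solve 1 (λ x →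
         (num 1 :- x) :* (num 1 :+ x :+ num 2 :* (x :* x)) := num 1 :+ x :* x :* (num 1 :- num 2 :* x)) refl x) ⟩
    (1# - x) * (1# + x + fromℕ 2 * (x * x))   ≤⟨ *-monoʳ-≤ 0≤q (1+x≤exp (- x)) ⟩
    exp (- x) * (1# + x + fromℕ 2 * (x * x))  ∎)
    where
    open Ineq
    0≤q : 0# ≤ 1# + x + fromℕ 2 * (x * x)
    -- Completing the square: 8 (1 + x + 2x²) = 7 + (1 + 4x)².
    0≤q = *-cancelˡ-≤ (0<fromℕ 7) (≤-trans (≤-reflexive (zeroʳ _)) (≤-trans
      (0≤+ (0≤fromℕ 7) (0≤x² (1# + fromℕ 4 * x)))
      (≤-reflexive (solve 1 (λ x → num 7 :+ (num 1 :+ num 4 :* x) :* (num 1 :+ num 4 :* x)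
         := num 8 :* (num 1 :+ x :+ num 2 :* (x :* x))) refl x))))

  -- Up to x = 1/2 the quadratic bound applies, with 1 + 2x² ≤ exp (2x²); beyond it x ≤ 2x². The
  -- linear term is kept apart because it vanishes in expectation for a centred variable; this
  -- replaces the convexity argument of Hoeffding's lemma.
  exp≤x+exp[2x²] : ∀ x → exp x ≤ x + exp (fromℕ 2 * (x * x))
  exp≤x+exp[2x²] x with 1# <? fromℕ 2 * x
  ... | no  1≮2x = begin
    exp x                          ≤⟨ exp≤quadratic (≮⇒≥ 1≮2x) ⟩
    1# + x + fromℕ 2 * (x * x)     ≈⟨ solve 2 (λ x y → num 1 :+ x :+ y := x :+ (num 1 :+ y)) refl x _ ⟩
    x + (1# + fromℕ 2 * (x * x))   ≤⟨ +-monoʳ-≤ x (1+x≤exp _) ⟩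
    x + exp (fromℕ 2 * (x * x))    ∎
    where open Ineq
  ... | yes 1<2x = begin
    exp x                          ≤⟨ exp-mono-≤ (≤-by (0≤* 0≤x (≤⇒0≤- (<⇒≤ 1<2x)))
         (solve 1 (λ x → num 2 :* (x :* x) := x :+ x :* (num 2 :* x :- num 1)) refl x)) ⟩
    exp (fromℕ 2 * (x * x))        ≤⟨ ≤-by 0≤x (+-comm _ _) ⟩
    x + exp (fromℕ 2 * (x * x))    ∎
    where
    open Ineq
    0≤x : 0# ≤ x
    0≤x = <⇒≤ (*-cancelˡ-< (0≤fromℕ 2) (<-respˡ-≈ (sym (zeroʳ _)) (<-trans 0<1 1<2x)))

  -- Completeness is applied to the set containing 0 and, if `P` holds, 1. If the supremum is
  -- positive, some element exceeds 0; it can only be 1 and carries a proof of `P`. A supremum that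
  -- is not positive refutes `P`.
  excludedMiddle : (P : Set) → P ⊎ ¬ P
  excludedMiddle P with complete (λ x → x ≈ 0# ⊎ (x ≈ 1# × P)) (0# , inj₁ refl)
                          (1# , λ { (inj₁ a≈0) → inj₁ (<-respˡ-≈ (sym a≈0) 0<1) ; (inj₂ (a≈1 , _)) → inj₂ a≈1 })
  ... | s , upper , approx with 0# <? s
  ...   | no  0≮s = inj₂ λ p → 0≮s (<-≤-trans 0<1 (upper (inj₂ (refl , p))))
  ...   | yes 0<s with approx 0<s
  ...     | _ , inj₁ a≈0 , 0<a = contradiction 0<a (<-irrefl (sym a≈0))
  ...     | _ , inj₂ (_ , p) , _ = inj₁ p

  -- If no natural number exceeded `x`, the naturals would have a supremum `s`; some `n` lies above
  -- `s - 1#`, hence its successor above `s`. Excluded middle turns this refutation into a witness.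
  archimedean : ∀ x → ∃ λ n → x < fromℕ n
  archimedean x with excludedMiddle (∃ λ n → x < fromℕ n)
  ... | inj₁ above = above
  ... | inj₂ none with complete (λ a → ∃ λ n → a ≈ fromℕ n) (0# , 0 , refl)
                         (x , λ { (n , a≈n) → ≤-trans (≤-reflexive a≈n) (≮⇒≥ λ x<n → none (n , x<n)) })
  ...   | s , upper , approx with approx {s - 1#} (<-by 0<1 (solve 1 (λ s → s := s :- num 1 :+ num 1) refl s))
  ...     | a , (n , a≈n) , s-1<a = contradiction (upper (suc n , refl)) (<⇒≱ (begin-strict
    s                ≈⟨ solve 1 (λ s → s := num 1 :+ (s :- num 1)) refl s ⟩
    1# + (s - 1#)    <⟨ +-monoʳ-< 1# s-1<a ⟩
    1# + a           ≈⟨ +-congˡ a≈n ⟩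
    fromℕ (suc n)    ∎))
    where open Ineq

  -- Descends from `n` as long as the predecessor still exceeds `x`. Where it stops, k - 1 ≤ x;
  -- reaching 0 is possible only for negative `x`, which is why the upper bound is conditional.
  least-above : ∀ x n → x < fromℕ n → ∃ λ k → x < fromℕ k × (0# ≤ x → fromℕ k ≤ x + 1#)
  least-above x zero x<0 = 0 , x<0 , λ 0≤x → contradiction 0≤x (<⇒≱ x<0)
  least-above x (suc n) x<1+n with x <? fromℕ n
  ... | yes x<n = least-above x n x<n
  ... | no  x≮n = suc n , x<1+n , λ _ → ≤-trans (+-monoʳ-≤ 1# (≮⇒≥ x≮n)) (≤-reflexive (+-comm 1# x))

  -- The least natural number strictly above the argument: one more than the usual ceiling at a
  -- natural number, and 0 at negative arguments.
  ⌈_⌉ : ℝ → ℕ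
  ⌈ x ⌉ = proj₁ (least-above x (proj₁ (archimedean x)) (proj₂ (archimedean x)))

  x<⌈x⌉ : ∀ x → x < fromℕ ⌈ x ⌉
  x<⌈x⌉ x = proj₁ (proj₂ (least-above x (proj₁ (archimedean x)) (proj₂ (archimedean x))))

  ⌈x⌉≤x+1 : ∀ {x} → 0# ≤ x → fromℕ ⌈ x ⌉ ≤ x + 1#
  ⌈x⌉≤x+1 {x} = proj₂ (proj₂ (least-above x (proj₁ (archimedean x)) (proj₂ (archimedean x))))

  -- Finite sums and products

  open import Algebra.Properties.CommutativeMonoid.Sum +-commutativeMonoid using (sum-cong-≋; ∑-distrib-+)
  open import Algebra.Properties.Semiring.Sum semiring using (*-distribˡ-sum)

  module Eq where
    open import Relation.Binary.Reasoning.Setoid setoid public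

  sum-cong : ∀ {n} {f g : Fin n → ℝ} → (∀ i → f i ≈ g i) → sum f ≈ sum g
  sum-cong = sum-cong-≋

  sum-+ : ∀ {n} (f g : Fin n → ℝ) → sum (λ i → f i + g i) ≈ sum f + sum g
  sum-+ = ∑-distrib-+

  sum-* : ∀ {n} c (f : Fin n → ℝ) → sum (λ i → c * f i) ≈ c * sum f
  sum-* c f = sym (*-distribˡ-sum c f)

  sum-neg : ∀ {n} (f : Fin n → ℝ) → sum (λ i → - f i) ≈ - sum f
  sum-neg f = begin
    sum (λ i → - f i)         ≈⟨ sum-cong (λ i → solve 1 (λ x → :- x := :- num 1 :* x) refl (f i)) ⟩
    sum (λ i → - 1# * f i)    ≈⟨ sum-* (- 1#) f ⟩
    - 1# * sum f              ≈⟨ solve 1 (λ x → :- x := :- num 1 :* x) refl (sum f) ⟨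
    - sum f                   ∎
    where open Eq

  sum-minus : ∀ {n} (f g : Fin n → ℝ) → sum (λ i → f i - g i) ≈ sum f - sum g
  sum-minus f g = trans (sum-+ f (λ i → - g i)) (+-congˡ (sum-neg g))

  sum-const : ∀ n x → sum {n} (λ _ → x) ≈ fromℕ n * x
  sum-const zero x = sym (zeroˡ x)
  sum-const (suc n) x = trans (+-congˡ (sum-const n x))
      (solve 2 (λ x n → x :+ n :* x := (num 1 :+ n) :* x) refl x (fromℕ n))

  sum-mono : ∀ {n} {f g : Fin n → ℝ} → (∀ i → f i ≤ g i) → sum f ≤ sum g
  sum-mono {zero} f≤g = ≤-refl
  sum-mono {suc n} f≤g = +-mono-≤ (f≤g zero) (sum-mono (f≤g ∘ suc))

  sum-0≤ : ∀ {n} {f : Fin n → ℝ} → (∀ i → 0# ≤ f i) → 0# ≤ sum f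
  sum-0≤ {zero} _ = ≤-refl
  sum-0≤ {suc n} 0≤f = 0≤+ (0≤f zero) (sum-0≤ (0≤f ∘ suc))

  term≤sum : ∀ {n} {f : Fin n → ℝ} → (∀ i → 0# ≤ f i) → ∀ i → f i ≤ sum f
  term≤sum 0≤f zero = ≤-by (sum-0≤ (0≤f ∘ suc)) refl
  term≤sum 0≤f (suc i) = ≤-trans (term≤sum (0≤f ∘ suc) i) (≤-by (0≤f zero) (+-comm _ _))

  sum-zero : ∀ {n} {f : Fin n → ℝ} → (∀ i → f i ≈ 0#) → sum f ≈ 0#
  sum-zero {n} f≈0 = trans (sum-cong f≈0) (trans (sum-const n 0#) (zeroʳ _))

  sum-single : ∀ {n} (f : Fin n → ℝ) j → (∀ i → ¬ (i ≡ j) → f i ≈ 0#) → sum f ≈ f j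
  sum-single f zero f≈0 = trans (+-congˡ (sum-zero λ i → f≈0 (suc i) λ ())) (+-identityʳ _)
  sum-single f (suc j) f≈0 = trans (+-cong (f≈0 zero λ ())
      (sum-single (f ∘ suc) j λ i i≢j → f≈0 (suc i) (i≢j ∘ Fin.suc-injective))) (+-identityˡ _)

  sum-++ : ∀ m {n} (f : Fin (m ℕ.+ n) → ℝ) → sum f ≈ sum (λ i → f (i Fin.↑ˡ n)) + sum (λ i → f (m Fin.↑ʳ i))
  sum-++ zero f = sym (+-identityˡ _)
  sum-++ (suc m) f = trans (+-congˡ (sum-++ m (f ∘ suc))) (sym (+-assoc _ _ _))

  sum-combine : ∀ G {k} (f : Fin (G ℕ.* k) → ℝ) → sum f ≈ sum (λ (g : Fin G) → sum (λ (j : Fin k) → f (combine g j)))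
  sum-combine zero f = refl
  sum-combine (suc G) {k} f = trans (sum-++ k f) (+-congˡ (sum-combine G (λ i → f (k Fin.↑ʳ i))))

  -- The identity behind Chebyshev's sum inequality. With equal families it gives `cauchySchwarz`;
  -- when `b` sums to zero the last product drops out, which turns sums over exchanged pairs into
  -- `Z` and `V`.
  ∑∑-differences : ∀ {d} (a b : Fin d → ℝ) →
    sum (λ i → sum (λ j → (a i - a j) * (b i - b j))) ≈ fromℕ 2 * (fromℕ d * sum (λ i → a i * b i) - sum a * sum b)
  ∑∑-differences {d} a b = begin
    sum (λ i → sum (λ j → (a i - a j) * (b i - b j)))   ≈⟨ sum-cong row ⟩
    sum (λ i → D * c i + - A * b i + (- B * a i + AB))
        ≈⟨ trans (sum-+ {d} _ _) (+-cong (sum-+ {d} _ _) (sum-+ {d} _ _)) ⟩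
    sum (λ i → D * c i) + sum (λ i → - A * b i) + (sum (λ i → - B * a i) + sum {d} (λ _ → AB))
      ≈⟨ +-cong (+-cong (sum-* D c) (sum-* (- A) b)) (+-cong (sum-* (- B) a) (sum-const d AB)) ⟩
    D * AB + - A * B + (- B * A + D * AB)
      ≈⟨ solve 4 (λ D A B AB → D :* AB :+ :- A :* B :+ (:- B :* A :+ D :* AB) := num 2 :*
          (D :* AB :- A :* B)) refl D A B AB ⟩
    fromℕ 2 * (D * AB - A * B) ∎
    where
    open Eq
    D = fromℕ d
    A = sum a
    B = sum b
    c = λ i → a i * b i
    AB = sum c
    row : ∀ i → sum (λ j → (a i - a j) * (b i - b j)) ≈ D * c i + - A * b i + (- B * a i + AB)
    row i = begin
      sum (λ j → (a i - a j) * (b i - b j))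
        ≈⟨ sum-cong (λ j → solve 4 (λ x y z w → (x :- y) :* (z :- w) := x :* z :+ :- z :* y :+
            (:- x :* w :+ y :* w)) refl (a i) (a j) (b i) (b j)) ⟩
      sum (λ j → a i * b i + - b i * a j + (- a i * b j + a j * b j))
        ≈⟨ trans (sum-+ {d} _ _) (+-cong (sum-+ {d} _ _) (sum-+ {d} _ _)) ⟩
      sum {d} (λ _ → a i * b i) + sum (λ j → - b i * a j) + (sum (λ j → - a i * b j) + AB)
        ≈⟨ +-cong (+-cong (sum-const d _) (sum-* _ a)) (+-congʳ (sum-* _ b)) ⟩
      D * (a i * b i) + - b i * A + (- a i * B + AB)
        ≈⟨ solve 6 (λ x z A B D AB → D :* (x :* z) :+ :- z :* A :+ (:- x :* B :+ AB) := D :* (x :* z) :+ :- A :* z :+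
            (:- B :* x :+ AB)) refl (a i) (b i) A B D AB ⟩
      D * c i + - A * b i + (- B * a i + AB) ∎

  -- Twice the defect is the sum of `(a i - a j)²` over all pairs.
  cauchySchwarz : ∀ {d} (a : Fin d → ℝ) → sum a * sum a ≤ fromℕ d * sum (λ i → a i * a i)
  cauchySchwarz {d} a = *-cancelˡ-≤ (0<fromℕ 1) (≤-by
    (sum-0≤ λ i → sum-0≤ λ j → 0≤x² (a i - a j))
    (sym (trans (+-congˡ (∑∑-differences a a)) (solve 2
        (λ x y → num 2 :* y :+ num 2 :* (x :- y) := num 2 :* x) refl _ _))))

  prod : ∀ {n} → (Fin n → ℝ) → ℝ
  prod {zero} f = 1#
  prod {suc n} f = f zero * prod (f ∘ suc)

  prod-cong : ∀ {n} {f g : Fin n → ℝ} → (∀ i → f i ≈ g i) → prod f ≈ prod g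
  prod-cong {zero} f≈g = refl
  prod-cong {suc n} f≈g = *-cong (f≈g zero) (prod-cong (f≈g ∘ suc))

  prod-0≤ : ∀ {n} {f : Fin n → ℝ} → (∀ i → 0# ≤ f i) → 0# ≤ prod f
  prod-0≤ {zero} _ = 0≤1
  prod-0≤ {suc n} 0≤f = 0≤* (0≤f zero) (prod-0≤ (0≤f ∘ suc))

  prod-mono : ∀ {n} {f g : Fin n → ℝ} → (∀ i → 0# ≤ f i) → (∀ i → f i ≤ g i) → prod f ≤ prod g
  prod-mono {zero} _ _ = ≤-refl
  prod-mono {suc n} 0≤f f≤g = *-mono-≤ (0≤f zero) (prod-0≤ (0≤f ∘ suc)) (f≤g zero) (prod-mono (0≤f ∘ suc) (f≤g ∘ suc))

  prod-one : ∀ {n} {f : Fin n → ℝ} → (∀ i → f i ≈ 1#) → prod f ≈ 1#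
  prod-one {zero} _ = refl
  prod-one {suc n} f≈1 = trans (*-cong (f≈1 zero) (prod-one (f≈1 ∘ suc))) (*-identityʳ 1#)

  prod-exp : ∀ {n} (f : Fin n → ℝ) → prod (λ i → exp (f i)) ≈ exp (sum f)
  prod-exp {zero} f = sym exp-0
  prod-exp {suc n} f = trans (*-congˡ (prod-exp (f ∘ suc))) (sym (exp-+ _ _))

  -- Expectations of finitely supported distributions

  private variable
    A B : Set

  -- A plain weighted sum, so that linearity, interchange and the rule for `_>>=_` hold for any
  -- weights; non-negativity and total weight one enter through `Law`.
  𝔼 : Weighted A → (A → ℝ) → ℝ
  𝔼 []            f = 0#
  𝔼 ((p , a) ∷ D) f = p * f a + 𝔼 D f

  𝔼-cong : (D : Weighted A) {f g : A → ℝ} → (∀ a → f a ≈ g a) → 𝔼 D f ≈ 𝔼 D g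
  𝔼-cong []            f≈g = refl
  𝔼-cong ((p , a) ∷ D) f≈g = +-cong (*-congˡ (f≈g a)) (𝔼-cong D f≈g)

  𝔼-+ : (D : Weighted A) (f g : A → ℝ) → 𝔼 D (λ a → f a + g a) ≈ 𝔼 D f + 𝔼 D g
  𝔼-+ []            f g = sym (+-identityʳ 0#)
  𝔼-+ ((p , a) ∷ D) f g = trans (+-congˡ (𝔼-+ D f g))
    (solve 5 (λ p x y X Y → p :* (x :+ y) :+ (X :+ Y) := p :* x :+ X :+ (p :* y :+ Y)) refl p (f a) (g a) (𝔼 D f)
        (𝔼 D g))

  𝔼-* : (D : Weighted A) (c : ℝ) (f : A → ℝ) → 𝔼 D (λ a → c * f a) ≈ c * 𝔼 D f
  𝔼-* []            c f = sym (zeroʳ c)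
  𝔼-* ((p , a) ∷ D) c f = trans (+-congˡ (𝔼-* D c f))
    (solve 4 (λ p c x X → p :* (c :* x) :+ c :* X := c :* (p :* x :+ X)) refl p c (f a) (𝔼 D f))

  𝔼-neg : (D : Weighted A) (f : A → ℝ) → 𝔼 D (λ a → - f a) ≈ - 𝔼 D f
  𝔼-neg D f = begin
    𝔼 D (λ a → - f a)      ≈⟨ 𝔼-cong D (λ a → solve 1 (λ x → :- x := :- num 1 :* x) refl (f a)) ⟩
    𝔼 D (λ a → - 1# * f a) ≈⟨ 𝔼-* D (- 1#) f ⟩
    - 1# * 𝔼 D f           ≈⟨ solve 1 (λ x → :- x := :- num 1 :* x) refl (𝔼 D f) ⟨
    - 𝔼 D f                ∎
    where open Eq

  𝔼-zero : (D : Weighted A) → 𝔼 D (λ _ → 0#) ≈ 0#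
  𝔼-zero []            = refl
  𝔼-zero ((p , a) ∷ D) = trans (+-cong (zeroʳ p) (𝔼-zero D)) (+-identityʳ 0#)

  𝔼-sum : (D : Weighted A) {n : ℕ} (f : Fin n → A → ℝ) → 𝔼 D (λ a → sum (λ i → f i a)) ≈ sum (λ i → 𝔼 D (f i))
  𝔼-sum D {zero}  f = 𝔼-zero D
  𝔼-sum D {suc n} f = trans (𝔼-+ D (f zero) _) (+-congˡ (𝔼-sum D (f ∘ suc)))

  𝔼-comm : (D : Weighted A) (D′ : Weighted B) (f : A → B → ℝ) →
           𝔼 D (λ a → 𝔼 D′ (f a)) ≈ 𝔼 D′ (λ b → 𝔼 D (λ a → f a b))
  𝔼-comm []            D′ f = sym (𝔼-zero D′)
  𝔼-comm ((p , a) ∷ D) D′ f = begin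
    p * 𝔼 D′ (f a) + 𝔼 D (λ a → 𝔼 D′ (f a))                       ≈⟨ +-cong (sym (𝔼-* D′ p (f a))) (𝔼-comm D D′ f) ⟩
    𝔼 D′ (λ b → p * f a b) + 𝔼 D′ (λ b → 𝔼 D (λ a → f a b))       ≈⟨ 𝔼-+ D′ _ _ ⟨
    𝔼 D′ (λ b → p * f a b + 𝔼 D (λ a → f a b))                    ∎
    where open Eq

  𝔼-++ : (D D′ : Weighted A) (f : A → ℝ) → 𝔼 (D List.++ D′) f ≈ 𝔼 D f + 𝔼 D′ f
  𝔼-++ []            D′ f = sym (+-identityˡ _)
  𝔼-++ ((p , a) ∷ D) D′ f = trans (+-congˡ (𝔼-++ D D′ f)) (sym (+-assoc _ _ _))

  𝔼-scale : (p : ℝ) (D : Weighted A) (f : A → ℝ) → 𝔼 (List.map (λ (q , b) → p * q , b) D) f ≈ p * 𝔼 D f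
  𝔼-scale p []            f = sym (zeroʳ p)
  𝔼-scale p ((q , b) ∷ D) f = trans (+-congˡ (𝔼-scale p D f))
    (solve 4 (λ p q x X → p :* q :* x :+ p :* X := p :* (q :* x :+ X)) refl p q (f b) (𝔼 D f))

  𝔼->>= : (D : Weighted A) (k : A → Weighted B) (f : B → ℝ) → 𝔼 (D >>= k) f ≈ 𝔼 D (λ a → 𝔼 (k a) f)
  𝔼->>= []            k f = refl
  𝔼->>= ((p , a) ∷ D) k f = trans (𝔼-++ (List.map (λ (q , b) → p * q , b) (k a)) (D >>= k) f)
      (+-cong (𝔼-scale p (k a) f) (𝔼->>= D k f))

  𝔼-pure : (a : A) (f : A → ℝ) → 𝔼 (pure a) f ≈ f a
  𝔼-pure a f = trans (+-identityʳ _) (*-identityˡ _)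

  𝔼-∷ : (D : Weighted A) {n : ℕ} (Ds : Vec (Weighted A) n) (f : Vec A (suc n) → ℝ) →
        𝔼 (independent (D ∷ Ds)) f ≈ 𝔼 D (λ a → 𝔼 (independent Ds) (λ as → f (a ∷ as)))
  𝔼-∷ D Ds f = trans (𝔼->>= D (λ a → independent Ds >>= λ as → pure (a ∷ as)) f) (𝔼-cong D λ a →
    trans (𝔼->>= (independent Ds) (λ as → pure (a ∷ as)) f) (𝔼-cong (independent Ds) λ as → 𝔼-pure (a ∷ as) f))

  -- Serves the two places where independence yields a small number: the exponential moments of a
  -- group, and the event that every group misses.
  𝔼-independent-prod : ∀ {n} (Ds : Vec (Weighted A) n) (f : Fin n → A → ℝ) →
    𝔼 (independent Ds) (λ v → prod (λ i → f i (lookup v i))) ≈ prod (λ i → 𝔼 (lookup Ds i) (f i))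
  𝔼-independent-prod {A} [] f = 𝔼-pure {Vec A 0} [] (λ _ → 1#)
  𝔼-independent-prod (D ∷ Ds) f = begin
    𝔼 (independent (D ∷ Ds)) (λ v → prod (λ i → f i (lookup v i)))
      ≈⟨ 𝔼-∷ D Ds _ ⟩
    𝔼 D (λ a → 𝔼 (independent Ds) (λ v → f zero a * prod (λ i → f (suc i) (lookup v i))))
      ≈⟨ 𝔼-cong D (λ a → trans (𝔼-* (independent Ds) (f zero a) _)
          (trans (*-congˡ (𝔼-independent-prod Ds (f ∘ suc))) (*-comm _ _))) ⟩
    𝔼 D (λ a → rest * f zero a)  ≈⟨ 𝔼-* D rest (f zero) ⟩
    rest * 𝔼 D (f zero)          ≈⟨ *-comm _ _ ⟩
    𝔼 D (f zero) * rest          ∎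
    where
    open Eq
    rest = prod (λ i → 𝔼 (lookup Ds i) (f (suc i)))

  -- Monotonicity on Q says both that the weights are non-negative and that D is
  -- concentrated on Q.
  record Law (D : Weighted A) (Q : A → Set) : Set where
    field
      mono : {f g : A → ℝ} → (∀ a → Q a → f a ≤ g a) → 𝔼 D f ≤ 𝔼 D g
      mass : 𝔼 D (λ _ → 1#) ≈ 1#

    const≈ : ∀ c → 𝔼 D (λ _ → c) ≈ c
    const≈ c = begin
      𝔼 D (λ _ → c)        ≈⟨ 𝔼-cong D (λ _ → sym (*-identityʳ c)) ⟩
      𝔼 D (λ _ → c * 1#)   ≈⟨ 𝔼-* D c _ ⟩
      c * 𝔼 D (λ _ → 1#)   ≈⟨ *-congˡ mass ⟩
      c * 1#               ≈⟨ *-identityʳ c ⟩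
      c                    ∎
      where open Eq

    ≤-const : ∀ {c} {f : A → ℝ} → (∀ a → Q a → f a ≤ c) → 𝔼 D f ≤ c
    ≤-const f≤c = ≤-trans (mono f≤c) (≤-reflexive (const≈ _))

    const-≤ : ∀ {c} {f : A → ℝ} → (∀ a → Q a → c ≤ f a) → c ≤ 𝔼 D f
    const-≤ c≤f = ≤-trans (≤-reflexive (sym (const≈ _))) (mono c≤f)

    cong-on : {f g : A → ℝ} → (∀ a → Q a → f a ≈ g a) → 𝔼 D f ≈ 𝔼 D g
    cong-on f≈g = ≤-antisym (mono λ a q → ≤-reflexive (f≈g a q)) (mono λ a q → ≤-reflexive (sym (f≈g a q)))

  open Law

  IsLaw : Weighted A → Set
  IsLaw D = Law D (λ _ → ⊤)

  forget : {D : Weighted A} {Q : A → Set} → Law D Q → IsLaw D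
  forget L = record { mono = λ f≤g → mono L λ a _ → f≤g a tt ; mass = mass L }

  Law-pure : (a : A) → IsLaw (pure a)
  Law-pure a = record
    { mono = λ {f} {g} f≤g → ≤-trans (≤-reflexive (𝔼-pure a f)) (≤-trans (f≤g a tt) (≤-reflexive (sym (𝔼-pure a g))))
    ; mass = 𝔼-pure a _ }

  Law->>= : {D : Weighted A} {k : A → Weighted B} → IsLaw D → (∀ a → IsLaw (k a)) → IsLaw (D >>= k)
  Law->>= {D = D} {k} L K = record
    { mono = λ {f} {g} f≤g → ≤-trans (≤-reflexive (𝔼->>= D k f))
        (≤-trans (mono L λ a _ → mono (K a) f≤g) (≤-reflexive (sym (𝔼->>= D k g))))
    ; mass = trans (𝔼->>= D k _) (trans (𝔼-cong D λ a → mass (K a)) (mass L)) }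

  Law-independent : ∀ {n} (Ds : Vec (Weighted A) n) {Q : A → Set} → (∀ i → Law (lookup Ds i) Q) →
                    Law (independent Ds) (λ v → ∀ i → Q (lookup v i))
  Law-independent {A} [] _ = record
    { mono = λ {f} {g} f≤g → mono (Law-pure {Vec A 0} []) {f} {g} λ { [] _ → f≤g [] λ () }
    ; mass = 𝔼-pure {Vec A 0} [] (λ _ → 1#) }
  Law-independent (D ∷ Ds) L = record
    { mono = λ {f} {g} f≤g → ≤-trans (≤-reflexive (𝔼-∷ D Ds f)) (≤-trans
        (mono (L zero) λ a q → mono tail λ as qs → f≤g (a ∷ as) λ { zero → q ; (suc i) → qs i })
        (≤-reflexive (sym (𝔼-∷ D Ds g))))
    ; mass = trans (𝔼-∷ D Ds _) (trans (𝔼-cong D λ _ → mass tail) (mass (L zero))) }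
    where tail = Law-independent Ds (L ∘ suc)

  -- No joint law is built; coordinates are treated one at a time. Off `C` the two laws are equal
  -- and the same value is used on both sides. On `C` the inequality holds for every pair of values,
  -- and both sides are averages of total weight one.
  coupling : ∀ {n} (Ds Ds′ : Vec (Weighted A) n) → (∀ i → IsLaw (lookup Ds i)) → (∀ i → IsLaw (lookup Ds′ i)) →
    {C : Pred (Fin n) 0ℓ} → Decidable C → (∀ i → ¬ C i → lookup Ds i ≡ lookup Ds′ i) →
    (f f′ : Vec A n → ℝ) → (∀ y z → (∀ i → ¬ C i → lookup y i ≡ lookup z i) → f y ≤ f′ z) →
    𝔼 (independent Ds) f ≤ 𝔼 (independent Ds′) f′
  coupling {A} [] [] L L′ C? same f f′ f≤f′ = mono (Law-pure {Vec A 0} []) {f} {f′} λ { [] _ → f≤f′ [] [] λ () }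
  coupling (D ∷ Ds) (D′ ∷ Ds′) L L′ {C} C? same f f′ f≤f′ = begin
    𝔼 (independent (D ∷ Ds)) f                                     ≈⟨ 𝔼-∷ D Ds f ⟩
    𝔼 D (λ a → 𝔼 (independent Ds) (λ as → f (a ∷ as)))             ≤⟨ step (C? zero) ⟩
    𝔼 D′ (λ b → 𝔼 (independent Ds′) (λ bs → f′ (b ∷ bs)))          ≈⟨ 𝔼-∷ D′ Ds′ f′ ⟨
    𝔼 (independent (D′ ∷ Ds′)) f′                                  ∎
    where
    open Ineq
    rec : ∀ a b → (¬ C zero → a ≡ b) →
          𝔼 (independent Ds) (λ as → f (a ∷ as)) ≤ 𝔼 (independent Ds′) (λ bs → f′ (b ∷ bs))
    rec a b a≡b = coupling Ds Ds′ (L ∘ suc) (L′ ∘ suc) (C? ∘ suc) (same ∘ suc) _ _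
      λ y z y≡z → f≤f′ (a ∷ y) (b ∷ z) λ { zero → a≡b ; (suc i) → y≡z i }
    step : Dec (C zero) → 𝔼 D (λ a → 𝔼 (independent Ds) (λ as → f (a ∷ as))) ≤
                          𝔼 D′ (λ b → 𝔼 (independent Ds′) (λ bs → f′ (b ∷ bs)))
    step (yes c) = ≤-const (L zero) λ a _ → const-≤ (L′ zero) λ b _ → rec a b λ ¬c → contradiction c ¬c
    step (no ¬c) = ≡.subst (λ X → 𝔼 D (λ a → 𝔼 (independent Ds) (λ as → f (a ∷ as))) ≤
                          𝔼 X (λ b → 𝔼 (independent Ds′) (λ bs → f′ (b ∷ bs)))) (same zero ¬c)
                          (mono (L zero) λ a _ → rec a a λ _ → ≡.refl)

  mono-weights : {D : Weighted A} {Q : A → Set} → All (λ (p , a) → 0# ≤ p × Q a) D →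
    {f g : A → ℝ} → (∀ a → Q a → f a ≤ g a) → 𝔼 D f ≤ 𝔼 D g
  mono-weights []               f≤g = ≤-refl
  mono-weights ((0≤p , q) ∷ ws) f≤g = +-mono-≤ (*-monoˡ-≤ 0≤p (f≤g _ q)) (mono-weights ws f≤g)

  IsProbability⇒IsLaw : {D : Weighted A} → IsProbability D → IsLaw D
  IsProbability⇒IsLaw {D = D} (0≤ws , total≈1) = record
    { mono = mono-weights (weights D 0≤ws)
    ; mass = trans (total-weight D) total≈1 }
    where
    weights : (D : Weighted A) → (∀ i → 0# ≤ proj₁ (List.lookup D i)) → All (λ (p , _) → 0# ≤ p × ⊤) D
    weights []      _  = []
    weights (_ ∷ D) ws = (ws zero , tt) ∷ weights D (ws ∘ suc)
    total-weight : (D : Weighted A) → 𝔼 D (λ _ → 1#) ≈ total (List.map proj₁ D)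
    total-weight []      = refl
    total-weight (_ ∷ D) = +-cong (*-identityʳ _) (total-weight D)

  𝔼-tabulate : ∀ {n} (P : Fin n → ℝ) (a : Fin n → A) (f : A → ℝ) →
               𝔼 (List.tabulate (λ j → P j , a j)) f ≈ sum (λ j → P j * f (a j))
  𝔼-tabulate {n = zero}  P a f = refl
  𝔼-tabulate {n = suc n} P a f = +-congˡ (𝔼-tabulate (P ∘ suc) (a ∘ suc) f)

  𝔼-sample : ∀ {d} (P : Fin d → ℝ) (f : Fin d → ℝ) → 𝔼 (sample P) f ≈ sum (λ j → P j * f j)
  𝔼-sample P f = 𝔼-tabulate P (λ j → j) f

  Law-sample : ∀ {d} {P : Fin d → ℝ} → IsDistribution P → IsLaw (sample P)
  Law-sample {P = P} (0≤P , ΣP≈1) = record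
    { mono = λ {f} {g} f≤g → ≤-trans (≤-reflexive (𝔼-sample P f))
        (≤-trans (sum-mono λ j → *-monoˡ-≤ (0≤P j) (f≤g j tt)) (≤-reflexive (sym (𝔼-sample P g))))
    ; mass = trans (𝔼-sample P _) (trans (sum-cong λ j → *-identityʳ (P j)) ΣP≈1) }

  𝔼-uniform : (c : ℝ) (as : List A) → 𝔼 (List.map (λ a → c , a) as) (λ _ → 1#) ≈ c * fromℕ (List.length as)
  𝔼-uniform c []       = sym (zeroʳ c)
  𝔼-uniform c (a ∷ as) = trans (+-congˡ (𝔼-uniform c as))
      (solve 2 (λ c n → c :* num 1 :+ c :* n := c :* (num 1 :+ n)) refl c _)

  Law-uniformOn : {as : List A} {Q : A → Set} → All Q as → 1 ℕ.≤ List.length as → Law (uniformOn as) Q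
  Law-uniformOn {A = A} {as} {Q} Qs nonempty = record
    { mono = mono-weights (weights Qs)
    ; mass = trans (𝔼-uniform _ as) (trans (*-comm _ _) (x*[y/x]≈y 1# 0<N)) }
    where
    0<N : 0# < fromℕ (List.length as)
    0<N = 0<fromℕ′ nonempty
    0≤c : 0# ≤ 1# / fromℕ (List.length as)
    0≤c = 0≤* 0≤1 (<⇒≤ (⁻¹-pos 0<N))
    weights : ∀ {bs} → All Q bs → All (λ (p , a) → 0# ≤ p × Q a) (List.map (λ a → 1# / fromℕ (List.length as) , a) bs)
    weights []       = []
    weights (q ∷ qs) = (0≤c , q) ∷ weights qs

  -- Lets a probability be bounded below through the expected indicator of failure, to which
  -- pointwise majorants apply.
  ℙ-complement : (D : Weighted A) {E : Pred A 0ℓ} (E? : Decidable E) →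
    ℙ D E? + 𝔼 D (λ a → if does (E? a) then 0# else 1#) ≈ 𝔼 D (λ _ → 1#)
  ℙ-complement []            E? = +-identityʳ 0#
  ℙ-complement ((p , a) ∷ D) E? with E? a
  ... | yes _ = trans (solve 3 (λ p x y → p :+ x :+ (p :* num 0 :+ y) := p :* num 1 :+ (x :+ y)) refl p _ _)
      (+-congˡ (ℙ-complement D E?))
  ... | no  _ = trans (solve 3 (λ p x y → x :+ (p :* num 1 :+ y) := p :* num 1 :+ (x :+ y)) refl p _ _)
      (+-congˡ (ℙ-complement D E?))

  -- Exchangeability of random halves

  -- Unlike the list `subsets d`, this nested form lets a transposition of neighbouring coordinates
  -- act by commuting two summands.
  ∑ˢ : ∀ d → (Subset d → ℝ) → ℝ
  ∑ˢ zero    f = f []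
  ∑ˢ (suc d) f = ∑ˢ d (f ∘ (inside ∷_)) + ∑ˢ d (f ∘ (outside ∷_))

  ∑ˢ-cong : ∀ d {f g : Subset d → ℝ} → (∀ S → f S ≈ g S) → ∑ˢ d f ≈ ∑ˢ d g
  ∑ˢ-cong zero    f≈g = f≈g []
  ∑ˢ-cong (suc d) f≈g = +-cong (∑ˢ-cong d (f≈g ∘ (inside ∷_))) (∑ˢ-cong d (f≈g ∘ (outside ∷_)))

  record Symmetry {d} (π : Subset d → Subset d) : Set where
    field
      invariant : ∀ f → ∑ˢ d (f ∘ π) ≈ ∑ˢ d f
      size      : ∀ S → ∣ π S ∣ ≡ ∣ S ∣

  open Symmetry

  Symmetry-id : ∀ {d} → Symmetry {d} (λ S → S)
  Symmetry-id = record { invariant = λ _ → refl ; size = λ _ → ≡.refl }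

  Symmetry-∘ : ∀ {d} {π ρ : Subset d → Subset d} → Symmetry π → Symmetry ρ → Symmetry (π ∘ ρ)
  Symmetry-∘ {π = π} {ρ} p r = record
    { invariant = λ f → trans (invariant r (f ∘ π)) (invariant p f)
    ; size      = λ S → ≡.trans (size p (ρ S)) (size r S) }

  Symmetry-resp : ∀ {d} {π ρ : Subset d → Subset d} → (∀ S → ρ S ≡ π S) → Symmetry π → Symmetry ρ
  Symmetry-resp {d} eq p = record
    { invariant = λ f → trans (∑ˢ-cong d λ S → reflexive (≡.cong f (eq S))) (invariant p f)
    ; size      = λ S → ≡.trans (≡.cong ∣_∣ (eq S)) (size p S) }

  onTail : ∀ {d} → (Subset d → Subset d) → Subset (suc d) → Subset (suc d)
  onTail π (a ∷ S) = a ∷ π S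

  Symmetry-onTail : ∀ {d} {π : Subset d → Subset d} → Symmetry π → Symmetry (onTail π)
  Symmetry-onTail p = record
    { invariant = λ f → +-cong (invariant p (f ∘ (inside ∷_))) (invariant p (f ∘ (outside ∷_)))
    ; size      = λ { (true ∷ S) → ≡.cong suc (size p S) ; (false ∷ S) → size p S } }

  swapHeads : ∀ {d} → Subset (suc (suc d)) → Subset (suc (suc d))
  swapHeads (a ∷ b ∷ S) = b ∷ a ∷ S

  Symmetry-swapHeads : ∀ {d} → Symmetry (swapHeads {d})
  Symmetry-swapHeads = record
    { invariant = λ f → solve 4 (λ x y z w → x :+ y :+ (z :+ w) := x :+ z :+ (y :+ w)) refl _ _ _ _
    ; size      = λ { (true ∷ true ∷ S) → ≡.refl ; (true ∷ false ∷ S) → ≡.refl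
                    ; (false ∷ true ∷ S) → ≡.refl ; (false ∷ false ∷ S) → ≡.refl } }

  exchange : ∀ {d} → Fin d → Fin d → Subset d → Subset d
  exchange i j S = (S [ i ]≔ lookup S j) [ j ]≔ lookup S i

  -- The transposition (0 j+2) is the conjugate of (1 j+2) by (0 1), and (1 j+2) acts on the tail.
  Symmetry-exchange-head : ∀ {d} (j : Fin d) → Symmetry (exchange zero (suc j))
  Symmetry-exchange-head zero    = Symmetry-resp (λ { (a ∷ b ∷ S) → ≡.refl }) Symmetry-swapHeads
  Symmetry-exchange-head (suc j) = Symmetry-resp (λ { (a ∷ b ∷ S) → ≡.refl })
    (Symmetry-∘ Symmetry-swapHeads (Symmetry-∘ (Symmetry-onTail (Symmetry-exchange-head j)) Symmetry-swapHeads))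

  Symmetry-exchange : ∀ {d} (i j : Fin d) → Symmetry (exchange i j)
  Symmetry-exchange zero    zero    = Symmetry-resp (λ { (a ∷ S) → ≡.refl }) Symmetry-id
  Symmetry-exchange zero    (suc j) = Symmetry-exchange-head j
  Symmetry-exchange (suc i) zero    = Symmetry-resp (λ { (a ∷ S) → ≡.refl }) (Symmetry-exchange-head i)
  Symmetry-exchange (suc i) (suc j) = Symmetry-resp (λ { (a ∷ S) → ≡.refl }) (Symmetry-onTail (Symmetry-exchange i j))

  𝔼-filter : ∀ {A : Set} {P : Pred A 0ℓ} (P? : Decidable P) c (as : List A) (f : A → ℝ) →
    𝔼 (List.map (λ a → c , a) (List.filter P? as)) f ≈
    𝔼 (List.map (λ a → c , a) as) (λ a → if does (P? a) then f a else 0#)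
  𝔼-filter P? c []       f = refl
  𝔼-filter P? c (a ∷ as) f with P? a
  ... | yes _ = +-congˡ (𝔼-filter P? c as f)
  ... | no  _ = trans (𝔼-filter P? c as f) (solve 2 (λ c x → x := c :* num 0 :+ x) refl c _)

  𝔼-map : ∀ {A B : Set} (g : A → B) c (as : List A) (f : B → ℝ) →
    𝔼 (List.map (λ a → c , a) (List.map g as)) f ≈ 𝔼 (List.map (λ a → c , a) as) (f ∘ g)
  𝔼-map g c []       f = refl
  𝔼-map g c (a ∷ as) f = +-congˡ (𝔼-map g c as f)

  𝔼-subsets : ∀ d c (f : Subset d → ℝ) → 𝔼 (List.map (λ S → c , S) (subsets d)) f ≈ c * ∑ˢ d f
  𝔼-subsets zero    c f = +-identityʳ _
  𝔼-subsets (suc d) c f = begin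
    𝔼 (List.map (λ S → c , S) (ins List.++ outs)) f
      ≡⟨ ≡.cong (λ D → 𝔼 D f) (List.map-++ (λ S → c , S) ins outs) ⟩
    𝔼 (List.map (λ S → c , S) ins List.++ List.map (λ S → c , S) outs) f
      ≈⟨ 𝔼-++ (List.map (λ S → c , S) ins) (List.map (λ S → c , S) outs) f ⟩
    𝔼 (List.map (λ S → c , S) ins) f + 𝔼 (List.map (λ S → c , S) outs) f
      ≈⟨ +-cong (trans (𝔼-map (inside ∷_) c (subsets d) f) (𝔼-subsets d c _))
          (trans (𝔼-map (outside ∷_) c (subsets d) f) (𝔼-subsets d c _)) ⟩
    c * ∑ˢ d (f ∘ (inside ∷_)) + c * ∑ˢ d (f ∘ (outside ∷_))
      ≈⟨ distribˡ c _ _ ⟨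
    c * ∑ˢ (suc d) f ∎
    where
    open Eq
    ins = List.map (inside ∷_) (subsets d)
    outs = List.map (outside ∷_) (subsets d)

  randomHalf : ∀ d → Weighted (Subset d)
  randomHalf d = uniformOn (halves d)

  -- A random half weights every subset by an indicator of its size; an exchange preserves both the
  -- sum over all subsets and the size.
  𝔼-exchange : ∀ {d} (i j : Fin d) (f : Subset d → ℝ) →
               𝔼 (randomHalf d) (f ∘ exchange i j) ≈ 𝔼 (randomHalf d) f
  𝔼-exchange {d} i j f = begin
    𝔼 (randomHalf d) (f ∘ exchange i j)                   ≈⟨ expand (f ∘ exchange i j) ⟩
    c * ∑ˢ d (restrict (f ∘ exchange i j))                ≈⟨ *-congˡ (∑ˢ-cong d λ S → reflexive (≡.cong
        (λ h → if does (h ℕ.≟ d ℕ./ 2) then f (exchange i j S) else 0#) (≡.sym (size (Symmetry-exchange i j) S)))) ⟩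
    c * ∑ˢ d (restrict f ∘ exchange i j)
        ≈⟨ *-congˡ (invariant (Symmetry-exchange i j) (restrict f)) ⟩
    c * ∑ˢ d (restrict f)                                 ≈⟨ expand f ⟨
    𝔼 (randomHalf d) f                                    ∎
    where
    open Eq
    c = 1# / fromℕ (List.length (halves d))
    restrict : (Subset d → ℝ) → Subset d → ℝ
    restrict f S = if does (∣ S ∣ ℕ.≟ d ℕ./ 2) then f S else 0#
    expand : ∀ f → 𝔼 (randomHalf d) f ≈ c * ∑ˢ d (restrict f)
    expand f = trans (𝔼-filter (λ S → ∣ S ∣ ℕ.≟ d ℕ./ 2) c (subsets d) f) (𝔼-subsets d c (restrict f))

  ∈-subsets : ∀ {d} (S : Subset d) → S ListMem.∈ subsets d
  ∈-subsets []          = here ≡.refl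
  ∈-subsets (true ∷ S)  = ListMem.∈-++⁺ˡ (ListMem.∈-map⁺ (inside ∷_) (∈-subsets S))
  ∈-subsets {suc d} (false ∷ S) = ListMem.∈-++⁺ʳ (List.map (inside ∷_) (subsets d))
      (ListMem.∈-map⁺ (outside ∷_) (∈-subsets S))

  subset-of-size : ∀ d h → h ℕ.≤ d → ∃ λ (S : Subset d) → ∣ S ∣ ≡ h
  subset-of-size zero    zero    _ = [] , ≡.refl
  subset-of-size (suc d) zero    _ with subset-of-size d zero ℕ.z≤n
  ... | S , eq = outside ∷ S , eq
  subset-of-size (suc d) (suc h) (ℕ.s≤s h≤d) with subset-of-size d h h≤d
  ... | S , eq = inside ∷ S , ≡.cong suc eq

  nonempty : ∀ {A : Set} {a : A} {as} → a ListMem.∈ as → 1 ℕ.≤ List.length as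
  nonempty (here _)  = ℕ.s≤s ℕ.z≤n
  nonempty (there _) = ℕ.s≤s ℕ.z≤n

  Law-randomHalf : ∀ d → Law (randomHalf d) (λ S → ∣ S ∣ ≡ d ℕ./ 2)
  Law-randomHalf d with subset-of-size d (d ℕ./ 2) (ℕ.m/n≤m d 2)
  ... | S , ∣S∣≡d/2 = Law-uniformOn (all-filter (λ S → ∣ S ∣ ℕ.≟ d ℕ./ 2) (subsets d))
    (nonempty (ListMem.∈-filter⁺ (λ S → ∣ S ∣ ℕ.≟ d ℕ./ 2) (∈-subsets S) ∣S∣≡d/2))

  σ : Bool → ℝ
  σ true  = 1#
  σ false = - 1#

  σ² : ∀ b → σ b * σ b ≈ 1#
  σ² true  = *-identityʳ 1#
  σ² false = solve 0 (:- num 1 :* :- num 1 := num 1) refl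

  [σ-σ]²≤4 : ∀ a b → (σ a - σ b) * (σ a - σ b) ≤ fromℕ 4
  [σ-σ]²≤4 true  true  = ≤-by (0≤fromℕ 4) (solve 0 (num 4 := (num 1 :- num 1) :* (num 1 :- num 1) :+ num 4) refl)
  [σ-σ]²≤4 true  false = ≤-reflexive (solve 0 ((num 1 :- (:- num 1)) :* (num 1 :- (:- num 1)) := num 4) refl)
  [σ-σ]²≤4 false true  = ≤-reflexive (solve 0 ((:- num 1 :- num 1) :* (:- num 1 :- num 1) := num 4) refl)
  [σ-σ]²≤4 false false = ≤-by (0≤fromℕ 4) (solve 0
      (num 4 := (:- num 1 :- (:- num 1)) :* (:- num 1 :- (:- num 1)) :+ num 4) refl)

  -- Anticoncentration of the contrast of a random half

  lookup-exchange : ∀ {d} (S : Subset d) i j → lookup (exchange i j S) i ≡ lookup S j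
  lookup-exchange S i j with i Fin.≟ j
  ... | yes ≡.refl = lookup∘update i (S [ i ]≔ lookup S i) (lookup S i)
  ... | no  i≢j    = ≡.trans (lookup∘update′ i≢j (S [ i ]≔ lookup S j) (lookup S i)) (lookup∘update i S (lookup S j))

  lookup-exchange′ : ∀ {d} (S : Subset d) i j → lookup (exchange i j S) j ≡ lookup S i
  lookup-exchange′ S i j = lookup∘update j (S [ i ]≔ lookup S j) (lookup S i)

  lookup-exchange-≢ : ∀ {d} (S : Subset d) {i j k} → ¬ (k ≡ i) → ¬ (k ≡ j) → lookup (exchange i j S) k ≡ lookup S k
  lookup-exchange-≢ S {i} {j} k≢i k≢j = ≡.trans (lookup∘update′ k≢j (S [ i ]≔ lookup S j) (lookup S i))
      (lookup∘update′ k≢i S (lookup S j))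

  contrast : ∀ {d} → (Fin d → ℝ) → Subset d → ℝ
  contrast δ S = sum (λ i → σ (lookup S i) * δ i)

  contrast-update : ∀ {d} (δ : Fin d → ℝ) S i b → contrast δ (S [ i ]≔ b) ≈ contrast δ S +
      (σ b - σ (lookup S i)) * δ i
  contrast-update δ (a ∷ S) zero    b = solve 4 (λ a b x y → b :* x :+ y := a :* x :+ y :+ (b :- a) :* x) refl (σ a)
      (σ b) (δ zero) _
  contrast-update δ (a ∷ S) (suc i) b = trans (+-congˡ (contrast-update (δ ∘ suc) S i b)) (sym (+-assoc _ _ _))

  -- The amount by which exchanging positions `i` and `j` lowers the contrast. A second exchange
  -- restores it, whence the sign change in `gap-exchange`.
  gap : ∀ {d} → (Fin d → ℝ) → Fin d → Fin d → Subset d → ℝ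
  gap δ i j S = (σ (lookup S i) - σ (lookup S j)) * (δ i - δ j)

  contrast-exchange : ∀ {d} (δ : Fin d → ℝ) i j S → contrast δ (exchange i j S) ≈ contrast δ S - gap δ i j S
  contrast-exchange δ i j S = begin
    contrast δ ((S [ i ]≔ lookup S j) [ j ]≔ lookup S i)
      ≈⟨ contrast-update δ (S [ i ]≔ lookup S j) j (lookup S i) ⟩
    contrast δ (S [ i ]≔ lookup S j) + (a - σ (lookup (S [ i ]≔ lookup S j) j)) * δ j
      ≈⟨ +-cong (contrast-update δ S i (lookup S j)) (*-congʳ (+-congˡ (-‿cong (reflexive (≡.cong σ unchanged))))) ⟩
    contrast δ S + (b - a) * δ i + (a - b) * δ j
      ≈⟨ solve 5 (λ a b x y z → z :+ (b :- a) :* x :+ (a :- b) :* y := z :- (a :- b) :* (x :- y)) refl a b (δ i) (δ j)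
          (contrast δ S) ⟩
    contrast δ S - gap δ i j S ∎
    where
    open Eq
    a = σ (lookup S i)
    b = σ (lookup S j)
    unchanged : lookup (S [ i ]≔ lookup S j) j ≡ lookup S j
    unchanged with j Fin.≟ i
    ... | yes ≡.refl = lookup∘update i S (lookup S i)
    ... | no  j≢i    = lookup∘update′ j≢i S (lookup S j)

  gap-exchange : ∀ {d} (δ : Fin d → ℝ) i j S → gap δ i j (exchange i j S) ≈ - gap δ i j S
  gap-exchange δ i j S = trans
    (*-congʳ (+-cong (reflexive (≡.cong σ (lookup-exchange S i j)))
        (-‿cong (reflexive (≡.cong σ (lookup-exchange′ S i j))))))
    (solve 3 (λ a b x → (b :- a) :* x := :- ((a :- b) :* x)) refl _ _ (δ i - δ j))

  ∑σ : ∀ {d} (S : Subset d) → sum (λ i → σ (lookup S i)) ≈ fromℕ 2 * fromℕ ∣ S ∣ - fromℕ d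
  ∑σ []                = solve 0 (num 0 := num 2 :* num 0 :- num 0) refl
  ∑σ (true ∷ S)        = trans (+-congˡ (∑σ S)) (solve 2
      (λ x y → num 1 :+ (num 2 :* x :- y) := num 2 :* (num 1 :+ x) :- (num 1 :+ y)) refl (fromℕ ∣ S ∣) _)
  ∑σ (false ∷ S)       = trans (+-congˡ (∑σ S)) (solve 2
      (λ x y → :- num 1 :+ (num 2 :* x :- y) := num 2 :* x :- (num 1 :+ y)) refl (fromℕ ∣ S ∣) _)

  balanced : ∀ {d} → 2 ∣ d → (S : Subset d) → ∣ S ∣ ≡ d ℕ./ 2 → sum (λ i → σ (lookup S i)) ≈ 0#
  balanced {d} 2∣d S ∣S∣≡d/2 = begin
    sum (λ i → σ (lookup S i))                    ≈⟨ ∑σ S ⟩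
    fromℕ 2 * fromℕ ∣ S ∣ - fromℕ d
        ≡⟨ ≡.cong₂ (λ x y → fromℕ 2 * fromℕ x - fromℕ y) ∣S∣≡d/2 (≡.sym (ℕ.m/n*n≡m 2∣d)) ⟩
    fromℕ 2 * fromℕ h - fromℕ (h ℕ.* 2)           ≈⟨ +-congˡ (-‿cong (fromℕ-* h 2)) ⟩
    fromℕ 2 * fromℕ h - fromℕ h * fromℕ 2
        ≈⟨ solve 1 (λ h → num 2 :* h :- h :* num 2 := num 0) refl (fromℕ h) ⟩
    0#                                            ∎
    where
    open Eq
    h = d ℕ./ 2

  module Anticoncentration {d : ℕ} (1≤d : 1 ℕ.≤ d) (2∣d : 2 ∣ d) (δ : Fin d → ℝ) (∑δ≈0 : sum δ ≈ 0#) where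

    L : Law (randomHalf d) (λ S → ∣ S ∣ ≡ d ℕ./ 2)
    L = Law-randomHalf d

    E : (Subset d → ℝ) → ℝ
    E = 𝔼 (randomHalf d)

    E-cong : {f g : Subset d → ℝ} → (∀ S → f S ≈ g S) → E f ≈ E g
    E-cong = 𝔼-cong (randomHalf d)

    Z : Subset d → ℝ
    Z = contrast δ

    V D : ℝ
    V = sum (λ i → δ i * δ i)
    D = fromℕ d

    0<D : 0# < D
    0<D = 0<fromℕ′ 1≤d

    -- Centring of `δ` removes the product of the two sums, so `Z` is recovered from the effects of
    -- all single exchanges.
    ∑gap : ∀ S → sum (λ i → sum (λ j → gap δ i j S)) ≈ fromℕ 2 * D * Z S
    ∑gap S = begin
      sum (λ i → sum (λ j → gap δ i j S)) ≈⟨ ∑∑-differences (λ i → σ (lookup S i)) δ ⟩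
      fromℕ 2 * (D * Z S - _ * sum δ)     ≈⟨ *-congˡ (+-congˡ (-‿cong (*-congˡ ∑δ≈0))) ⟩
      fromℕ 2 * (D * Z S - _ * 0#)
          ≈⟨ solve 3 (λ D Z s → num 2 :* (D :* Z :- s :* num 0) := num 2 :* D :* Z) refl D (Z S)
          (sum (λ i → σ (lookup S i))) ⟩
      fromℕ 2 * D * Z S                   ∎
      where open Eq

    -- With `h` equal to `Z` and to its cube, this reduces the second and fourth moments to one pair
    -- of positions at a time, where `symmetrise` applies.
    ∑gap-weighted : (h : Subset d → ℝ) → sum (λ i → sum (λ j → E (λ S → gap δ i j S * h S))) ≈ fromℕ 2 * D * E
        (λ S → Z S * h S)
    ∑gap-weighted h = begin
      sum (λ i → sum (λ j → E (λ S → gap δ i j S * h S)))     ≈⟨ sum-cong {d} (λ i → 𝔼-sum (randomHalf d) {d} _) ⟨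
      sum (λ i → E (λ S → sum (λ j → gap δ i j S * h S)))     ≈⟨ 𝔼-sum (randomHalf d) {d} _ ⟨
      E (λ S → sum (λ i → sum (λ j → gap δ i j S * h S)))     ≈⟨ E-cong (λ S → begin
        sum (λ i → sum (λ j → gap δ i j S * h S))
            ≈⟨ sum-cong {d} (λ i → trans (sum-cong {d} λ j → *-comm _ _) (sum-* {d} (h S) _)) ⟩
        sum (λ i → h S * sum (λ j → gap δ i j S))             ≈⟨ sum-* {d} (h S) _ ⟩
        h S * sum (λ i → sum (λ j → gap δ i j S))             ≈⟨ *-congˡ (∑gap S) ⟩
        h S * (fromℕ 2 * D * Z S)
            ≈⟨ solve 3 (λ h D Z → h :* (num 2 :* D :* Z) := num 2 :* D :* (Z :* h)) refl (h S) D (Z S) ⟩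
        fromℕ 2 * D * (Z S * h S)                             ∎) ⟩
      E (λ S → fromℕ 2 * D * (Z S * h S))                     ≈⟨ 𝔼-* (randomHalf d) (fromℕ 2 * D) _ ⟩
      fromℕ 2 * D * E (λ S → Z S * h S)                       ∎
      where open Eq

    ∑∑[δ-δ]² : sum (λ i → sum (λ j → (δ i - δ j) * (δ i - δ j))) ≈ fromℕ 2 * D * V
    ∑∑[δ-δ]² = begin
      sum (λ i → sum (λ j → (δ i - δ j) * (δ i - δ j)))  ≈⟨ ∑∑-differences δ δ ⟩
      fromℕ 2 * (D * V - sum δ * sum δ)                  ≈⟨ *-congˡ (+-congˡ (-‿cong (*-cong ∑δ≈0 ∑δ≈0))) ⟩
      fromℕ 2 * (D * V - 0# * 0#)
          ≈⟨ solve 2 (λ D V → num 2 :* (D :* V :- num 0 :* num 0) := num 2 :* D :* V) refl D V ⟩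
      fromℕ 2 * D * V                                    ∎
      where open Eq

    -- Exchangeability of S and exchange i j S, under which the gap changes sign.
    symmetrise : ∀ i j (h : ℝ → ℝ) → (∀ {x y} → x ≈ y → h x ≈ h y) →
      fromℕ 2 * E (λ S → gap δ i j S * h (Z S)) ≈ E (λ S → gap δ i j S * (h (Z S) - h (Z S - gap δ i j S)))
    symmetrise i j h h-cong = begin
      fromℕ 2 * e                                             ≈⟨ solve 1 (λ x → num 2 :* x := x :+ x) refl e ⟩
      e + e                                                   ≈⟨ +-congˡ (𝔼-exchange i j _) ⟨
      e + E (λ S → gap δ i j (exchange i j S) * h (Z (exchange i j S)))
                                                              ≈⟨ 𝔼-+ (randomHalf d) _ _ ⟨
      E (λ S → gap δ i j S * h (Z S) + gap δ i j (exchange i j S) * h (Z (exchange i j S)))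
        ≈⟨ E-cong (λ S → trans (+-congˡ (*-cong (gap-exchange δ i j S) (h-cong (contrast-exchange δ i j S))))
             (solve 3 (λ g x y → g :* x :+ :- g :* y := g :* (x :- y)) refl (gap δ i j S) (h (Z S)) _)) ⟩
      E (λ S → gap δ i j S * (h (Z S) - h (Z S - gap δ i j S)))  ∎
      where
      open Eq
      e = E (λ S → gap δ i j S * h (Z S))

    -- Four times the probability that `S` separates `i` from `j`.
    q : Fin d → Fin d → ℝ
    q i j = E (λ S → (σ (lookup S i) - σ (lookup S j)) * (σ (lookup S i) - σ (lookup S j)))

    -- Exchanging `j` and `k` leaves position `i` alone.
    q-exchange : ∀ {i j} k → ¬ (i ≡ j) → ¬ (i ≡ k) → q i k ≈ q i j
    q-exchange {i} {j} k i≢j i≢k = trans (E-cong λ S → reflexive (≡.cong₂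
        (λ a b → (σ a - σ b) * (σ a - σ b)) (≡.sym (lookup-exchange-≢ S i≢j i≢k)) (≡.sym (lookup-exchange S j k))))
      (𝔼-exchange j k _)

    -- Expanding the squares of signs gives 2 per position and a cross term, which vanishes because
    -- every half is balanced.
    ∑q : ∀ i → sum (q i) ≈ fromℕ 2 * D
    ∑q i = begin
      sum (q i)                                       ≈⟨ 𝔼-sum (randomHalf d) {d} _ ⟨
      E (λ S → sum (λ k → (σ (lookup S i) - σ (lookup S k)) * (σ (lookup S i) - σ (lookup S k))))
                                                      ≈⟨ cong-on L row ⟩
      E (λ S → fromℕ 2 * D)                           ≈⟨ const≈ L _ ⟩
      fromℕ 2 * D                                     ∎
      where
      open Eq
      row : ∀ S → ∣ S ∣ ≡ d ℕ./ 2 → sum (λ k → (σ (lookup S i) - σ (lookup S k)) *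
          (σ (lookup S i) - σ (lookup S k))) ≈ fromℕ 2 * D
      row S half = begin
        sum (λ k → (s i - s k) * (s i - s k))
          ≈⟨ sum-cong (λ k → trans (solve 2 (λ x y → (x :- y) :* (x :- y) := x :* x :+ y :* y :+
              (:- num 2 :* x) :* y) refl (s i) (s k))
               (+-congʳ (trans (+-cong (σ² (lookup S i)) (σ² (lookup S k)))
                   (solve 0 (num 1 :+ num 1 := num 2) refl)))) ⟩
        sum (λ k → fromℕ 2 + (- fromℕ 2 * s i) * s k)           ≈⟨ sum-+ {d} _ _ ⟩
        sum {d} (λ k → fromℕ 2) + sum (λ k → (- fromℕ 2 * s i) * s k)
            ≈⟨ +-cong (sum-const d _) (sum-* (- fromℕ 2 * s i) s) ⟩
        D * fromℕ 2 + (- fromℕ 2 * s i) * sum s                 ≈⟨ +-congˡ (*-congˡ (balanced 2∣d S half)) ⟩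
        D * fromℕ 2 + (- fromℕ 2 * s i) * 0#
            ≈⟨ solve 2 (λ D s → D :* num 2 :+ s :* num 0 := num 2 :* D) refl D _ ⟩
        fromℕ 2 * D                                             ∎
        where s = λ k → σ (lookup S k)

    -- The row of `i` sums to 2D, vanishes at `i` and is constant elsewhere, so the common value is
    -- 2D/(D - 1). Bounding the row by D copies of that value yields 2 directly.
    2≤q : ∀ {i j} → ¬ (i ≡ j) → fromℕ 2 ≤ q i j
    2≤q {i} {j} i≢j = *-cancelˡ-≤ 0<D (begin
      D * fromℕ 2            ≈⟨ *-comm _ _ ⟩
      fromℕ 2 * D            ≈⟨ ∑q i ⟨
      sum (q i)              ≤⟨ sum-mono row ⟩
      sum {d} (λ _ → q i j)  ≈⟨ sum-const d _ ⟩
      D * q i j              ∎)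
      where
      open Ineq
      row : ∀ k → q i k ≤ q i j
      row k with i Fin.≟ k
      ... | no  i≢k    = ≤-reflexive (q-exchange k i≢j i≢k)
      ... | yes ≡.refl = mono L λ S _ → ≤-trans (≤-reflexive (solve 1 (λ x → (x :- x) :* (x :- x) := num 0) refl _))
          (0≤x² _)

    [δ-δ]² : Fin d → Fin d → ℝ
    [δ-δ]² i j = (δ i - δ j) * (δ i - δ j)

    E[Z²] : ℝ
    E[Z²] = E (λ S → Z S * Z S)

    -- Symmetrising with the identity function gives 2 E (gap Z) = E (gap²) = q (δ i - δ j)², which
    -- is at least 2 (δ i - δ j)²; the sum over pairs produces `V`.
    secondMoment : V ≤ E[Z²]
    secondMoment = *-cancelˡ-≤ (*-pos (0<fromℕ 3) 0<D) (begin
      fromℕ 4 * D * V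
          ≈⟨ solve 2 (λ D V → num 4 :* D :* V := num 2 :* (num 2 :* D :* V)) refl D V ⟩
      fromℕ 2 * (fromℕ 2 * D * V)                                  ≈⟨ *-congˡ ∑∑[δ-δ]² ⟨
      fromℕ 2 * sum (λ i → sum (λ j → [δ-δ]² i j))
          ≤⟨ *-monoˡ-≤ (0≤fromℕ 2) (sum-mono λ i → sum-mono λ j → pair i j) ⟩
      fromℕ 2 * sum (λ i → sum (λ j → E (λ S → gap δ i j S * Z S))) ≈⟨ *-congˡ (∑gap-weighted Z) ⟩
      fromℕ 2 * (fromℕ 2 * D * E[Z²])
          ≈⟨ solve 2 (λ D V → num 4 :* D :* V := num 2 :* (num 2 :* D :* V)) refl D _ ⟨
      fromℕ 4 * D * E[Z²]                                          ∎)
      where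
      open Ineq
      2≤q′ : ∀ i j → fromℕ 2 * [δ-δ]² i j ≤ q i j * [δ-δ]² i j
      2≤q′ i j with i Fin.≟ j
      ... | no  i≢j    = *-monoʳ-≤ (0≤x² _) (2≤q i≢j)
      ... | yes ≡.refl = ≤-reflexive (solve 3 (λ a b x → a :* ((x :- x) :* (x :- x)) := b :*
          ((x :- x) :* (x :- x))) refl _ _ (δ i))
      pair : ∀ i j → [δ-δ]² i j ≤ E (λ S → gap δ i j S * Z S)
      pair i j = *-cancelˡ-≤ (0<fromℕ 1) (begin
        fromℕ 2 * [δ-δ]² i j                                      ≤⟨ 2≤q′ i j ⟩
        q i j * [δ-δ]² i j                                        ≈⟨ *-comm _ _ ⟩
        [δ-δ]² i j * q i j                                        ≈⟨ 𝔼-* (randomHalf d) _ _ ⟨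
        E (λ S → [δ-δ]² i j * ((σ (lookup S i) - σ (lookup S j)) * (σ (lookup S i) - σ (lookup S j))))
          ≈⟨ E-cong (λ S → solve 3 (λ u s z → u :* u :* (s :* s) := s :* u :* (z :- (z :- s :* u))) refl (δ i - δ j) _
              (Z S)) ⟩
        E (λ S → gap δ i j S * (Z S - (Z S - gap δ i j S)))       ≈⟨ symmetrise i j (λ z → z) (λ x≈y → x≈y) ⟨
        fromℕ 2 * E (λ S → gap δ i j S * Z S)                     ∎)

    cube : ℝ → ℝ
    cube z = z * (z * z)

    -- With g the gap and W = Z - g, the identity 2g (Z³ - W³) = 3g² (Z² + W²) - g⁴ bounds the
    -- symmetrised cube by squares. Another exchange makes the W term equal to the Z term, and g² ≤
    -- 4 (δ i - δ j)². Each pair thus contributes at most (3 · 2 · 4)/4 = 6 times (δ i - δ j)²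
    -- E[Z²].
    fourthMoment : E (λ S → Z S * cube (Z S)) ≤ fromℕ 6 * V * E[Z²]
    fourthMoment = *-cancelˡ-≤ (*-pos (0<fromℕ 1) 0<D) (begin
      fromℕ 2 * D * E (λ S → Z S * cube (Z S))                       ≈⟨ ∑gap-weighted (cube ∘ Z) ⟨
      sum (λ i → sum (λ j → E (λ S → gap δ i j S * cube (Z S))))     ≤⟨ sum-mono (λ i → sum-mono λ j → pair i j) ⟩
      sum (λ i → sum (λ j → fromℕ 6 * E[Z²] * [δ-δ]² i j))
          ≈⟨ trans (sum-cong {d} λ i → sum-* {d} _ _) (sum-* {d} _ _) ⟩
      fromℕ 6 * E[Z²] * sum (λ i → sum (λ j → [δ-δ]² i j))           ≈⟨ *-congˡ ∑∑[δ-δ]² ⟩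
      fromℕ 6 * E[Z²] * (fromℕ 2 * D * V)
          ≈⟨ solve 3 (λ e D V → num 6 :* e :* (num 2 :* D :* V) := num 2 :* D :* (num 6 :* V :* e)) refl E[Z²] D V ⟩
      fromℕ 2 * D * (fromℕ 6 * V * E[Z²])                            ∎)
      where
      open Ineq
      module _ (i j : Fin d) where
        g W : Subset d → ℝ
        g = gap δ i j
        W S = Z S - g S
        f : Subset d → ℝ
        f S = g S * g S * (Z S * Z S)
        f≤ : E f ≤ fromℕ 4 * [δ-δ]² i j * E[Z²]
        f≤ = begin
          E f                                               ≤⟨ mono L (λ S _ → *-monoʳ-≤ (0≤x² (Z S)) (begin
            g S * g S
                ≈⟨ solve 2 (λ s u → s :* u :* (s :* u) := u :* u :* (s :* s)) refl _ (δ i - δ j) ⟩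
            [δ-δ]² i j * ((σ (lookup S i) - σ (lookup S j)) * (σ (lookup S i) - σ (lookup S j)))
                                                            ≤⟨ *-monoˡ-≤ (0≤x² _)
                                                                ([σ-σ]²≤4 (lookup S i) (lookup S j)) ⟩
            [δ-δ]² i j * fromℕ 4                            ≈⟨ *-comm _ _ ⟩
            fromℕ 4 * [δ-δ]² i j                            ∎)) ⟩
          E (λ S → fromℕ 4 * [δ-δ]² i j * (Z S * Z S))      ≈⟨ 𝔼-* (randomHalf d) _ _ ⟩
          fromℕ 4 * [δ-δ]² i j * E[Z²]                      ∎
        f-exchange : E (λ S → g S * g S * (W S * W S)) ≈ E f
        f-exchange = trans (E-cong λ S → trans
          (*-cong (solve 1 (λ g → g :* g := :- g :* :- g) refl (g S)) refl)
          (sym (*-cong (*-cong (gap-exchange δ i j S) (gap-exchange δ i j S))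
              (*-cong (contrast-exchange δ i j S) (contrast-exchange δ i j S)))))
          (𝔼-exchange i j f)
        pair : E (λ S → gap δ i j S * cube (Z S)) ≤ fromℕ 6 * E[Z²] * [δ-δ]² i j
        pair = *-cancelˡ-≤ (0<fromℕ 3) (begin
          fromℕ 4 * E (λ S → g S * cube (Z S))
              ≈⟨ solve 1 (λ x → num 4 :* x := num 2 :* (num 2 :* x)) refl _ ⟩
          fromℕ 2 * (fromℕ 2 * E (λ S → g S * cube (Z S)))
              ≈⟨ *-congˡ (symmetrise i j cube (λ x≈y → *-cong x≈y (*-cong x≈y x≈y))) ⟩
          fromℕ 2 * E (λ S → g S * (cube (Z S) - cube (W S)))        ≈⟨ 𝔼-* (randomHalf d) _ _ ⟨
          E (λ S → fromℕ 2 * (g S * (cube (Z S) - cube (W S))))      ≤⟨ mono L (λ S _ → ≤-by (0≤x² (g S * g S))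
              (solve 2 (λ z g → num 3 :* (g :* g :* (z :* z) :+ g :* g :* ((z :- g) :* (z :- g)))
                 := num 2 :* (g :* (z :* (z :* z) :- (z :- g) :* ((z :- g) :* (z :- g)))) :+ g :* g :* (g :* g)) refl
                     (Z S) (g S))) ⟩
          E (λ S → fromℕ 3 * (f S + g S * g S * (W S * W S)))        ≈⟨ 𝔼-* (randomHalf d) _ _ ⟩
          fromℕ 3 * E (λ S → f S + g S * g S * (W S * W S))
              ≈⟨ *-congˡ (trans (𝔼-+ (randomHalf d) _ _) (+-congˡ f-exchange)) ⟩
          fromℕ 3 * (E f + E f)                                      ≤⟨ *-monoˡ-≤ (0≤fromℕ 3) (+-mono-≤ f≤ f≤) ⟩
          fromℕ 3 * (fromℕ 4 * [δ-δ]² i j * E[Z²] + fromℕ 4 * [δ-δ]² i j * E[Z²])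
            ≈⟨ solve 2 (λ u e → num 3 :* (num 4 :* u :* e :+ num 4 :* u :* e) := num 4 :* (num 6 :* e :* u)) refl
                ([δ-δ]² i j) E[Z²] ⟩
          fromℕ 4 * (fromℕ 6 * E[Z²] * [δ-δ]² i j)                   ∎)

    miss : Subset d → ℝ
    miss S = if does (fromℕ 4 * (Z S * Z S) <? V) then 1# else 0#

    -- With u = 4 Z², (u - V)(49 V - u) is negative when u < V, and at most (24 V)² always.
    miss-quadratic : ∀ S → 0# < V →
      fromℕ 200 * V * (Z S * Z S) + (- fromℕ 16 * (Z S * cube (Z S)) - fromℕ 49 * (V * V)) ≤ fromℕ 576 * (V * V) *
          (1# - miss S)
    miss-quadratic S 0<V with fromℕ 4 * (Z S * Z S) <? V
    ... | no  _   = ≤-by (0≤x² (fromℕ 4 * (Z S * Z S) - fromℕ 25 * V))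
      (solve 2 (λ z V → num 576 :* (V :* V) :* (num 1 :- num 0)
         := num 200 :* V :* (z :* z) :+ (:- num 16 :* (z :* (z :* (z :* z))) :- num 49 :* (V :* V))
            :+ (num 4 :* (z :* z) :- num 25 :* V) :* (num 4 :* (z :* z) :- num 25 :* V)) refl (Z S) V)
    ... | yes u<V = ≤-by (0≤* (≤⇒0≤- (<⇒≤ u<V)) (≤⇒0≤- (≤-trans (<⇒≤ u<V) (≤-by (0≤* (0≤fromℕ 48) (<⇒≤ 0<V))
           (solve 1 (λ V → num 49 :* V := V :+ num 48 :* V) refl V)))))
      (solve 2 (λ z V → num 576 :* (V :* V) :* (num 1 :- num 1)
         := num 200 :* V :* (z :* z) :+ (:- num 16 :* (z :* (z :* (z :* z))) :- num 49 :* (V :* V))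
            :+ (V :- num 4 :* (z :* z)) :* (num 49 :* V :- num 4 :* (z :* z))) refl (Z S) V)

    -- Averaging the quadratic and inserting the two moment bounds leaves at least (200 - 16 · 6 -
    -- 49) V² = 55 V², of which 48 V² is kept because 48/576 = 1/12.
    miss-probability : 0# < V → fromℕ 12 * E miss ≤ fromℕ 11
    miss-probability 0<V = *-cancelˡ-≤ (*-pos (0<fromℕ 47) (*-pos 0<V 0<V)) (begin
      fromℕ 48 * (V * V) * (fromℕ 12 * E miss)
        ≈⟨ solve 2 (λ v e → num 48 :* v :* (num 12 :* e) := num 576 :* v :- num 576 :* v :* (num 1 :- e)) refl (V * V)
            (E miss) ⟩
      fromℕ 576 * (V * V) - fromℕ 576 * (V * V) * (1# - E miss)
          ≤⟨ +-monoʳ-≤ _ (neg-mono-≤ (≤-trans bound quadratic)) ⟩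
      fromℕ 576 * (V * V) - fromℕ 48 * (V * V)
          ≈⟨ solve 1 (λ v → num 576 :* v :- num 48 :* v := num 48 :* v :* num 11) refl (V * V) ⟩
      fromℕ 48 * (V * V) * fromℕ 11                                  ∎)
      where
      open Ineq
      E[Z⁴] = E (λ S → Z S * cube (Z S))
      quadratic : fromℕ 200 * V * E[Z²] + (- fromℕ 16 * E[Z⁴] - fromℕ 49 * (V * V)) ≤ fromℕ 576 * (V * V) *
          (1# - E miss)
      quadratic = begin
        fromℕ 200 * V * E[Z²] + (- fromℕ 16 * E[Z⁴] - fromℕ 49 * (V * V))
          ≈⟨ +-cong (𝔼-* (randomHalf d) _ _) (+-cong (𝔼-* (randomHalf d) _ _) (const≈ L _)) ⟨
        E (λ S → fromℕ 200 * V * (Z S * Z S)) + (E (λ S → - fromℕ 16 * (Z S * cube (Z S))) + E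
            (λ _ → - (fromℕ 49 * (V * V))))
          ≈⟨ trans (𝔼-+ (randomHalf d) _ _) (+-congˡ (𝔼-+ (randomHalf d) _ _)) ⟨
        E (λ S → fromℕ 200 * V * (Z S * Z S) + (- fromℕ 16 * (Z S * cube (Z S)) - fromℕ 49 * (V * V)))
          ≤⟨ mono L (λ S _ → miss-quadratic S 0<V) ⟩
        E (λ S → fromℕ 576 * (V * V) * (1# - miss S))
          ≈⟨ trans (𝔼-* (randomHalf d) _ _) (*-congˡ
              (trans (𝔼-+ (randomHalf d) _ _) (+-cong (mass L) (𝔼-neg (randomHalf d) miss)))) ⟩
        fromℕ 576 * (V * V) * (1# - E miss) ∎
      bound : fromℕ 48 * (V * V) ≤ fromℕ 200 * V * E[Z²] + (- fromℕ 16 * E[Z⁴] - fromℕ 49 * (V * V))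
      bound = ≤-by (0≤+ (0≤+ (0≤* (0≤fromℕ 16) (≤⇒0≤- fourthMoment))
          (0≤* (0≤* (0≤fromℕ 104) (<⇒≤ 0<V)) (≤⇒0≤- secondMoment)))
                        (0≤* (0≤fromℕ 7) (0≤x² V)))
        (solve 3 (λ V e f → num 200 :* V :* e :+ (:- num 16 :* f :- num 49 :* (V :* V))
            := num 48 :* (V :* V) :+ (num 16 :* (num 6 :* V :* e :- f) :+ num 104 :* V :* (e :- V) :+ num 7 :*
                (V :* V))) refl V E[Z²] E[Z⁴])

    -- Since 11/12 = 1 - 1/12. In exponential form the product over independent groups has an
    -- exponent linear in `G`.
    miss≤exp : 0# < V → E miss ≤ exp (- (fromℕ 12 ⁻¹))
    miss≤exp 0<V = ≤-trans (*-cancelˡ-≤ (0<fromℕ 11) (begin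
      fromℕ 12 * E miss                    ≤⟨ miss-probability 0<V ⟩
      fromℕ 11                             ≈⟨ solve 0 (num 11 := num 12 :- num 1) refl ⟩
      fromℕ 12 - 1#                        ≈⟨ +-congˡ (-‿cong (x*x⁻¹≈1 (0<fromℕ 11))) ⟨
      fromℕ 12 - fromℕ 12 * fromℕ 12 ⁻¹
          ≈⟨ solve 2 (λ a b → a :- a :* b := a :* (num 1 :+ :- b)) refl (fromℕ 12) _ ⟩
      fromℕ 12 * (1# + - (fromℕ 12 ⁻¹))    ∎)) (1+x≤exp _)
      where open Ineq

  -- Concentration of the group sums

  module RandomizedResponse (ε : ℝ) (0<ε : 0# < ε) where

    e s p : ℝ
    e = exp ε
    s = rrScale ε
    p = e / (e + 1#)

    0<e-1 : 0# < e - 1#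
    0<e-1 = <⇒0<- (1<exp 0<ε)

    0<e+1 : 0# < e + 1#
    0<e+1 = 0<+ (0<exp ε) 0≤1

    0<s : 0# < s
    0<s = *-pos 0<e+1 (⁻¹-pos 0<e-1)

    value : Sign → ℝ
    value = messageValue ε

    sgn : Sign → ℝ
    sgn Sign.+ = 1#
    sgn Sign.- = - 1#

    value≤s : ∀ b → value b ≤ s
    value≤s Sign.+ = ≤-refl
    value≤s Sign.- = ≤-by (0≤+ (<⇒≤ 0<s) (<⇒≤ 0<s)) (solve 1 (λ s → s := :- s :+ (s :+ s)) refl s)

    -s≤value : ∀ b → - s ≤ value b
    -s≤value Sign.+ = value≤s Sign.-
    -s≤value Sign.- = ≤-refl

    value² : ∀ b → value b * value b ≈ s * s
    value² Sign.+ = refl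
    value² Sign.- = solve 1 (λ s → :- s :* :- s := s :* s) refl s

    -- 2p - 1 is (e - 1)/(e + 1), the reciprocal of the scale; this is what makes the response
    -- unbiased.
    [2p-1]s≈1 : (fromℕ 2 * p - 1#) * s ≈ 1#
    [2p-1]s≈1 = *-cancelˡ-≈ 0<e+1 (begin
      (e + 1#) * ((fromℕ 2 * p - 1#) * s)
          ≈⟨ solve 3 (λ e p s → (e :+ num 1) :* ((num 2 :* p :- num 1) :* s) :=
          (num 2 :* ((e :+ num 1) :* p) :- (e :+ num 1)) :* s) refl e p s ⟩
      (fromℕ 2 * ((e + 1#) * p) - (e + 1#)) * s ≈⟨ *-congʳ (+-congʳ (*-congˡ (x*[y/x]≈y e 0<e+1))) ⟩
      (fromℕ 2 * e - (e + 1#)) * s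
          ≈⟨ *-congʳ (solve 1 (λ e → num 2 :* e :- (e :+ num 1) := e :- num 1) refl e) ⟩
      (e - 1#) * s                              ≈⟨ x*[y/x]≈y (e + 1#) 0<e-1 ⟩
      e + 1#                                    ≈⟨ *-identityʳ _ ⟨
      (e + 1#) * 1#                             ∎)
      where open Eq

    unbiased : ∀ b → 𝔼 (randomizedResponse ε b) value ≈ sgn b
    unbiased Sign.+ = trans (solve 2 (λ p s → p :* s :+ ((num 1 :- p) :* :- s :+ num 0) :=
        (num 2 :* p :- num 1) :* s) refl p s) [2p-1]s≈1
    unbiased Sign.- = trans (solve 2 (λ p s → p :* :- s :+ ((num 1 :- p) :* s :+ num 0) := :-
        ((num 2 :* p :- num 1) :* s)) refl p s) (-‿cong [2p-1]s≈1)

    Law-randomizedResponse : ∀ b → IsLaw (randomizedResponse ε b)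
    Law-randomizedResponse b = record
      { mono = mono-weights ((0≤p , tt) ∷ (0≤1-p , tt) ∷ [])
      ; mass = solve 1 (λ p → p :* num 1 :+ ((num 1 :- p) :* num 1 :+ num 0) := num 1) refl p }
      where
      0≤p : 0# ≤ p
      0≤p = 0≤* (0≤exp ε) (<⇒≤ (⁻¹-pos 0<e+1))
      0≤1-p : 0# ≤ 1# - p
      0≤1-p = *-cancelˡ-≤ 0<e+1 (begin
        (e + 1#) * 0#              ≈⟨ zeroʳ _ ⟩
        0#                         ≤⟨ 0≤1 ⟩
        1#                         ≈⟨ solve 1 (λ e → num 1 := e :+ num 1 :- e) refl e ⟩
        (e + 1#) - e               ≈⟨ +-congˡ (-‿cong (x*[y/x]≈y e 0<e+1)) ⟨
        (e + 1#) - (e + 1#) * p    ≈⟨ solve 2 (λ x p → x :- x :* p := x :* (num 1 :- p)) refl _ p ⟩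
        (e + 1#) * (1# - p)        ∎)
        where open Ineq

  -- Independence factors over all users, while `p̃` reads one group. The other users enter with
  -- exponent 0, and this sum removes them.
  group-sum : ∀ {G k} (g : Fin G) (f : Fin (G ℕ.* k) → ℝ) →
    sum (λ i → if does (quotient {G} k i Fin.≟ g) then f i else 0#) ≈ sum (λ (j : Fin k) → f (combine g j))
  group-sum {G} {k} g f = begin
    sum (λ i → if does (quotient {G} k i Fin.≟ g) then f i else 0#)   ≈⟨ sum-combine G _ ⟩
    sum (λ (h : Fin G) → sum (λ (j : Fin k) → if does (quotient {G} k (combine h j) Fin.≟ g) then f
        (combine h j) else 0#))
      ≈⟨ sum-cong {G} (λ h → sum-cong {k} λ j → reflexive
          (≡.cong (λ q → if does (q Fin.≟ g) then f (combine h j) else 0#)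
           (≡.cong proj₁ (Fin.remQuot-combine {G} {k} h j)))) ⟩
    sum (λ (h : Fin G) → sum (λ (j : Fin k) → if does (h Fin.≟ g) then f (combine h j) else 0#))
      ≈⟨ sum-single _ g other ⟩
    sum (λ (j : Fin k) → if does (g Fin.≟ g) then f (combine g j) else 0#)
      ≈⟨ same ⟩
    sum (λ (j : Fin k) → f (combine g j)) ∎
    where
    open Eq
    other : ∀ h → ¬ (h ≡ g) → sum (λ (j : Fin k) → if does (h Fin.≟ g) then f (combine h j) else 0#) ≈ 0#
    other h h≢g with h Fin.≟ g
    ... | yes h≡g = contradiction h≡g h≢g
    ... | no  _   = sum-zero {k} λ _ → refl
    same : sum (λ (j : Fin k) → if does (g Fin.≟ g) then f (combine g j) else 0#) ≈ sum
        (λ (j : Fin k) → f (combine g j))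
    same with g Fin.≟ g
    ... | yes _   = refl
    ... | no  g≢g = contradiction ≡.refl g≢g

  ∑-members : ∀ {n} (C : Subset n) → sum (λ i → if lookup C i then 1# else 0#) ≈ fromℕ ∣ C ∣
  ∑-members []          = refl
  ∑-members (true ∷ C)  = +-congˡ (∑-members C)
  ∑-members (false ∷ C) = trans (+-identityˡ _) (∑-members C)

  does-∈? : ∀ {d} (S : Subset d) x → does (x ∈? S) ≡ lookup S x
  does-∈? (true ∷ S)  zero    = ≡.refl
  does-∈? (false ∷ S) zero    = ≡.refl
  does-∈? (_ ∷ S)     (suc x) = does-∈? S x

  module Raptor (G k : ℕ) (ε : ℝ) (m : ℕ) (β : ℝ) (d : ℕ) (0<ε : 0# < ε)
    (0<β : 0# < β) (β<1 : β < 1#) (1≤G : 1 ℕ.≤ G) (1≤k : 1 ℕ.≤ k) where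
    open RandomizedResponse ε 0<ε
    open RAPTOR G k ε m β {d}

    κ : ℝ
    κ = fromℕ k

    γ : ℝ
    γ = fromℕ G / fromℕ n

    0<κ : 0# < κ
    0<κ = 0<fromℕ′ 1≤k

    0<n : 0# < fromℕ n
    0<n = <-respʳ-≈ (sym (fromℕ-* G k)) (*-pos (0<fromℕ′ 1≤G) 0<κ)

    0<γ : 0# < γ
    0<γ = *-pos (0<fromℕ′ 1≤G) (⁻¹-pos 0<n)

    -- Multiplying by the group size `κ` turns `p̃` into the plain sum of messages, in which all
    -- estimates are made.
    κγ≈1 : κ * γ ≈ 1#
    κγ≈1 = begin
      κ * (fromℕ G * fromℕ n ⁻¹)   ≈⟨ solve 3 (λ x y z → x :* (y :* z) := y :* x :* z) refl κ (fromℕ G) (fromℕ n ⁻¹) ⟩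
      fromℕ G * κ * fromℕ n ⁻¹     ≈⟨ *-congʳ (fromℕ-* G k) ⟨
      fromℕ n * fromℕ n ⁻¹         ≈⟨ x*x⁻¹≈1 0<n ⟩
      1#                           ∎
      where open Eq

    ℓ r : ℝ
    ℓ = ln ((fromℕ 4 * fromℕ G) / β)
    r = √ ((fromℕ 6 * fromℕ G) / fromℕ n * ℓ)

    1≤4G/β : 1# ≤ (fromℕ 4 * fromℕ G) / β
    1≤4G/β = *-cancelˡ-≤ 0<β (begin
      β * 1#                                 ≈⟨ *-identityʳ β ⟩
      β                                      ≤⟨ <⇒≤ β<1 ⟩
      1#                                     ≈⟨ fromℕ-1 ⟨
      fromℕ 1                                ≤⟨ fromℕ-mono {1} {4 ℕ.* G} (ℕ.≤-trans 1≤G (ℕ.m≤m+n G _)) ⟩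
      fromℕ (4 ℕ.* G)                        ≈⟨ fromℕ-* 4 G ⟩
      fromℕ 4 * fromℕ G                      ≈⟨ x*[y/x]≈y _ 0<β ⟨
      β * ((fromℕ 4 * fromℕ G) / β)          ∎)
      where open Ineq

    0≤ℓ : 0# ≤ ℓ
    0≤ℓ = 0≤ln 1≤4G/β

    -- Two tails of size exp (-ℓ) in each of the `G` groups cost β/2 in total.
    4G*exp[-ℓ]≈β : fromℕ 4 * fromℕ G * exp (- ℓ) ≈ β
    4G*exp[-ℓ]≈β = begin
      fromℕ 4 * fromℕ G * exp (- ℓ)                   ≈⟨ *-congʳ (x*[y/x]≈y _ 0<β) ⟨
      β * ((fromℕ 4 * fromℕ G) / β) * exp (- ℓ)       ≈⟨ *-congʳ (*-congˡ (exp-ln (<-≤-trans 0<1 1≤4G/β))) ⟨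
      β * exp ℓ * exp (- ℓ)                           ≈⟨ *-assoc _ _ _ ⟩
      β * (exp ℓ * exp (- ℓ))                         ≈⟨ *-congˡ (exp-inverse ℓ) ⟩
      β * 1#                                          ≈⟨ *-identityʳ β ⟩
      β                                               ∎
      where open Eq

    0≤r²-arg : 0# ≤ (fromℕ 6 * fromℕ G) / fromℕ n * ℓ
    0≤r²-arg = 0≤* (0≤* (0≤* (0≤fromℕ 6) (0≤fromℕ G)) (<⇒≤ (⁻¹-pos 0<n))) 0≤ℓ

    0≤r : 0# ≤ r
    0≤r = √-nonNeg 0≤r²-arg

    r²≈6γℓ : r * r ≈ fromℕ 6 * γ * ℓ
    r²≈6γℓ = trans (√-square 0≤r²-arg) (*-congʳ (*-assoc _ _ _))

    κr²≈6ℓ : κ * (r * r) ≈ fromℕ 6 * ℓ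
    κr²≈6ℓ = begin
      κ * (r * r)              ≈⟨ *-congˡ r²≈6γℓ ⟩
      κ * (fromℕ 6 * γ * ℓ)    ≈⟨ solve 3 (λ k g l → k :* (num 6 :* g :* l) := num 6 :* (k :* g) :* l) refl κ γ ℓ ⟩
      fromℕ 6 * (κ * γ) * ℓ    ≈⟨ *-congʳ (trans (*-congˡ κγ≈1) (*-identityʳ _)) ⟩
      fromℕ 6 * ℓ              ∎
      where open Eq

    -- Honest against corrupted messages

    groupSum : Fin G → Vec Sign n → ℝ
    groupSum g y = sum (λ (j : Fin k) → value (lookup y (combine g j)))

    Agree : Subset n → Vec Sign n → Vec Sign n → Set
    Agree C y z = ∀ i → ¬ (i ∈ C) → lookup y i ≡ lookup z i

    groupSum-corrupted : ∀ {C} y z g → ∣ C ∣ ≡ m → Agree C y z →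
      groupSum g y ≤ groupSum g z + fromℕ 2 * fromℕ m * s
    groupSum-corrupted {C} y z g ∣C∣≡m agree = begin
      groupSum g y
          ≤⟨ sum-mono (λ j → single (combine g j)) ⟩
      sum (λ (j : Fin k) → value (lookup z (combine g j)) + fromℕ 2 * s * member (combine g j))
                                                                                ≈⟨ trans (sum-+ {k} _ _)
                                                                                    (+-congˡ
                                                                                    (sum-* {k} (fromℕ 2 * s) _)) ⟩
      groupSum g z + fromℕ 2 * s * sum (λ (j : Fin k) → member (combine g j))
          ≤⟨ +-monoʳ-≤ _ (*-monoˡ-≤ (0≤* (0≤fromℕ 2) (<⇒≤ 0<s)) members) ⟩
      groupSum g z + fromℕ 2 * s * fromℕ m
          ≈⟨ +-congˡ (solve 2 (λ s m → num 2 :* s :* m := num 2 :* m :* s) refl s _) ⟩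
      groupSum g z + fromℕ 2 * fromℕ m * s                                      ∎
      where
      open Ineq
      member : Fin n → ℝ
      member i = if lookup C i then 1# else 0#
      0≤member : ∀ i → 0# ≤ member i
      0≤member i with lookup C i
      ... | true  = 0≤1
      ... | false = ≤-refl
      single : ∀ i → value (lookup y i) ≤ value (lookup z i) + fromℕ 2 * s * member i
      single i with lookup C i in eq
      ... | true  = ≤-trans (value≤s (lookup y i)) (≤-by (≤⇒0≤- (-s≤value (lookup z i)))
                      (solve 2 (λ s v → v :+ num 2 :* s :* num 1 := s :+ (v :- (:- s))) refl s _))
      ... | false = ≤-reflexive (trans (reflexive (≡.cong value (agree i i∉C)))
          (solve 2 (λ v s → v := v :+ num 2 :* s :* num 0) refl _ s))
        where
        i∉C : ¬ (i ∈ C)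
        i∉C i∈C with ≡.trans (≡.sym eq) ([]=⇒lookup i∈C)
        ... | ()
      members : sum (λ (j : Fin k) → member (combine g j)) ≤ fromℕ m
      members = begin
        sum (λ (j : Fin k) → member (combine g j))
            ≤⟨ term≤sum {f = λ h → sum (λ (j : Fin k) → member (combine h j))}
            (λ h → sum-0≤ {k} λ j → 0≤member (combine h j)) g ⟩
        sum (λ (h : Fin G) → sum (λ (j : Fin k) → member (combine h j)))    ≈⟨ sum-combine G member ⟨
        sum member                                                          ≈⟨ ∑-members C ⟩
        fromℕ ∣ C ∣                                                         ≡⟨ ≡.cong fromℕ ∣C∣≡m ⟩
        fromℕ m                                                             ∎

    -- Agreement off `C` is symmetric, so the previous bound applies with `y` and `z` interchanged.
    neg-groupSum-corrupted : ∀ {C} y z g → ∣ C ∣ ≡ m → Agree C y z →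
      - groupSum g y ≤ - groupSum g z + fromℕ 2 * fromℕ m * s
    neg-groupSum-corrupted y z g ∣C∣≡m agree =
      ≤-by (≤⇒0≤- (groupSum-corrupted z y g ∣C∣≡m λ i i∉C → ≡.sym (agree i i∉C)))
        (solve 3 (λ y z c → :- z :+ c := :- y :+ (y :+ c :- z)) refl (groupSum g y) (groupSum g z) _)

    honestMessages : Vec (Subset d) G → Vec (Fin d) n → Weighted (Vec Sign n)
    honestMessages S x = independent (Vec.tabulate (λ i → honest S i (lookup x i)))

    Law-respond : ∀ x S a i → IsLaw (respond x S a i)
    Law-respond x S a i with i ∈? Corruption.C a
    ... | yes i∈C = Law-pure _
    ... | no  _   = Law-randomizedResponse _

    respond-honest : ∀ x S a i → ¬ (i ∈ Corruption.C a) → respond x S a i ≡ honest S i (lookup x i)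
    respond-honest x S a i i∉C with i ∈? Corruption.C a
    ... | yes i∈C = contradiction i∈C i∉C
    ... | no  _   = ≡.refl

    Law-tabulate : ∀ {A : Set} {l} (D : Fin l → Weighted A) → (∀ i → IsLaw (D i)) → ∀ i → IsLaw
        (lookup (Vec.tabulate D) i)
    Law-tabulate D L i = ≡.subst IsLaw (≡.sym (lookup∘tabulate D i)) (L i)

    -- Off the corrupted set the responses are the honest ones, so `coupling` applies. The
    -- hypothesis ranges over every set of size `m`, so nothing of the attacker's choice is left on
    -- the right.
    corruption-bound : ∀ S x a (f f′ : Vec Sign n → ℝ) →
      (∀ {C} y z → ∣ C ∣ ≡ m → Agree C y z → f y ≤ f′ z) →
      𝔼 (independent (Vec.tabulate (respond x S a))) f ≤ 𝔼 (honestMessages S x) f′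
    corruption-bound S x a f f′ f≤f′ = coupling (Vec.tabulate R) (Vec.tabulate H)
      (Law-tabulate R (Law-respond x S a)) (Law-tabulate H (λ i → Law-randomizedResponse _)) (_∈? Corruption.C a)
      (λ i i∉C → ≡.trans (lookup∘tabulate R i) (≡.trans (respond-honest x S a i i∉C) (≡.sym (lookup∘tabulate H i))))
      f f′ (λ y z agree → f≤f′ y z (Corruption.∣C∣≡m a) agree)
      where
      R H : Fin n → Weighted Sign
      R = respond x S a
      H i = honest S i (lookup x i)

    -- Exponential moments and tails of a group

    module Data (P : Fin d → ℝ) (P-dist : IsDistribution P) where

      users : Weighted (Vec (Fin d) n)
      users = independent (Vec.replicate n (sample P))

      Law-users : IsLaw users
      Law-users = forget (Law-independent (Vec.replicate n (sample P)) {λ _ → ⊤}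
        λ i → ≡.subst IsLaw (≡.sym (lookup-replicate i (sample P))) (Law-sample P-dist))

      Law-publicRandomness : Law publicRandomness (λ S → ∀ g → ∣ lookup S g ∣ ≡ d ℕ./ 2)
      Law-publicRandomness = Law-independent (Vec.replicate G (randomHalf d))
        λ g → ≡.subst (λ D → Law D (λ S → ∣ S ∣ ≡ d ℕ./ 2)) (≡.sym (lookup-replicate g (randomHalf d)))
            (Law-randomHalf d)

      mean : Subset d → ℝ
      mean = contrast P

      message : Subset d → Weighted Sign
      message T = sample P >>= λ x → randomizedResponse ε (encode T x)

      Law-message : ∀ T → IsLaw (message T)
      Law-message T = Law->>= {k = λ x → randomizedResponse ε (encode T x)} (Law-sample P-dist)
          (λ x → Law-randomizedResponse (encode T x))

      mean-message : ∀ T → 𝔼 (message T) value ≈ mean T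
      mean-message T = begin
        𝔼 (message T) value
            ≈⟨ 𝔼->>= (sample P) (λ x → randomizedResponse ε (encode T x)) value ⟩
        𝔼 (sample P) (λ x → 𝔼 (randomizedResponse ε (encode T x)) value)            ≈⟨ 𝔼-sample P _ ⟩
        sum (λ x → P x * 𝔼 (randomizedResponse ε (encode T x)) value)
            ≈⟨ sum-cong (λ x → trans (*-comm _ _) (*-congʳ
            (trans (unbiased (encode T x)) (reflexive (sgn-encode x))))) ⟩
        sum (λ x → σ (lookup T x) * P x)                                            ∎
        where
        open Eq
        sgn-if : ∀ b → sgn (if b then Sign.+ else Sign.-) ≡ σ b
        sgn-if true  = ≡.refl
        sgn-if false = ≡.refl
        sgn-encode : ∀ x → sgn (encode T x) ≡ σ (lookup T x)
        sgn-encode x = ≡.trans (sgn-if (does (x ∈? T))) (≡.cong σ (does-∈? T x))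

      mean≤s : ∀ T → mean T ≤ s
      mean≤s T = ≤-trans (≤-reflexive (sym (mean-message T))) (≤-const (Law-message T) λ b _ → value≤s b)

      -s≤mean : ∀ T → - s ≤ mean T
      -s≤mean T = ≤-trans (const-≤ (Law-message T) λ b _ → -s≤value b) (≤-reflexive (mean-message T))

      WithinOf : ℝ → Subset d → Set
      WithinOf B T = ∀ b → (value b - mean T) * (value b - mean T) ≤ B * B

      -- Centring removes the linear term of `exp≤x+exp[2x²]`.
      message-mgf : ∀ {B T} θ → WithinOf B T →
        𝔼 (message T) (λ b → exp (θ * (value b - mean T))) ≤ exp (fromℕ 2 * (θ * θ * (B * B)))
      message-mgf {B} {T} θ within = begin
        𝔼 (message T) (λ b → exp (θ * (value b - mean T)))
            ≤⟨ mono (Law-message T) (λ b _ → ≤-trans (exp≤x+exp[2x²] _)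
            (+-monoʳ-≤ _ (exp-mono-≤ (*-monoˡ-≤ (0≤fromℕ 2) (square b))))) ⟩
        𝔼 (message T) (λ b → θ * (value b - mean T) + c)
            ≈⟨ trans (𝔼-+ (message T) _ _) (+-cong (𝔼-* (message T) θ _) (const≈ (Law-message T) c)) ⟩
        θ * 𝔼 (message T) (λ b → value b - mean T) + c
            ≈⟨ +-congʳ (*-congˡ (trans (𝔼-+ (message T) value _)
            (+-cong (mean-message T) (const≈ (Law-message T) _)))) ⟩
        θ * (mean T - mean T) + c
            ≈⟨ solve 3 (λ t m c → t :* (m :- m) :+ c := c) refl θ (mean T) c ⟩
        c                                                             ∎
        where
        open Ineq
        c = exp (fromℕ 2 * (θ * θ * (B * B)))
        square : ∀ b → θ * (value b - mean T) * (θ * (value b - mean T)) ≤ θ * θ * (B * B)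
        square b = ≤-trans (≤-reflexive (solve 2 (λ t x → t :* x :* (t :* x) := t :* t :* (x :* x)) refl θ _))
            (*-monoˡ-≤ (0≤x² θ) (within b))

      deviation : Vec (Subset d) G → Fin G → Vec Sign n → ℝ
      deviation S g z = sum (λ (j : Fin k) → value (lookup z (combine g j)) - mean (lookup S g))

      deviation≈ : ∀ S g z → deviation S g z ≈ groupSum g z - κ * mean (lookup S g)
      deviation≈ S g z = trans (sum-+ {k} _ _) (+-congˡ
          (trans (sum-const k _) (solve 2 (λ k x → k :* :- x := :- (k :* x)) refl κ _)))

      -- The data are averaged along with the responses while the subsets stay fixed: messages are
      -- then independent across users and identically distributed within a group.
      𝔼-honest : Vec (Subset d) G → (Vec Sign n → ℝ) → ℝ
      𝔼-honest S f = 𝔼 users (λ x → 𝔼 (honestMessages S x) f)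

      group-mgf : ∀ S g {B} θ → WithinOf B (lookup S g) →
        𝔼-honest S (λ z → exp (θ * deviation S g z)) ≤ exp (κ * (fromℕ 2 * (θ * θ * (B * B))))
      group-mgf S g {B} θ within = begin
        𝔼-honest S (λ z → exp (θ * deviation S g z))
          ≈⟨ 𝔼-cong users (λ x → 𝔼-cong (honestMessages S x) λ z → as-product z) ⟩
        𝔼-honest S (λ z → prod (λ i → exp (φ (quotient k i Fin.≟ g) (lookup z i))))
          ≈⟨ 𝔼-cong users (λ x → trans (𝔼-independent-prod (Vec.tabulate (λ i → honest S i (lookup x i)))
              (λ i b → exp (φ (quotient k i Fin.≟ g) b)))
               (prod-cong λ i → reflexive (≡.cong (λ D → 𝔼 D (λ b → exp (φ (quotient k i Fin.≟ g) b)))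
                   (lookup∘tabulate (λ i → honest S i (lookup x i)) i)))) ⟩
        𝔼 users (λ x → prod (λ i → h i (lookup x i)))
          ≈⟨ trans (𝔼-independent-prod (Vec.replicate n (sample P)) h)
               (prod-cong λ i → reflexive (≡.cong (λ D → 𝔼 D (h i)) (lookup-replicate i (sample P)))) ⟩
        prod (λ i → 𝔼 (sample P) (h i))
          ≤⟨ prod-mono (λ i → const-≤ (Law-sample P-dist) λ x _ → const-≤
              (Law-randomizedResponse (encode (lookup S (quotient k i)) x)) λ b _ → 0≤exp
              (φ (quotient k i Fin.≟ g) b))
               (λ i → factor (quotient k i) (quotient k i Fin.≟ g)) ⟩
        prod (λ i → exp (if does (quotient {G} k i Fin.≟ g) then c else 0#))
          ≈⟨ trans (prod-exp {n} _) (exp-cong (trans (group-sum {G} {k} g (λ _ → c)) (sum-const k c))) ⟩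
        exp (κ * c) ∎
        where
        open Ineq
        c = fromℕ 2 * (θ * θ * (B * B))
        μ = mean (lookup S g)
        -- The decision is an argument, so that `factor` can match on it and identify `h` with `g`.
        φ : ∀ {h : Fin G} → Dec (h ≡ g) → Sign → ℝ
        φ h≟g b = if does h≟g then θ * (value b - μ) else 0#
        h : Fin n → Fin d → ℝ
        h i x = 𝔼 (honest S i x) (λ b → exp (φ (quotient k i Fin.≟ g) b))
        as-product : ∀ z → exp (θ * deviation S g z) ≈ prod (λ i → exp (φ (quotient k i Fin.≟ g) (lookup z i)))
        as-product z = sym (trans (prod-exp {n} _) (exp-cong
          (trans (group-sum {G} {k} g (λ i → θ * (value (lookup z i) - μ))) (sum-* {k} θ _))))
        factor : ∀ h (h≟g : Dec (h ≡ g)) →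
          𝔼 (sample P) (λ x → 𝔼 (randomizedResponse ε (encode (lookup S h) x)) (λ b → exp (φ h≟g b))) ≤ exp
              (if does h≟g then c else 0#)
        factor h (yes ≡.refl) = ≤-trans (≤-reflexive
            (sym (𝔼->>= (sample P) (λ x → randomizedResponse ε (encode (lookup S h) x)) _)))
          (message-mgf θ within)
        factor h (no _) = ≤-const (Law-sample P-dist) λ x _ → ≤-const
            (Law-randomizedResponse (encode (lookup S h) x)) λ b _ → ≤-refl

      module Tail (S : Vec (Subset d) G) (g : Fin G) {B : ℝ} (0<B : 0# < B) (within : WithinOf B (lookup S g)) where

        0<2B : 0# < fromℕ 2 * B
        0<2B = *-pos (0<fromℕ 1) 0<B

        -- `θ` minimises the Chernoff exponent κ (2θ²B² - 2θBr) at deviation 2Bκr; `τ` is `θ` times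
        -- that deviation.
        θ τ : ℝ
        θ = r / (fromℕ 2 * B)
        τ = κ * (r * r)

        0≤θ : 0# ≤ θ
        0≤θ = 0≤* 0≤r (<⇒≤ (⁻¹-pos 0<2B))

        -- A majorant of the indicator of a deviation of at least 2Bκr in either direction, by
        -- `0≤tail` and `1≤tail`.
        tail : Vec Sign n → ℝ
        tail z = exp (- τ) * exp (θ * deviation S g z) + exp (- τ) * exp (- θ * deviation S g z)

        0≤tail : ∀ z → 0# ≤ tail z
        0≤tail z = 0≤+ (0≤* (0≤exp _) (0≤exp _)) (0≤* (0≤exp _) (0≤exp _))

        -- The second summand is τ/2, so the left side is -τ/2 = -3ℓ.
        exponent : - τ + κ * (fromℕ 2 * (θ * θ * (B * B))) ≤ - ℓ
        exponent = *-cancelˡ-≤ (0<fromℕ 1) (begin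
          fromℕ 2 * (- τ + κ * (fromℕ 2 * (θ * θ * (B * B))))
            ≈⟨ solve 4 (λ t k h b → num 2 :* (:- t :+ k :* (num 2 :* (h :* h :* (b :* b)))) := num 2 :* (:- t) :+ k :*
                (num 2 :* b :* h :* (num 2 :* b :* h))) refl τ κ θ B ⟩
          fromℕ 2 * (- τ) + κ * (fromℕ 2 * B * θ * (fromℕ 2 * B * θ))
            ≈⟨ +-congˡ (*-congˡ (*-cong (x*[y/x]≈y r 0<2B) (x*[y/x]≈y r 0<2B))) ⟩
          fromℕ 2 * (- τ) + τ          ≈⟨ solve 1 (λ t → num 2 :* (:- t) :+ t := :- t) refl τ ⟩
          - τ                          ≈⟨ -‿cong κr²≈6ℓ ⟩
          - (fromℕ 6 * ℓ)
              ≤⟨ ≤-by (0≤* (0≤fromℕ 4) 0≤ℓ) (solve 1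
              (λ l → num 2 :* (:- l) := :- (num 6 :* l) :+ num 4 :* l) refl ℓ) ⟩
          fromℕ 2 * (- ℓ)              ∎)
          where open Ineq

        one-sided : ∀ θ′ → θ′ * θ′ ≈ θ * θ → 𝔼-honest S (λ z → exp (- τ) * exp (θ′ * deviation S g z)) ≤ exp (- ℓ)
        one-sided θ′ θ′²≈θ² = begin
          𝔼-honest S (λ z → exp (- τ) * exp (θ′ * deviation S g z))
            ≈⟨ trans (𝔼-cong users λ x → 𝔼-* (honestMessages S x) (exp (- τ)) _) (𝔼-* users (exp (- τ)) _) ⟩
          exp (- τ) * 𝔼-honest S (λ z → exp (θ′ * deviation S g z))
              ≤⟨ *-monoˡ-≤ (0≤exp _) (group-mgf S g θ′ within) ⟩
          exp (- τ) * exp (κ * (fromℕ 2 * (θ′ * θ′ * (B * B))))       ≈⟨ exp-+ _ _ ⟨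
          exp (- τ + κ * (fromℕ 2 * (θ′ * θ′ * (B * B))))
              ≈⟨ exp-cong (+-congˡ (*-congˡ (*-congˡ (*-congʳ θ′²≈θ²)))) ⟩
          exp (- τ + κ * (fromℕ 2 * (θ * θ * (B * B))))               ≤⟨ exp-mono-≤ exponent ⟩
          exp (- ℓ)                                                   ∎
          where open Ineq

        tail-bound : 𝔼-honest S tail ≤ fromℕ 2 * exp (- ℓ)
        tail-bound = begin
          𝔼-honest S tail     ≈⟨ trans (𝔼-cong users λ x → 𝔼-+ (honestMessages S x) _ _) (𝔼-+ users _ _) ⟩
          𝔼-honest S (λ z → exp (- τ) * exp (θ * deviation S g z)) + 𝔼-honest S
              (λ z → exp (- τ) * exp (- θ * deviation S g z))
                              ≤⟨ +-mono-≤ (one-sided θ refl)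
                                  (one-sided (- θ) (solve 1 (λ t → :- t :* :- t := t :* t) refl θ)) ⟩
          exp (- ℓ) + exp (- ℓ) ≈⟨ solve 1 (λ x → x :+ x := num 2 :* x) refl (exp (- ℓ)) ⟩
          fromℕ 2 * exp (- ℓ) ∎
          where open Ineq

        1≤exp-shift : ∀ x → fromℕ 2 * B * (κ * r) ≤ x → 1# ≤ exp (- τ) * exp (θ * x)
        1≤exp-shift x large = begin
          1#
              ≤⟨ 1≤exp (≤-trans (≤⇒0≤- (*-monoˡ-≤ 0≤θ large))
              (≤-reflexive (trans (+-comm _ _) (+-congʳ (-‿cong θ-large))))) ⟩
          exp (- τ + θ * x)              ≈⟨ exp-+ _ _ ⟩
          exp (- τ) * exp (θ * x)        ∎
          where
          open Ineq
          θ-large : θ * (fromℕ 2 * B * (κ * r)) ≈ τ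
          θ-large = trans (solve 4 (λ h b k r → h :* (b :* (k :* r)) := k :* (b :* h :* r)) refl θ (fromℕ 2 * B) κ r)
            (*-congˡ (*-congʳ (x*[y/x]≈y r 0<2B)))

        1≤tail : ∀ z → fromℕ 2 * B * (κ * r) ≤ deviation S g z ⊎ fromℕ 2 * B *
            (κ * r) ≤ - deviation S g z → 1# ≤ tail z
        1≤tail z (inj₁ large) = ≤-trans (1≤exp-shift _ large) (≤-by (0≤* (0≤exp _) (0≤exp _)) refl)
        1≤tail z (inj₂ large) = ≤-trans (1≤exp-shift _ large) (≤-by (0≤* (0≤exp (- τ)) (0≤exp (θ * deviation S g z)))
          (trans (+-comm _ _) (+-congʳ (*-congˡ (exp-cong (solve 2 (λ t x → :- t :* x := t :* :- x) refl θ _))))))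

  -- The two guarantees

  module Guarantee (G k : ℕ) (ε : ℝ) (m : ℕ) (β : ℝ) (d : ℕ) (0<ε : 0# < ε)
    (0<β : 0# < β) (β<1 : β < 1#) (1≤G : 1 ℕ.≤ G) (1≤k : 1 ℕ.≤ k) (1≤d : 1 ℕ.≤ d) (2∣d : 2 ∣ d)
    (M : RAPTOR.Attacker G k ε m β {d}) where
    open RandomizedResponse ε 0<ε
    open RAPTOR G k ε m β {d}
    open Raptor G k ε m β d 0<ε 0<β β<1 1≤G 1≤k

    HalfSized : Vec (Subset d) G → Set
    HalfSized S = ∀ g → ∣ lookup S g ∣ ≡ d ℕ./ 2

    mᴿ : ℝ
    mᴿ = fromℕ m

    κp̃≈groupSum : ∀ y g → κ * p̃ y g ≈ groupSum g y
    κp̃≈groupSum y g = trans (sym (*-assoc _ _ _)) (trans (*-congʳ κγ≈1) (*-identityˡ _))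

    κα≈ : κ * α ≈ s * (κ * r + fromℕ 2 * mᴿ)
    κα≈ = begin
      κ * (s * (r + fromℕ 2 * mᴿ * fromℕ G * fromℕ n ⁻¹))
        ≈⟨ solve 6 (λ k s r m g n → k :* (s :* (r :+ num 2 :* m :* g :* n)) := s :*
            (k :* r :+ num 2 :* m :* (k :* (g :* n)))) refl κ s r mᴿ (fromℕ G) (fromℕ n ⁻¹) ⟩
      s * (κ * r + fromℕ 2 * mᴿ * (κ * γ))   ≈⟨ *-congˡ (+-congˡ (trans (*-congˡ κγ≈1) (*-identityʳ _))) ⟩
      s * (κ * r + fromℕ 2 * mᴿ)             ∎
      where open Eq

    threshold : ℝ
    threshold = fromℕ 2 * (s * (κ * r + fromℕ 2 * mᴿ))

    κ2α≈threshold : κ * (fromℕ 2 * α) ≈ threshold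
    κ2α≈threshold = trans (solve 2 (λ k a → k :* (num 2 :* a) := num 2 :* (k :* a)) refl κ α) (*-congˡ κα≈)

    -- A view of the verdict through group sums: inequalities are scaled by `κ`, the absolute value
    -- is split by sign, and strictness is dropped.
    data Aggregated (y : Vec Sign n) : Set where
      rejected : ∀ g → aggregate y ≡ notUniform → threshold ≤ groupSum g y ⊎ threshold ≤ - groupSum g y → Aggregated y
      accepted : aggregate y ≡ uniform → (∀ g → groupSum g y ≤ threshold × - groupSum g y ≤ threshold) → Aggregated y

    κ-neg-p̃ : ∀ y g → κ * - p̃ y g ≈ - groupSum g y
    κ-neg-p̃ y g = trans (solve 2 (λ k a → k :* :- a := :- (k :* a)) refl κ (p̃ y g)) (-‿cong (κp̃≈groupSum y g))

    scale-≥ : ∀ {u v} → κ * u ≈ v → fromℕ 2 * α < u → threshold ≤ v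
    scale-≥ κu≈v 2α<u = ≤-trans (≤-reflexive (sym κ2α≈threshold))
        (≤-trans (*-monoˡ-≤ (<⇒≤ 0<κ) (<⇒≤ 2α<u)) (≤-reflexive κu≈v))

    scale-≤ : ∀ {u v} → κ * u ≈ v → u ≤ fromℕ 2 * α → v ≤ threshold
    scale-≤ κu≈v u≤2α = ≤-trans (≤-reflexive (sym κu≈v))
        (≤-trans (*-monoˡ-≤ (<⇒≤ 0<κ) u≤2α) (≤-reflexive κ2α≈threshold))

    aggregated : ∀ y → Aggregated y
    aggregated y with any? (λ g → fromℕ 2 * α <? abs (p̃ y g)) in eq
    ... | yes (g , 2α<∣p̃∣) = rejected g (≡.cong (λ w → if does w then notUniform else uniform) eq)
            (Sum.map (scale-≥ (κp̃≈groupSum y g)) (scale-≥ (κ-neg-p̃ y g)) (<∣x∣ 2α<∣p̃∣))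
    ... | no  none = accepted (≡.cong (λ w → if does w then notUniform else uniform) eq) λ g →
            let ∣p̃∣≤2α = ≮⇒≥ λ 2α<∣p̃∣ → none (g , 2α<∣p̃∣) in
            scale-≤ (κp̃≈groupSum y g) (≤-trans (x≤∣x∣ _) ∣p̃∣≤2α) , scale-≤ (κ-neg-p̃ y g)
                (≤-trans (-x≤∣x∣ _) ∣p̃∣≤2α)

    contrast-𝐔≈0 : ∀ T → ∣ T ∣ ≡ d ℕ./ 2 → contrast 𝐔 T ≈ 0#
    contrast-𝐔≈0 T half = begin
      sum (λ i → σ (lookup T i) * (1# / fromℕ d))   ≈⟨ sum-cong (λ i → *-comm (σ (lookup T i)) (1# / fromℕ d)) ⟩
      sum (λ i → 1# / fromℕ d * σ (lookup T i))     ≈⟨ sum-* (1# / fromℕ d) (λ i → σ (lookup T i)) ⟩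
      1# / fromℕ d * sum (λ i → σ (lookup T i))     ≈⟨ *-congˡ (balanced 2∣d T half) ⟩
      1# / fromℕ d * 0#                             ≈⟨ zeroʳ _ ⟩
      0#                                            ∎
      where open Eq

    0<d : 0# < fromℕ d
    0<d = 0<fromℕ′ 1≤d

    𝐔-dist : IsDistribution {d} 𝐔
    𝐔-dist = (λ _ → 0≤* 0≤1 (<⇒≤ (⁻¹-pos 0<d))) , trans (sum-const d _) (x*[y/x]≈y 1# 0<d)

    -- The game with the public randomness fixed

    module _ (P : Fin d → ℝ) (P-dist : IsDistribution P) where
      open Data P P-dist

      attack : (Vec Sign n → ℝ) → Vec (Subset d) G → ℝ
      attack f S = 𝔼 users (λ x → 𝔼 (Attacker.strategy M x S)
          (λ a → 𝔼 (independent (Vec.tabulate (respond x S a))) f))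

      Law-strategy : ∀ x S → IsLaw (Attacker.strategy M x S)
      Law-strategy x S = IsProbability⇒IsLaw (Attacker.isProbability M x S)

      attack-≤ : ∀ S (f f′ : Vec Sign n → ℝ) → (∀ {C} y z → ∣ C ∣ ≡ m → Agree C y z → f y ≤ f′ z) →
                 attack f S ≤ 𝔼-honest S f′
      attack-≤ S f f′ f≤f′ = mono Law-users λ x _ → ≤-const
          (Law-strategy x S) λ a _ → corruption-bound S x a f f′ f≤f′

      -- Data and subsets are drawn independently, so the subsets may be averaged last. For fixed
      -- subsets the tail bounds average over the data, while the attacker still sees both.
      𝔼-Manip : ∀ f → 𝔼 (Manip P M) f ≈ 𝔼 publicRandomness (attack (f ∘ aggregate))
      𝔼-Manip f = begin
        𝔼 (users >>= k₁) f                                               ≈⟨ 𝔼->>= users k₁ f ⟩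
        𝔼 users (λ x → 𝔼 (k₁ x) f)                                       ≈⟨ 𝔼-cong users (λ x → begin
          𝔼 (k₁ x) f                                                     ≈⟨ 𝔼->>= publicRandomness (k₂ x) f ⟩
          𝔼 publicRandomness (λ S → 𝔼 (k₂ x S) f)                        ≈⟨ 𝔼-cong publicRandomness (λ S → begin
            𝔼 (k₂ x S) f
                ≈⟨ 𝔼->>= (Attacker.strategy M x S) (k₃ x S) f ⟩
            𝔼 (Attacker.strategy M x S) (λ a → 𝔼 (k₃ x S a) f)           ≈⟨ 𝔼-cong (Attacker.strategy M x S) (λ a →
              trans (𝔼->>= (independent (Vec.tabulate (respond x S a))) (λ y → pure (aggregate y)) f)
                    (𝔼-cong (independent (Vec.tabulate (respond x S a))) λ y → 𝔼-pure (aggregate y) f)) ⟩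
            inner x S                                                    ∎) ⟩
          𝔼 publicRandomness (inner x)                                   ∎) ⟩
        𝔼 users (λ x → 𝔼 publicRandomness (inner x))                     ≈⟨ 𝔼-comm users publicRandomness inner ⟩
        𝔼 publicRandomness (attack (f ∘ aggregate))                      ∎
        where
        open Eq
        inner : Vec (Fin d) n → Vec (Subset d) G → ℝ
        inner x S = 𝔼 (Attacker.strategy M x S) (λ a → 𝔼 (independent (Vec.tabulate (respond x S a))) (f ∘ aggregate))
        k₃ : (x : Vec (Fin d) n) (S : Vec (Subset d) G) (a : Corruption m n) → Weighted Verdict
        k₃ x S a = independent (Vec.tabulate (respond x S a)) >>= λ y → pure (aggregate y)
        k₂ : (x : Vec (Fin d) n) (S : Vec (Subset d) G) → Weighted Verdict
        k₂ x S = Attacker.strategy M x S >>= k₃ x S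
        k₁ : (x : Vec (Fin d) n) → Weighted Verdict
        k₁ x = publicRandomness >>= k₂ x

      Manip-mass : 𝔼 (Manip P M) (λ _ → 1#) ≈ 1#
      Manip-mass = trans (𝔼-Manip (λ _ → 1#)) (trans
        (𝔼-cong publicRandomness λ S → trans (𝔼-cong users λ x → trans (𝔼-cong (Attacker.strategy M x S) λ a →
          mass (Law-independent (Vec.tabulate (respond x S a)) {λ _ → ⊤}
              (Law-tabulate (respond x S a) (Law-respond x S a)))) (mass (Law-strategy x S))) (mass Law-users))
        (mass Law-publicRandomness))

      failure : Verdict → Verdict → ℝ
      failure v w = if does (w ≟ᵛ v) then 0# else 1#

      ℙ-Manip : ∀ v → 𝔼 publicRandomness (attack (failure v ∘ aggregate)) ≤ β → 1# - β ≤ ℙ (Manip P M) (_≟ᵛ v)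
      ℙ-Manip v small = ≤-by (≤⇒0≤- small) (begin
        ℙ (Manip P M) (_≟ᵛ v)                    ≈⟨ solve 3 (λ p f b → p := (p :+ f) :- b :+ (b :- f)) refl _ F β ⟩
        (ℙ (Manip P M) (_≟ᵛ v) + F) - β + (β - F)
            ≈⟨ +-congʳ (+-congʳ (trans (trans (+-congˡ (sym (𝔼-Manip (failure v))))
            (ℙ-complement (Manip P M) (_≟ᵛ v))) Manip-mass)) ⟩
        1# - β + (β - F)                          ∎)
        where
        open Eq
        F = 𝔼 publicRandomness (attack (failure v ∘ aggregate))

    -- Acceptance of the uniform distribution

    acceptsUniform : AcceptsUniform M
    acceptsUniform = ℙ-Manip 𝐔 𝐔-dist uniform (≤-const Law-publicRandomness λ S half → bound S half)
      where
      open Data 𝐔 𝐔-dist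
      module _ (S : Vec (Subset d) G) (half : HalfSized S) where
        mean≈0 : ∀ g → mean (lookup S g) ≈ 0#
        mean≈0 g = contrast-𝐔≈0 (lookup S g) (half g)
        -- The mean is 0, so the centred message has size exactly `s`; the tail level 2sκr is then
        -- the noise part of the threshold.
        within : ∀ g → WithinOf s (lookup S g)
        within g b = ≤-reflexive (trans (*-cong drop drop) (value² b))
          where
          drop : value b - mean (lookup S g) ≈ value b
          drop = trans (+-congˡ (-‿cong (mean≈0 g))) (solve 1 (λ x → x :- num 0 := x) refl (value b))
        module T (g : Fin G) = Tail S g 0<s (within g)
        0≤ms : 0# ≤ mᴿ * s
        0≤ms = 0≤* (0≤fromℕ m) (<⇒≤ 0<s)
        deviation≈groupSum : ∀ g z → deviation S g z ≈ groupSum g z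
        deviation≈groupSum g z = trans (deviation≈ S g z)
            (trans (+-congˡ (-‿cong (*-congˡ (mean≈0 g)))) (solve 2 (λ x k → x :- k :* num 0 := x) refl _ κ))
        -- The threshold allows 4ms for corruption, of which 2ms is used.
        large : ∀ {x y} → threshold ≤ y → y ≤ x + fromℕ 2 * mᴿ * s → fromℕ 2 * s * (κ * r) ≤ x
        large {x} {y} threshold≤y y≤x+ = ≤-by (0≤+ (0≤+ (≤⇒0≤- threshold≤y) (≤⇒0≤- y≤x+)) (0≤* (0≤fromℕ 2) 0≤ms))
          (solve 5 (λ x y s a m → x := num 2 :* s :* a :+
              ((y :- num 2 :* (s :* (a :+ num 2 :* m))) :+ ((x :+ num 2 :* m :* s) :- y) :+ num 2 :* (m :* s)))
            refl x y s (κ * r) mᴿ)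
        pointwise : ∀ {C} y z → ∣ C ∣ ≡ m → Agree C y z → failure 𝐔 𝐔-dist uniform (aggregate y) ≤ sum
            (λ g → T.tail g z)
        pointwise {C} y z ∣C∣≡m agree with aggregated y
        ... | accepted eq _ rewrite eq = sum-0≤ λ g → T.0≤tail g z
        ... | rejected g eq big rewrite eq = ≤-trans (T.1≤tail g z (Sum.map
                (λ threshold≤y → ≤-trans (large threshold≤y (groupSum-corrupted y z g ∣C∣≡m agree))
                    (≤-reflexive (sym (deviation≈groupSum g z))))
                (λ threshold≤-y → ≤-trans (large threshold≤-y (neg-groupSum-corrupted y z g ∣C∣≡m agree))
                    (≤-reflexive (-‿cong (sym (deviation≈groupSum g z))))) big))
              (term≤sum (λ h → T.0≤tail h z) g)
        bound : attack 𝐔 𝐔-dist (failure 𝐔 𝐔-dist uniform ∘ aggregate) S ≤ β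
        bound = begin
          attack 𝐔 𝐔-dist (failure 𝐔 𝐔-dist uniform ∘ aggregate) S   ≤⟨ attack-≤ 𝐔 𝐔-dist S _ _ pointwise ⟩
          𝔼-honest S (λ z → sum (λ g → T.tail g z))
              ≈⟨ trans (𝔼-cong users λ x → 𝔼-sum (honestMessages S x) {G} _) (𝔼-sum users {G} _) ⟩
          sum (λ g → 𝔼-honest S (T.tail g))                          ≤⟨ sum-mono (λ g → T.tail-bound g) ⟩
          sum {G} (λ _ → fromℕ 2 * exp (- ℓ))                        ≈⟨ sum-const G _ ⟩
          fromℕ G * (fromℕ 2 * exp (- ℓ))
              ≤⟨ ≤-by (0≤* (0≤fromℕ 2) (0≤* (0≤fromℕ G) (0≤exp (- ℓ))))
               (solve 2 (λ g e → num 4 :* g :* e := g :* (num 2 :* e) :+ num 2 :* (g :* e)) refl (fromℕ G)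
                   (exp (- ℓ))) ⟩
          fromℕ 4 * fromℕ G * exp (- ℓ)                              ≈⟨ 4G*exp[-ℓ]≈β ⟩
          β                                                          ∎
          where open Ineq

    -- Rejection of far distributions

    module Far (1≤m : 1 ℕ.≤ m) (4≤G : 4 ℕ.≤ G) (12ln[2/β]≤G : fromℕ 12 * ln (fromℕ 2 / β) ≤ fromℕ G)
               (P : Fin d → ℝ) (P-dist : IsDistribution P) (far : distanceThreshold (fromℕ 48) ≤ ‖ P - 𝐔 ‖₁) where
      open Data P P-dist

      δ : Fin d → ℝ
      δ i = P i - 𝐔 i

      ∑δ≈0 : sum δ ≈ 0#
      ∑δ≈0 = trans (sum-minus P 𝐔) (trans (+-cong (proj₂ P-dist) (-‿cong (proj₂ 𝐔-dist))) (-‿inverseʳ 1#))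

      open Anticoncentration 1≤d 2∣d δ ∑δ≈0 using (V; Z; miss; miss≤exp)

      Z≈mean : ∀ T → ∣ T ∣ ≡ d ℕ./ 2 → Z T ≈ mean T
      Z≈mean T half = begin
        sum (λ i → σ (lookup T i) * (P i - 𝐔 i))
            ≈⟨ sum-cong (λ i → solve 3 (λ a x y → a :* (x :- y) := a :* x :- a :* y) refl (σ (lookup T i)) (P i)
            (𝐔 i)) ⟩
        sum (λ i → σ (lookup T i) * P i - σ (lookup T i) * 𝐔 i)
            ≈⟨ sum-minus (λ i → σ (lookup T i) * P i) (λ i → σ (lookup T i) * 𝐔 i) ⟩
        mean T - contrast 𝐔 T
            ≈⟨ +-congˡ (-‿cong (contrast-𝐔≈0 T half)) ⟩
        mean T - 0#
            ≈⟨ solve 1 (λ x → x :- num 0 := x) refl _ ⟩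
        mean T                                                                ∎
        where open Eq

      -- `T₂` is the distance threshold with its factor √d removed: a lower bound for √V, hence for
      -- twice the absolute mean of a hit group. `r′` corresponds to `r` with the logarithm of the
      -- distance threshold.
      ℓ′ r′ √d T₂ : ℝ
      ℓ′ = ln (fromℕ G / β)
      r′ = √ (γ * ℓ′)
      √d = √ (fromℕ d)
      T₂ = fromℕ 48 * s * (r′ + mᴿ * γ)

      4≤G/β : fromℕ 4 ≤ fromℕ G / β
      4≤G/β = *-cancelˡ-≤ 0<β (begin
        β * fromℕ 4         ≤⟨ *-monoʳ-≤ (0≤fromℕ 4) (<⇒≤ β<1) ⟩
        1# * fromℕ 4        ≈⟨ *-identityˡ _ ⟩
        fromℕ 4             ≤⟨ fromℕ-mono 4≤G ⟩
        fromℕ G             ≈⟨ x*[y/x]≈y _ 0<β ⟨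
        β * (fromℕ G / β)   ∎)
        where open Ineq

      1≤G/β : 1# ≤ fromℕ G / β
      1≤G/β = ≤-trans (≤-by (0≤fromℕ 3) (solve 0 (num 4 := num 1 :+ num 3) refl)) 4≤G/β

      0≤ℓ′ : 0# ≤ ℓ′
      0≤ℓ′ = 0≤ln 1≤G/β

      exp-ℓ′ : exp ℓ′ ≈ fromℕ G / β
      exp-ℓ′ = exp-ln (<-≤-trans 0<1 1≤G/β)

      -- 4G/β ≤ (G/β)² because G/β is at least 4; this is the purpose of the summand 4 in
      -- `groupCount`.
      ℓ≤2ℓ′ : ℓ ≤ ℓ′ + ℓ′
      ℓ≤2ℓ′ = exp-cancel-≤ (begin
        exp ℓ                                  ≈⟨ exp-ln (<-≤-trans 0<1 1≤4G/β) ⟩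
        (fromℕ 4 * fromℕ G) * β ⁻¹             ≈⟨ *-assoc _ _ _ ⟩
        fromℕ 4 * (fromℕ G / β)                ≤⟨ *-monoʳ-≤ (≤-trans 0≤1 1≤G/β) 4≤G/β ⟩
        fromℕ G / β * (fromℕ G / β)            ≈⟨ *-cong exp-ℓ′ exp-ℓ′ ⟨
        exp ℓ′ * exp ℓ′                        ≈⟨ exp-+ ℓ′ ℓ′ ⟨
        exp (ℓ′ + ℓ′)                          ∎)
        where open Ineq

      0≤γℓ′ : 0# ≤ γ * ℓ′
      0≤γℓ′ = 0≤* (<⇒≤ 0<γ) 0≤ℓ′

      0≤r′ : 0# ≤ r′
      0≤r′ = √-nonNeg 0≤γℓ′

      -- 6ℓ ≤ 12ℓ′ ≤ 16ℓ′, rounded up to a perfect square.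
      r≤4r′ : r ≤ fromℕ 4 * r′
      r≤4r′ = square-≤ (0≤* (0≤fromℕ 4) 0≤r′) (begin
        r * r                              ≈⟨ r²≈6γℓ ⟩
        fromℕ 6 * γ * ℓ                    ≤⟨ *-monoˡ-≤ (0≤* (0≤fromℕ 6) (<⇒≤ 0<γ)) ℓ≤2ℓ′ ⟩
        fromℕ 6 * γ * (ℓ′ + ℓ′)
            ≤⟨ ≤-by (0≤* (0≤fromℕ 4) 0≤γℓ′) (solve 2
            (λ g l → num 16 :* (g :* l) := num 6 :* g :* (l :+ l) :+ num 4 :* (g :* l)) refl γ ℓ′) ⟩
        fromℕ 16 * (γ * ℓ′)                ≈⟨ *-congˡ (√-square 0≤γℓ′) ⟨
        fromℕ 16 * (r′ * r′)
            ≈⟨ solve 1 (λ r → num 16 :* (r :* r) := num 4 :* r :* (num 4 :* r)) refl r′ ⟩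
        fromℕ 4 * r′ * (fromℕ 4 * r′)      ∎)
        where open Ineq

      0≤√d : 0# ≤ √d
      0≤√d = √-nonNeg (0≤fromℕ d)

      √d² : √d * √d ≈ fromℕ d
      √d² = √-square (0≤fromℕ d)

      √d*T₂≤‖δ‖ : √d * T₂ ≤ ‖ P - 𝐔 ‖₁
      √d*T₂≤‖δ‖ = begin
        √d * T₂
          ≈⟨ solve 6 (λ D s r m g n → D :* (num 48 :* s :* (r :+ m :* (g :* n))) := num 48 :* s :*
              (D :* r :+ m :* g :* D :* n)) refl √d s r′ mᴿ (fromℕ G) (fromℕ n ⁻¹) ⟩
        fromℕ 48 * s * (√d * r′ + mᴿ * fromℕ G * √d * fromℕ n ⁻¹)
          ≤⟨ *-monoˡ-≤ (0≤* (0≤fromℕ 48) (<⇒≤ 0<s)) (+-monoˡ-≤ _ √dr′≤) ⟩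
        distanceThreshold (fromℕ 48)   ≤⟨ far ⟩
        ‖ P - 𝐔 ‖₁                     ∎
        where
        open Ineq
        0≤arg : 0# ≤ (fromℕ d * fromℕ G) / fromℕ n * ℓ′
        0≤arg = 0≤* (0≤* (0≤* (0≤fromℕ d) (0≤fromℕ G)) (<⇒≤ (⁻¹-pos 0<n))) 0≤ℓ′
        √dr′≤ : √d * r′ ≤ √ ((fromℕ d * fromℕ G) / fromℕ n * ℓ′)
        √dr′≤ = square-≤ (√-nonNeg 0≤arg) (≤-reflexive (begin-equality
          √d * r′ * (√d * r′)
              ≈⟨ solve 2 (λ D r → D :* r :* (D :* r) := D :* D :* (r :* r)) refl √d r′ ⟩
          √d * √d * (r′ * r′)                                ≈⟨ *-cong √d² (√-square 0≤γℓ′) ⟩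
          fromℕ d * (γ * ℓ′)
              ≈⟨ solve 4 (λ d g n l → d :* (g :* n :* l) := d :* g :* n :* l) refl (fromℕ d) (fromℕ G)
              (fromℕ n ⁻¹) ℓ′ ⟩
          (fromℕ d * fromℕ G) / fromℕ n * ℓ′                 ≈⟨ √-square 0≤arg ⟨
          √ ((fromℕ d * fromℕ G) / fromℕ n * ℓ′) * √ ((fromℕ d * fromℕ G) / fromℕ n * ℓ′) ∎))

      -- The corruption term is positive as `1≤m`. Through `0<V` this supplies the strict positivity
      -- that `miss≤exp` asks for.
      0<T₂ : 0# < T₂
      0<T₂ = *-pos (*-pos (0<fromℕ 47) 0<s) (<-respʳ-≈ (+-comm _ _) (0<+ (*-pos (0<fromℕ′ 1≤m) 0<γ) 0≤r′))

      -- By Cauchy-Schwarz the squared first norm of `δ` is at most d V; the √d in the distance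
      -- threshold pays for this change of norm.
      T₂²≤V : T₂ * T₂ ≤ V
      T₂²≤V = *-cancelˡ-≤ 0<d (begin
        fromℕ d * (T₂ * T₂)                         ≈⟨ *-congʳ √d² ⟨
        √d * √d * (T₂ * T₂)
            ≈⟨ solve 2 (λ D t → D :* D :* (t :* t) := D :* t :* (D :* t)) refl √d T₂ ⟩
        √d * T₂ * (√d * T₂)                         ≤⟨ *-mono-≤ 0≤√d*T₂ 0≤√d*T₂ √d*T₂≤‖δ‖ √d*T₂≤‖δ‖ ⟩
        ‖ P - 𝐔 ‖₁ * ‖ P - 𝐔 ‖₁                     ≤⟨ cauchySchwarz (λ i → abs (δ i)) ⟩
        fromℕ d * sum (λ i → abs (δ i) * abs (δ i)) ≈⟨ *-congˡ (sum-cong λ i → ∣x∣² (δ i)) ⟩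
        fromℕ d * V                                 ∎)
        where
        open Ineq
        0≤√d*T₂ : 0# ≤ √d * T₂
        0≤√d*T₂ = 0≤* 0≤√d (<⇒≤ 0<T₂)

      0<V : 0# < V
      0<V = <-≤-trans (*-pos 0<T₂ 0<T₂) T₂²≤V

      -- Message and mean both lie between `- s` and `s`; as the mean may differ from 0 here, the
      -- bound is twice that of the uniform case.
      within : ∀ T → WithinOf (fromℕ 2 * s) T
      within T b = ≤-by (0≤* (0≤+ (≤⇒0≤- (value≤s b)) (≤⇒0≤- (-s≤mean T)))
          (0≤+ (≤⇒0≤- (-s≤value b)) (≤⇒0≤- (mean≤s T))))
        (solve 3 (λ s v m → num 2 :* s :* (num 2 :* s) := (v :- m) :* (v :- m) :+ ((s :- v) :+ (m :- (:- s))) :*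
            ((v :- (:- s)) :+ (s :- m))) refl s (value b) (mean T))

      0≤miss : ∀ T → 0# ≤ miss T
      0≤miss T with fromℕ 4 * (Z T * Z T) <? V
      ... | yes _ = 0≤1
      ... | no  _ = ≤-refl

      module _ (S : Vec (Subset d) G) (half : HalfSized S) where

        Hit : Fin G → Set
        Hit g = ¬ (fromℕ 4 * (Z (lookup S g) * Z (lookup S g)) < V)

        module _ (g : Fin G) (hit : Hit g) where
          open Tail S g (*-pos (0<fromℕ 1) 0<s) (within (lookup S g))

          μ : ℝ
          μ = mean (lookup S g)

          T₂≤2∣μ∣ : T₂ ≤ fromℕ 2 * μ ⊎ T₂ ≤ - (fromℕ 2 * μ)
          T₂≤2∣μ∣ = ≤∣x∣ (square-≤ (0≤∣x∣ _) (begin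
            T₂ * T₂                                       ≤⟨ T₂²≤V ⟩
            V                                             ≤⟨ ≮⇒≥ hit ⟩
            fromℕ 4 * (Z (lookup S g) * Z (lookup S g))
                ≈⟨ *-congˡ (*-cong (Z≈mean (lookup S g) (half g)) (Z≈mean (lookup S g) (half g))) ⟩
            fromℕ 4 * (μ * μ)
                ≈⟨ solve 1 (λ u → num 4 :* (u :* u) := num 2 :* u :* (num 2 :* u)) refl μ ⟩
            fromℕ 2 * μ * (fromℕ 2 * μ)                   ≈⟨ ∣x∣² (fromℕ 2 * μ) ⟨
            abs (fromℕ 2 * μ) * abs (fromℕ 2 * μ)         ∎))
            where open Ineq

          κT₂ : κ * T₂ ≈ fromℕ 48 * s * (κ * r′ + mᴿ)
          κT₂ = trans (solve 5 (λ k s r m g → k :* (num 48 :* s :* (r :+ m :* g)) := num 48 :* s :*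
              (k :* r :+ m :* (k :* g))) refl κ s r′ mᴿ γ)
            (*-congˡ (+-congˡ (trans (*-congˡ κγ≈1) (*-identityʳ _))))

          -- Origin of the constant 48. After doubling, 2κu must cover 8sκr for the tail level, 4sκr
          -- + 8sm for the threshold and 4sm for corruption, together 12sκr + 12sm. By `r≤4r′` the
          -- first term is at most 48sκr′; the second leaves a slack of 36sm.
          large : ∀ {u y z} → T₂ ≤ fromℕ 2 * u → y ≤ threshold → z ≤ y + fromℕ 2 * mᴿ * s →
            fromℕ 2 * (fromℕ 2 * s) * (κ * r) ≤ κ * u - z
          large {u} {y} {z} T₂≤2u y≤ z≤ = *-cancelˡ-≤ (0<fromℕ 1) (≤-by
            (0≤+ (0≤+ (≤⇒0≤- κT₂≤) (0≤+ (0≤* (0≤fromℕ 2) (≤⇒0≤- y≤)) (0≤* (0≤fromℕ 2) (≤⇒0≤- z≤))))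
                 (0≤+ (0≤* (0≤* (0≤fromℕ 12) (0≤* (<⇒≤ 0<s) (<⇒≤ 0<κ))) (≤⇒0≤- r≤4r′))
                     (0≤* (0≤fromℕ 36) (0≤* (<⇒≤ 0<s) (0≤fromℕ m)))))
            (solve 8 (λ k u y z s r q m → num 2 :* (k :* u :- z) := num 2 :* (num 2 :* (num 2 :* s) :* (k :* r))
               :+ ((k :* (num 2 :* u) :- num 48 :* s :* (k :* q :+ m))
                 :+ (num 2 :* (num 2 :* (s :* (k :* r :+ num 2 :* m)) :- y) :+ num 2 :* (y :+ num 2 :* m :* s :- z))
                 :+ (num 12 :* (s :* k) :* (num 4 :* q :- r) :+ num 36 :* (s :* m)))) refl κ u y z s r r′ mᴿ))
            where
            κT₂≤ : fromℕ 48 * s * (κ * r′ + mᴿ) ≤ κ * (fromℕ 2 * u)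
            κT₂≤ = ≤-trans (≤-reflexive (sym κT₂)) (*-monoˡ-≤ (<⇒≤ 0<κ) T₂≤2u)

          pointwise : ∀ {C} y z → ∣ C ∣ ≡ m → Agree C y z → failure P P-dist notUniform (aggregate y) ≤ tail z
          pointwise y z ∣C∣≡m agree with aggregated y
          ... | rejected _ eq _ rewrite eq = 0≤tail z
          -- A large positive mean with an accepted group sum forces a large negative deviation, and
          -- conversely, whence `Sum.swap`.
          ... | accepted eq small rewrite eq = 1≤tail z (Sum.swap (Sum.map
              (λ T₂≤2μ → ≤-trans (large {μ} T₂≤2μ (proj₁ (small g)) (groupSum-corrupted z y g ∣C∣≡m agree′))
                 (≤-reflexive (sym (trans (-‿cong (deviation≈ S g z))
                     (solve 2 (λ a b → :- (a :- b) := b :- a) refl _ _)))))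
              (λ T₂≤-2μ → ≤-trans (large { - μ} (≤-trans T₂≤-2μ
                  (≤-reflexive (solve 1 (λ u → :- (num 2 :* u) := num 2 :* :- u) refl μ))) (proj₂ (small g))
                  (neg-groupSum-corrupted z y g ∣C∣≡m agree′))
                 (≤-reflexive (sym (trans (deviation≈ S g z)
                     (solve 3 (λ a k u → a :- k :* u := k :* :- u :- (:- a)) refl _ κ μ)))))
              T₂≤2∣μ∣))
            where
            agree′ : Agree _ z y
            agree′ i i∉C = ≡.sym (agree i i∉C)

          hit-bound : attack P P-dist (failure P P-dist notUniform ∘ aggregate) S ≤ fromℕ 2 * exp (- ℓ)
          hit-bound = ≤-trans (attack-≤ P P-dist S _ _ pointwise) tail-bound

        failure≤1 : ∀ v → failure P P-dist notUniform v ≤ 1#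
        failure≤1 uniform    = ≤-refl
        failure≤1 notUniform = 0≤1

        -- Whether a group is hit depends on the subsets alone, so one hit group is fixed before any
        -- message is drawn and a single tail is paid. If there is none, the product of the `miss`
        -- indicators is 1 and covers the trivial bound.
        far-bound : attack P P-dist (failure P P-dist notUniform ∘ aggregate) S ≤ fromℕ 2 * exp (- ℓ) + prod
            (λ g → miss (lookup S g))
        far-bound with any? (λ g → ¬? (fromℕ 4 * (Z (lookup S g) * Z (lookup S g)) <? V))
        ... | yes (g , hit) = ≤-trans (hit-bound g hit) (≤-by (prod-0≤ λ g → 0≤miss (lookup S g)) refl)
        ... | no  none = begin
          attack P P-dist (failure P P-dist notUniform ∘ aggregate) S
            ≤⟨ ≤-const Law-users (λ x _ → ≤-const (Law-strategy P P-dist x S) λ a _ →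
                 ≤-const (Law-independent (Vec.tabulate (respond x S a)) {λ _ → ⊤}
                     (Law-tabulate (respond x S a) (Law-respond x S a))) λ y _ → failure≤1 (aggregate y)) ⟩
          1#                                                             ≈⟨ prod-one all-missed ⟨
          prod (λ g → miss (lookup S g))
              ≤⟨ ≤-by (0≤* (0≤fromℕ 2) (0≤exp (- ℓ))) (+-comm _ _) ⟩
          fromℕ 2 * exp (- ℓ) + prod (λ g → miss (lookup S g))           ∎
          where
          open Ineq
          all-missed : ∀ g → miss (lookup S g) ≈ 1#
          all-missed g with fromℕ 4 * (Z (lookup S g) * Z (lookup S g)) <? V
          ... | yes _   = refl
          ... | no  hit = contradiction (g , hit) none

      -- The subsets are independent, so the miss probabilities multiply to at most exp (-G/12).
      all-miss : 𝔼 publicRandomness (λ S → prod (λ g → miss (lookup S g))) ≤ exp (- ln (fromℕ 2 / β))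
      all-miss = begin
        𝔼 publicRandomness (λ S → prod (λ g → miss (lookup S g)))
          ≈⟨ trans (𝔼-independent-prod (Vec.replicate G (randomHalf d)) (λ _ → miss))
               (prod-cong {G} λ g → reflexive (≡.cong (λ D → 𝔼 D miss) (lookup-replicate g (randomHalf d)))) ⟩
        prod {G} (λ _ → 𝔼 (randomHalf d) miss)
          ≤⟨ prod-mono {G} (λ _ → const-≤ (Law-randomHalf d) λ T _ → 0≤miss T) (λ _ → miss≤exp 0<V) ⟩
        prod {G} (λ _ → exp (- (fromℕ 12 ⁻¹)))              ≈⟨ trans (prod-exp {G} _) (exp-cong (sum-const G _)) ⟩
        exp (fromℕ G * - (fromℕ 12 ⁻¹))                     ≤⟨ exp-mono-≤ (*-cancelˡ-≤ (0<fromℕ 11) (begin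
          fromℕ 12 * (fromℕ G * - (fromℕ 12 ⁻¹))
              ≈⟨ solve 3 (λ t g i → t :* (g :* :- i) := :- (g :* (t :* i))) refl (fromℕ 12) (fromℕ G) _ ⟩
          - (fromℕ G * (fromℕ 12 * fromℕ 12 ⁻¹))
              ≈⟨ -‿cong (trans (*-congˡ (x*x⁻¹≈1 (0<fromℕ 11))) (*-identityʳ _)) ⟩
          - fromℕ G                                         ≤⟨ neg-mono-≤ 12ln[2/β]≤G ⟩
          - (fromℕ 12 * ln (fromℕ 2 / β))
              ≈⟨ solve 2 (λ a b → :- (a :* b) := a :* :- b) refl (fromℕ 12) _ ⟩
          fromℕ 12 * - ln (fromℕ 2 / β)                     ∎)) ⟩
        exp (- ln (fromℕ 2 / β))                            ∎
        where
        open Ineq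

      2*exp[-ln[2/β]]≈β : fromℕ 2 * exp (- ln (fromℕ 2 / β)) ≈ β
      2*exp[-ln[2/β]]≈β = begin
        fromℕ 2 * exp (- L)                    ≈⟨ *-congʳ (x*[y/x]≈y (fromℕ 2) 0<β) ⟨
        β * (fromℕ 2 / β) * exp (- L)          ≈⟨ *-congʳ (*-congˡ (exp-ln (*-pos (0<fromℕ 1) (⁻¹-pos 0<β)))) ⟨
        β * exp L * exp (- L)                  ≈⟨ *-assoc _ _ _ ⟩
        β * (exp L * exp (- L))                ≈⟨ trans (*-congˡ (exp-inverse L)) (*-identityʳ β) ⟩
        β                                      ∎
        where
        open Eq
        L = ln (fromℕ 2 / β)

      rejectsFar : 1# - β ≤ ℙ (Manip P M) (_≟ᵛ notUniform)
      rejectsFar = ℙ-Manip P P-dist notUniform (begin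
        𝔼 publicRandomness (attack P P-dist (failure P P-dist notUniform ∘ aggregate))
            ≤⟨ mono Law-publicRandomness far-bound ⟩
        𝔼 publicRandomness (λ S → fromℕ 2 * exp (- ℓ) + prod (λ g → miss (lookup S g)))
            ≈⟨ trans (𝔼-+ publicRandomness _ _) (+-congʳ (const≈ Law-publicRandomness _)) ⟩
        fromℕ 2 * exp (- ℓ) + 𝔼 publicRandomness (λ S → prod (λ g → miss (lookup S g)))
            ≤⟨ +-monoʳ-≤ _ all-miss ⟩
        fromℕ 2 * exp (- ℓ) + exp (- ln (fromℕ 2 / β))
            ≤⟨ *-cancelˡ-≤ (0<fromℕ 1) halves-of-β ⟩
        β                                                                                     ∎)
        where
        open Ineq
        halves-of-β : fromℕ 2 * (fromℕ 2 * exp (- ℓ) + exp (- ln (fromℕ 2 / β))) ≤ fromℕ 2 * β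
        halves-of-β = begin
          fromℕ 2 * (fromℕ 2 * exp (- ℓ) + exp (- ln (fromℕ 2 / β)))
              ≈⟨ solve 2 (λ a b → num 2 :* (num 2 :* a :+ b) := num 4 :* num 1 :* a :+ num 2 :* b) refl _ _ ⟩
          fromℕ 4 * 1# * exp (- ℓ) + fromℕ 2 * exp (- ln (fromℕ 2 / β))
              ≤⟨ +-mono-≤ (*-monoʳ-≤ (0≤exp (- ℓ))
              (*-monoˡ-≤ (0≤fromℕ 4) (≤-trans (≤-reflexive (sym fromℕ-1)) (fromℕ-mono {1} {G} 1≤G))))
              (≤-reflexive 2*exp[-ln[2/β]]≈β) ⟩
          fromℕ 4 * fromℕ G * exp (- ℓ) + β                                ≈⟨ +-congʳ 4G*exp[-ℓ]≈β ⟩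
          β + β
              ≈⟨ solve 1 (λ b → b :+ b := num 2 :* b) refl β ⟩
          fromℕ 2 * β                                                      ∎

  -- The number of groups

  groupCount : ℝ → ℕ
  groupCount β = 4 ℕ.+ ⌈ fromℕ 12 * ln (fromℕ 2 / β) ⌉

  -- Brings exp (-G/12) down to at most β/2, the share of the failure probability left to the event
  -- that every group misses.
  12ln[2/β]≤groupCount : ∀ β → fromℕ 12 * ln (fromℕ 2 / β) ≤ fromℕ (groupCount β)
  12ln[2/β]≤groupCount β = ≤-trans (<⇒≤ (x<⌈x⌉ x)) (fromℕ-mono {⌈ x ⌉} {groupCount β} (ℕ.m≤n+m ⌈ x ⌉ 4))
    where x = fromℕ 12 * ln (fromℕ 2 / β)

  guarantees : Guarantees (fromℕ 48) groupCount
  guarantees β 0<β β<1 ε 0<ε k m 1≤m m≤Gk d 1≤d 2∣d M = acceptsUniform ,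
    λ P P-dist far → Far.rejectsFar 1≤m (ℕ.m≤m+n 4 _) (12ln[2/β]≤groupCount β) P P-dist far
    where
    -- At least one corrupted user among all users rules out empty groups.
    1≤k : ∀ k → m ℕ.≤ groupCount β ℕ.* k → 1 ℕ.≤ k
    1≤k (suc _) _   = ℕ.s≤s ℕ.z≤n
    1≤k zero    m≤0 = contradiction (ℕ.≤-trans 1≤m (≡.subst (m ℕ.≤_) (ℕ.*-zeroʳ (groupCount β)) m≤0)) λ ()
    open Guarantee (groupCount β) k ε m β d 0<ε 0<β β<1 (ℕ.s≤s ℕ.z≤n) (1≤k k m≤Gk) 1≤d 2∣d M

  -- Below 1/e the logarithm L of 1/β is at least 1 and absorbs the constants: G ≤ 4 + 12 (1 + L) +
  -- 1 = 17 + 12L ≤ 29L.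
  groupCount-Θ : IsΘ-log1/ groupCount
  groupCount-Θ = 1# , fromℕ 29 , exp (- 1#) , 0<1 , 0<fromℕ 28 , 0<exp _ , bounds
    where
    bounds : ∀ β → 0# < β → β < exp (- 1#) →
      1# * ln (1# / β) ≤ fromℕ (groupCount β) × fromℕ (groupCount β) ≤ fromℕ 29 * ln (1# / β)
    bounds β 0<β β<1/e = lower , upper
      where
      open Ineq
      L L₂ : ℝ
      L = ln (1# / β)
      L₂ = ln (fromℕ 2 / β)
      exp-L : exp L ≈ 1# / β
      exp-L = exp-ln (*-pos 0<1 (⁻¹-pos 0<β))
      exp-L₂ : exp L₂ ≈ fromℕ 2 / β
      exp-L₂ = exp-ln (*-pos (0<fromℕ 1) (⁻¹-pos 0<β))
      1≤L : 1# ≤ L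
      1≤L = exp-cancel-≤ (*-cancelˡ-≤ 0<β (begin
        β * exp 1#              ≤⟨ *-monoʳ-≤ (0≤exp 1#) (<⇒≤ β<1/e) ⟩
        exp (- 1#) * exp 1#     ≈⟨ trans (*-comm _ _) (exp-inverse 1#) ⟩
        1#                      ≈⟨ x*[y/x]≈y 1# 0<β ⟨
        β * (1# / β)            ≈⟨ *-congˡ exp-L ⟨
        β * exp L               ∎))
      L≤L₂ : L ≤ L₂
      L≤L₂ = exp-cancel-≤ (begin
        exp L         ≈⟨ exp-L ⟩
        1# / β        ≤⟨ *-monoʳ-≤ (<⇒≤ (⁻¹-pos 0<β)) (≤-by 0≤1 (solve 0 (num 2 := num 1 :+ num 1) refl)) ⟩
        fromℕ 2 / β   ≈⟨ exp-L₂ ⟨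
        exp L₂        ∎)
      -- From 2 = 1 + 1 ≤ exp 1.
      L₂≤1+L : L₂ ≤ 1# + L
      L₂≤1+L = exp-cancel-≤ (begin
        exp L₂             ≈⟨ exp-L₂ ⟩
        fromℕ 2 * β ⁻¹     ≈⟨ solve 1 (λ b → num 2 :* b := (num 1 :+ num 1) :* (num 1 :* b)) refl (β ⁻¹) ⟩
        (1# + 1#) * (1# / β) ≤⟨ *-monoʳ-≤ (≤-trans (0≤exp L) (≤-reflexive exp-L)) (1+x≤exp 1#) ⟩
        exp 1# * (1# / β)  ≈⟨ *-congˡ exp-L ⟨
        exp 1# * exp L     ≈⟨ exp-+ 1# L ⟨
        exp (1# + L)       ∎)
      0≤L₂ : 0# ≤ L₂
      0≤L₂ = ≤-trans 0≤1 (≤-trans 1≤L L≤L₂)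
      lower : 1# * L ≤ fromℕ (groupCount β)
      lower = begin
        1# * L                 ≈⟨ *-identityˡ L ⟩
        L                      ≤⟨ L≤L₂ ⟩
        L₂
            ≤⟨ ≤-by (0≤* (0≤fromℕ 11) 0≤L₂) (solve 1 (λ x → num 12 :* x := x :+ num 11 :* x) refl L₂) ⟩
        fromℕ 12 * L₂          ≤⟨ 12ln[2/β]≤groupCount β ⟩
        fromℕ (groupCount β)   ∎
      upper : fromℕ (groupCount β) ≤ fromℕ 29 * L
      upper = begin
        fromℕ (groupCount β)                        ≈⟨ fromℕ-+ 4 ⌈ fromℕ 12 * L₂ ⌉ ⟩
        fromℕ 4 + fromℕ ⌈ fromℕ 12 * L₂ ⌉           ≤⟨ +-monoʳ-≤ _ (⌈x⌉≤x+1 (0≤* (0≤fromℕ 12) 0≤L₂)) ⟩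
        fromℕ 4 + (fromℕ 12 * L₂ + 1#)
            ≤⟨ ≤-by (0≤+ (0≤* (0≤fromℕ 12) (≤⇒0≤- L₂≤1+L)) (0≤* (0≤fromℕ 17) (≤⇒0≤- 1≤L)))
            (solve 2 (λ x y → num 29 :* x := num 4 :+ (num 12 :* y :+ num 1) :+
                (num 12 :* (num 1 :+ x :- y) :+ num 17 :* (x :- num 1))) refl L L₂) ⟩
        fromℕ 29 * L                                ∎

open RealNumbers using (ℝ; 0#; _<_)
open Game using (IsΘ-log1/; PositiveOn⟨0,1⟩; Guarantees)

mainTheorem16 : (ℛ : RealNumbers) →
    ∃ λ (c : ℝ ℛ) → ∃ λ (G : ℝ ℛ → ℕ) →
    _<_ ℛ (0# ℛ) c × PositiveOn⟨0,1⟩ ℛ G × IsΘ-log1/ ℛ G × Guarantees ℛ c G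
mainTheorem16 ℛ = fromℕ 48 , groupCount , 0<fromℕ 47 , (λ _ _ _ → ℕ.s≤s ℕ.z≤n) , groupCount-Θ , guarantees
  where
  open RealNumbers ℛ using (fromℕ)
  open Proof ℛ using (groupCount; 0<fromℕ; groupCount-Θ; guarantees)
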